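{- Let $M$ be a loopless matroid with ground set $E$. Then \[ Z_M^{\mathrm{top}}(0) = 1, \] and \[ \left(\frac{d}{ds} Z^{\mathrm{top}}_M(s)\right) \Big|_{s = 0} = - \# E. \]
   Context: For a matroid $M$ on $E$ with rank function $\operatorname{rk}$, let $\operatorname{wt}_M(w)=\max_{B\text{ basis}}\sum_{e\in B}w_e$ for $w\in\mathbb{R}^E$, let $M_w$ be the matroid whose bases are the bases attaining this maximum, $|w|=\sum_e w_e$, and let $Z_M(q,T)=\sum_{w\in\mathbb{Z}_{\ge0}^E}\chi_{M_w}(q)q^{ -\operatorname{rk}M-\operatorname{wt}_M(w)}T^{|w|}$ ($\chi$ the characteristic polynomial). Let $\mathbb{Z}[q^{\pm1}]\llbracket T\rrbracket_{\mathrm{rat}}$ be the $\mathbb{Z}[q^{\pm1}]$-subalgebra of $\mathbb{Z}[q^{\pm1}]\llbracket T\rrbracket$ generated by the elements $(q-1)q^bT^a/(1-q^bT^a)$, $a\in\mathbb{Z}_{>0},b\in\mathbb{Z}$; it contains $Z_M(q,T)$. Let $\mu_{\mathrm{top}}:\mathbb{Z}[q^{\pm1}]\llbracket T\rrbracket_{\mathrm{rat}}\to\mathbb{Q}(s)$ be the ring morphism with $\mu_{\mathrm{top}}(q)=1$ and $\mu_{\mathrm{top}}((q-1)q^bT^a/(1-q^bT^a))=1/(as-b)$. The topological zeta function is $Z_M^{\mathrm{top}}(s)=\mu_{\mathrm{top}}(Z_M(q,T))$. -}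

module Defs where

open import Data.Bool using (Bool; true; false; _∧_; T; if_then_else_)
open import Data.Nat as ℕ using (ℕ; zero; suc; _⊔_; _<_; NonZero)
open import Data.Nat.Divisibility using (_∣?_)
open import Data.Integer as ℤ using (ℤ; +_; -[1+_])
open import Data.Rational as ℚ using (ℚ; 0ℚ; 1ℚ)
open import Data.Fin using (Fin)
open import Data.Fin.Subset using (Subset; inside; outside; _∩_; ⊤; ⁅_⁆; ∣_∣; _∈_; _∉_)
open import Data.Vec using (Vec; []; _∷_; _[_]≔_; zipWith; toList)
open import Data.List as L using (List; []; _∷_; _++_; map; concatMap; filter; upTo; foldr)
open import Data.Product using (Σ; Σ-syntax; ∃; _×_; _,_)
open import Relation.Nullary using (¬_; does)
open import Relation.Binary.PropositionalEquality using (_≡_)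

allSubsets : (n : ℕ) → List (Subset n)
allSubsets zero = [] ∷ []
allSubsets (suc n) = concatMap (λ S → (inside ∷ S) ∷ (outside ∷ S) ∷ []) (allSubsets n)

weightsOfSize : (n N : ℕ) → List (Vec ℕ n)
weightsOfSize zero zero = [] ∷ []
weightsOfSize zero (suc N) = []
weightsOfSize (suc n) N = concatMap (λ k → map (k ∷_) (weightsOfSize n (N ℕ.∸ k))) (upTo (suc N))

maxList : List ℕ → ℕ
maxList = foldr _⊔_ 0

sumℤ : List ℤ → ℤ
sumℤ = foldr ℤ._+_ (+ 0)

record Matroid (n : ℕ) : Set where
  field
    isBasis   : Subset n → Bool
    nonempty  : ∃ λ B → T (isBasis B)
    exchange  : ∀ B₁ B₂ → T (isBasis B₁) → T (isBasis B₂) →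
                ∀ x → x ∈ B₁ → x ∉ B₂ →
                Σ[ y ∈ Fin n ] (y ∈ B₂ × y ∉ B₁ ×
                   T (isBasis ((B₁ [ x ]≔ outside) [ y ]≔ inside)))
open Matroid public

rankOf : ∀ {n} → (Subset n → Bool) → Subset n → ℕ
rankOf {n} bs A = maxList (map (λ B → ∣ A ∩ B ∣) (filter (λ B → T? (bs B)) (allSubsets n)))
  where
  open import Relation.Nullary.Decidable using (Dec)
  T? : (b : Bool) → Dec (T b)
  T? = Data.Bool.T?
    where import Data.Bool

rk : ∀ {n} → Matroid n → Subset n → ℕ
rk M = rankOf (isBasis M)

rkM : ∀ {n} → Matroid n → ℕ
rkM M = rk M ⊤

Loopless : ∀ {n} → Matroid n → Set
Loopless {n} M = ∀ (e : Fin n) → rk M ⁅ e ⁆ ≡ 1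

-- Laurent polynomials in q with integer coefficients, as finite formal
-- sums of terms (exponent , coefficient).

Laurent : Set
Laurent = List (ℤ × ℤ)

coeffL : Laurent → ℤ → ℤ
coeffL p j = sumℤ (map (λ { (e , c) → if does (e ℤ.≟ j) then c else + 0 }) p)

_≈L_ : Laurent → Laurent → Set
p ≈L r = ∀ j → coeffL p j ≡ coeffL r j

mulL : Laurent → Laurent → Laurent
mulL p r = concatMap (λ { (e , c) → map (λ { (e' , c') → (e ℤ.+ e' , c ℤ.* c') }) r }) p

shiftL : ℤ → Laurent → Laurent
shiftL k = map (λ { (e , c) → (k ℤ.+ e , c) })

evalAt1 : Laurent → ℤ
evalAt1 p = sumℤ (map (λ { (e , c) → c }) p)

sign : ℕ → ℤ
sign zero = + 1
sign (suc k) = ℤ.- sign k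

χ : ∀ {n} → (Subset n → Bool) → Laurent
χ {n} bs = map (λ A → ((+ rankOf bs ⊤) ℤ.- (+ rankOf bs A) , sign ∣ A ∣)) (allSubsets n)

wsum : ∀ {n} → Vec ℕ n → Subset n → ℕ
wsum w B = foldr ℕ._+_ 0 (toList (zipWith (λ we b → if b then we else 0) w B))

wt : ∀ {n} → Matroid n → Vec ℕ n → ℕ
wt {n} M w = maxList (map (λ B → if isBasis M B then wsum w B else 0) (allSubsets n))

basesW : ∀ {n} → Matroid n → Vec ℕ n → Subset n → Bool
basesW M w B = isBasis M B ∧ does (wsum w B ℕ.≟ wt M w)

Series : Set
Series = ℕ → Laurent

_≈S_ : Series → Series → Set
f ≈S g = ∀ N → f N ≈L g N

Z : ∀ {n} → Matroid n → Series
Z {n} M N = concatMap (λ w → shiftL (ℤ.- (+ (rkM M ℕ.+ wt M w))) (χ (basesW M w)))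
                      (weightsOfSize n N)

-- Expressions for elements of ℤ[q^{±1}][[T]]_rat: the ℤ[q^{±1}]-algebra
-- generated by (q-1) q^b T^a / (1 - q^b T^a), a > 0, b ∈ ℤ.

data Expr : Set where
  const : Laurent → Expr
  gen   : (a : ℕ) → .{{_ : NonZero a}} → (b : ℤ) → Expr
  _⊕_   : Expr → Expr → Expr
  _⊗_   : Expr → Expr → Expr

-- (q-1) q^b T^a/(1-q^b T^a) = Σ_{k≥1} (q^{bk+1} - q^{bk}) T^{ak}
genCoeff : (a : ℕ) → .{{_ : NonZero a}} → ℤ → ℕ → Laurent
genCoeff a b zero = []
genCoeff a b (suc N) with does (a ∣? suc N)
... | false = []
... | true  = let k = + (suc N ℕ./ a) in
              ((b ℤ.* k) ℤ.+ + 1 , + 1) ∷ (b ℤ.* k , ℤ.- + 1) ∷ []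

⟦_⟧ : Expr → Series
⟦ const p ⟧ zero = p
⟦ const p ⟧ (suc N) = []
⟦ gen a b ⟧ N = genCoeff a b N
⟦ e ⊕ f ⟧ N = ⟦ e ⟧ N ++ ⟦ f ⟧ N
⟦ e ⊗ f ⟧ N = concatMap (λ m → mulL (⟦ e ⟧ m) (⟦ f ⟧ (N ℕ.∸ m))) (upTo (suc N))

-- Polynomials over ℚ in s (ascending coefficient lists) and fractions

Poly : Set
Poly = List ℚ

addP : Poly → Poly → Poly
addP [] r = r
addP (x ∷ p) [] = x ∷ p
addP (x ∷ p) (y ∷ r) = (x ℚ.+ y) ∷ addP p r

mulP : Poly → Poly → Poly
mulP [] r = []
mulP (x ∷ p) r = addP (map (x ℚ.*_) r) (0ℚ ∷ mulP p r)

negP : Poly → Poly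
negP = map (λ x → ℚ.- x)

coeffP : Poly → ℕ → ℚ
coeffP [] i = 0ℚ
coeffP (x ∷ p) zero = x
coeffP (x ∷ p) (suc i) = coeffP p i

-- a rational function N/D in ℚ(s), as (numerator , denominator)
Frac : Set
Frac = Poly × Poly

ℤtoℚ : ℤ → ℚ
ℤtoℚ z = z ℚ./ 1

-- μ_top : q ↦ 1, (q-1)q^bT^a/(1-q^bT^a) ↦ 1/(a s - b)
μtop : Expr → Frac
μtop (const p) = (ℤtoℚ (evalAt1 p) ∷ []) , (1ℚ ∷ [])
μtop (gen a b) = (1ℚ ∷ []) , (ℚ.- ℤtoℚ b ∷ ℤtoℚ (+ a) ∷ [])
μtop (e ⊕ f) with μtop e | μtop f
... | (n₁ , d₁) | (n₂ , d₂) = addP (mulP n₁ d₂) (mulP n₂ d₁) , mulP d₁ d₂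
μtop (e ⊗ f) with μtop e | μtop f
... | (n₁ , d₁) | (n₂ , d₂) = mulP n₁ n₂ , mulP d₁ d₂

-- f = N/D is regular at s = 0 with f(0) = v and f'(0) = d,
-- i.e. f(s) = v + d s + O(s²): ord₀(N - D·(v + d s)) ≥ ord₀(D) + 2.
ValDerivAt0 : Frac → ℚ → ℚ → Set
ValDerivAt0 (N , D) v d =
  Σ[ k ∈ ℕ ] ((∀ i → i < k → coeffP D i ≡ 0ℚ) × ¬ (coeffP D k ≡ 0ℚ) ×
              (∀ i → i < k ℕ.+ 2 → coeffP (addP N (negP (mulP D (v ∷ d ∷ [])))) i ≡ 0ℚ))

{-# OPTIONS --safe #-}

-- A Laurent polynomial is treated as the functional ⟨ p , g ⟩ = Σ c g(e) on functions g : ℤ → ℤ, and a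
-- series as a functional on functions of (N, e) that vanish for large N; products then become iterated
-- pairings.
--
-- Well-definedness of μtop: clearing denominators writes e as num e / den e with polynomials in q^±1 and T.
-- Under T ↦ q^(−t) both are divisible by (q − 1)^(ord e), with cofactors at q = 1 equal to the numerator and
-- denominator of μtop e at s = t. So ⟦ e ⟧ = ⟦ f ⟧ forces the cross-multiplied identity at every t, hence as
-- polynomials in s.
--
-- Rationality: with r the rank function, S the support of w and w′ = w − 1_S, the number
-- ρ(w, A) = wt w + rank_{M_w} A satisfies ρ(w, A) = r(A ∪ S) + ρ(w′, A ∩ S). Hence the zeta functions Z_F of
-- the restrictions to F satisfy
--   Z_F = Σ_{S ⊆ F} c(F, S) T^|S| Z_S,   c(F, S) = Σ_{S ⊆ A ⊆ F} (−1)^|A ∖ S| q^(−r A),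
-- where q − 1 divides c(F, S) for S ≠ F and c(F, F) = q^(−r F). Solving for Y_F = q^(−r F) T^|F| Z_F, its
-- image y_F under μtop satisfies (|F| s + r F) y_F = Σ_{S ⊊ F} c′(F, S)(1) y_S. Möbius inversion gives
-- Σ_{S ⊊ F} c′(F, S)(1) = r F and, by looplessness, Σ_{S ⊊ F} |S| c′(F, S)(1) = |F| (r F − 1), so
-- y_F = 1 − |F| s + O(s²) by induction, and Z_E has the same image as Y_E.

module Submission where

open import Defs
open import Algebra.Properties.CommutativeSemigroup using () renaming (interchange to ·-interchange; x∙yz≈y∙xz to ·-x∙yz≈y∙xz)
open import Data.Bool using (Bool; true; false; T; if_then_else_)
open import Data.Bool.Properties using (T-∧)
open import Data.Empty using (⊥-elim)
open import Data.Fin using (zero; suc)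
open import Data.Fin.Subset using (Subset; inside; outside; _∈_; _∉_; _∩_; _∪_; _─_; ∣_∣; ⊤; ⊥; ⁅_⁆)
import Data.Fin.Subset.Properties as Subₚ
open import Data.Integer as ℤ using (ℤ; +_; -[1+_]; _+_; _*_; -_; _-_; 0ℤ; 1ℤ)
open import Data.Integer.Properties as ℤₚ using (+-identityˡ; +-identityʳ; *-zeroʳ; *-zeroˡ; *-identityˡ; +-comm; +-assoc)
open import Data.Integer.Tactic.RingSolver using (solve-∀)
open import Data.List using (List; []; _∷_; _++_; map; concatMap; upTo; foldr; length)
import Data.List.Membership.Propositional as List
open import Data.List.Membership.Propositional.Properties using (∈-++⁺ˡ; ∈-++⁺ʳ; ∈-map⁺; ∈-map⁻; ∈-filter⁺; ∈-filter⁻; ∈-concatMap⁺; ∈-upTo⁻)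
open import Data.List.Properties using (map-upTo; upTo-∷ʳ)
open import Data.List.Relation.Unary.All as All using (All; []; _∷_)
import Data.List.Relation.Unary.All.Properties as Allₚ
open import Data.List.Relation.Unary.Any as Any using (here; there)
open import Data.Nat as ℕ using (ℕ; zero; suc; z≤n; s≤s)
open import Data.Nat.Divisibility using (_∣_; _∣?_; divides; ∣m+n∣m⇒∣n; ∣-refl; >⇒∤)
open import Data.Nat.DivMod using (m*n/n≡m)
import Data.Nat.Properties as ℕₚ
open import Data.Nat.Tactic.RingSolver using () renaming (solve-∀ to solveℕ-∀)
open import Data.Product using (Σ-syntax; _×_; _,_; proj₁; proj₂; ∃; uncurry)
open import Data.Rational as ℚ using (ℚ; 0ℚ; 1ℚ; toℚᵘ) renaming (-_ to ℚneg)
import Data.Rational.Properties as ℚₚ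
open import Data.Rational.Unnormalised as ℚᵘ using (mkℚᵘ; *≡*)
import Data.Rational.Unnormalised.Properties as ℚᵘₚ
open import Data.Sum using (_⊎_; inj₁; inj₂)
open import Data.Unit using (tt)
open import Data.Vec using (Vec; []; _∷_; _[_]≔_; zipWith; here; there; replicate; sum)
open import Data.Vec.Properties using (updateAt-minimal)
open import Function using (_∘_; id; Equivalence)
open import Level using (0ℓ)
open import Relation.Binary.PropositionalEquality
open import Relation.Nullary using (Dec; yes; no; ¬_; does)
open import Relation.Nullary.Decidable using (dec-true; dec-false; dec⇒maybe)
open import Tactic.RingSolver using () renaming (solve-∀ to solve-∀-in)
open import Tactic.RingSolver.Core.AlmostCommutativeRing using (AlmostCommutativeRing; fromCommutativeRing)
open ≡-Reasoning

-- `μtop` is defined on syntax and the theorem speaks of every expression for `Z M`, so comparing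
-- two expressions of one series is half of the work. The substitution T ↦ q^(-t) makes no sense on
-- a series, only on cleared numerators and denominators. It is chosen because 1 - q^b T^a becomes 1
-- - q^(b - a t), whose quotient by q - 1 takes the value a t - b at q = 1: this is the denominator
-- of `μtop` at s = t, and a polynomial in s is determined by its values at the integers t ≥ 0.
--
-- An arbitrary expression may have a denominator vanishing at s = 0. The constructed one does not:
-- its denominators are products of factors |F| s + r F, and r F > 0 for nonempty F by looplessness.
-- So only this expression is expanded at 0, and the expansion is then transferred.
--
-- Y_F is the contribution of the weights with support exactly F, that is, the term S = F of the
-- recursion. Moving it to the left leaves (1 - q^(-r F) T^|F|) Z_F, and the factor q - 1 taken out
-- of c(F, S) is the one in the numerator of the generator. In the final sum Z_E - Y_E the
-- coefficients c(E, S) stay undivided, hence vanish at q = 1.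

private variable
  n : ℕ
  A B X Y : Set

-- Sums over lists and formal sums

addˡ : ∀ a {b c} → b ≡ c → a + b ≡ a + c
addˡ a = cong (λ x → a + x)

zero+ : ∀ {a} b → a ≡ 0ℤ → a + b ≡ b
zero+ b refl = +-identityˡ b

+zero : ∀ a {b} → b ≡ 0ℤ → a + b ≡ a
+zero a refl = +-identityʳ a

interchange : ∀ a b c d → (a + b) + (c + d) ≡ (a + c) + (b + d)
interchange = solve-∀

-- Opaque, so that unification can recover the summand from a sum.
opaque

  ∑ : List A → (A → ℤ) → ℤ
  ∑ xs h = sumℤ (map h xs)

  ∑-sumℤ : (xs : List A) (h : A → ℤ) → sumℤ (map h xs) ≡ ∑ xs h
  ∑-sumℤ xs h = refl

  ∑-[] : (h : A → ℤ) → ∑ [] h ≡ 0ℤ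
  ∑-[] h = refl

  ∑-∷ : ∀ x (xs : List A) h → ∑ (x ∷ xs) h ≡ h x + ∑ xs h
  ∑-∷ x xs h = refl

  ∑-cong-∈ : (xs : List A) {h k : A → ℤ} → (∀ x → x List.∈ xs → h x ≡ k x) → ∑ xs h ≡ ∑ xs k
  ∑-cong-∈ [] eq = refl
  ∑-cong-∈ (x ∷ xs) eq = cong₂ _+_ (eq x (here refl)) (∑-cong-∈ xs λ y m → eq y (there m))

  ∑-cong : (xs : List A) {h k : A → ℤ} → (∀ x → h x ≡ k x) → ∑ xs h ≡ ∑ xs k
  ∑-cong xs eq = ∑-cong-∈ xs λ x _ → eq x

  ∑-zero : (xs : List A) {h : A → ℤ} → (∀ x → h x ≡ 0ℤ) → ∑ xs h ≡ 0ℤ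
  ∑-zero [] eq = refl
  ∑-zero (x ∷ xs) eq = cong₂ _+_ (eq x) (∑-zero xs eq)

  ∑-++ : (xs ys : List A) (h : A → ℤ) → ∑ (xs ++ ys) h ≡ ∑ xs h + ∑ ys h
  ∑-++ [] ys h = sym (+-identityˡ _)
  ∑-++ (x ∷ xs) ys h = trans (addˡ (h x) (∑-++ xs ys h)) (sym (+-assoc (h x) _ _))

  ∑-map : (f : A → B) (xs : List A) (h : B → ℤ) → ∑ (map f xs) h ≡ ∑ xs (h ∘ f)
  ∑-map f [] h = refl
  ∑-map f (x ∷ xs) h = addˡ (h (f x)) (∑-map f xs h)

  ∑-concatMap : (f : A → List B) (xs : List A) (h : B → ℤ) →
    ∑ (concatMap f xs) h ≡ ∑ xs (λ x → ∑ (f x) h)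
  ∑-concatMap f [] h = refl
  ∑-concatMap f (x ∷ xs) h =
    trans (∑-++ (f x) (concatMap f xs) h) (addˡ (∑ (f x) h) (∑-concatMap f xs h))

  ∑-+ : (xs : List A) (h k : A → ℤ) → ∑ xs (λ x → h x + k x) ≡ ∑ xs h + ∑ xs k
  ∑-+ [] h k = refl
  ∑-+ (x ∷ xs) h k = trans (addˡ (h x + k x) (∑-+ xs h k)) (interchange (h x) (k x) _ _)

  ∑-*ˡ : (c : ℤ) (xs : List A) (h : A → ℤ) → ∑ xs (λ x → c * h x) ≡ c * ∑ xs h
  ∑-*ˡ c [] h = sym (*-zeroʳ c)
  ∑-*ˡ c (x ∷ xs) h = trans (addˡ (c * h x) (∑-*ˡ c xs h)) (sym (ℤₚ.*-distribˡ-+ c (h x) _))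

  ∑-neg : (xs : List A) (h : A → ℤ) → ∑ xs (λ x → - h x) ≡ - ∑ xs h
  ∑-neg [] h = refl
  ∑-neg (x ∷ xs) h = trans (addˡ (- h x) (∑-neg xs h)) (sym (ℤₚ.neg-distrib-+ (h x) _))

  ∑-minus : (xs : List A) (h k : A → ℤ) → ∑ xs (λ x → h x - k x) ≡ ∑ xs h - ∑ xs k
  ∑-minus xs h k = trans (∑-+ xs h (λ x → - k x)) (addˡ (∑ xs h) (∑-neg xs k))

  ∑-swap : (xs : List A) (ys : List B) (h : A → B → ℤ) →
    ∑ xs (λ x → ∑ ys (h x)) ≡ ∑ ys (λ y → ∑ xs (λ x → h x y))
  ∑-swap [] ys h = sym (∑-zero ys λ _ → refl)
  ∑-swap (x ∷ xs) ys h =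
    trans (addˡ (∑ ys (h x)) (∑-swap xs ys h)) (sym (∑-+ ys (h x) (λ y → ∑ xs (λ x → h x y))))

∑-upTo-suc : ∀ K (h : ℕ → ℤ) → ∑ (upTo (suc K)) h ≡ h 0 + ∑ (upTo K) (h ∘ suc)
∑-upTo-suc K h = trans (∑-∷ 0 _ h)
  (addˡ (h 0) (trans (cong (λ l → ∑ l h) (sym (map-upTo suc K))) (∑-map suc (upTo K) h)))

∑-singleton : (x : A) (h : A → ℤ) → ∑ (x ∷ []) h ≡ h x
∑-singleton x h = trans (∑-∷ x [] h) (+zero (h x) (∑-[] h))

∑-upTo-last : ∀ K (h : ℕ → ℤ) → ∑ (upTo (suc K)) h ≡ ∑ (upTo K) h + h K
∑-upTo-last K h = trans (cong (λ l → ∑ l h) (sym (upTo-∷ʳ K)))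
  (trans (∑-++ (upTo K) (K ∷ []) h) (addˡ (∑ (upTo K) h) (∑-singleton K h)))

∑-upTo-extend : ∀ K (h : ℕ → ℤ) → h K ≡ 0ℤ → ∑ (upTo (suc K)) h ≡ ∑ (upTo K) h
∑-upTo-extend K h eq = trans (∑-upTo-last K h) (trans (addˡ (∑ (upTo K) h) eq) (+-identityʳ _))

-- Terms with `m + l ≥ K` vanish, so the triangle and the square have the same sum.
∑-cauchy : ∀ K (h : ℕ → ℕ → ℤ) → (∀ m l → K ℕ.≤ m ℕ.+ l → h m l ≡ 0ℤ) →
  ∑ (upTo K) (λ N → ∑ (upTo (suc N)) (λ m → h m (N ℕ.∸ m))) ≡
  ∑ (upTo K) (λ m → ∑ (upTo K) (λ l → h m l))
∑-cauchy zero h v = trans (∑-[] _) (sym (∑-[] _))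
∑-cauchy (suc K) h v = begin
  ∑ (upTo (suc K)) (λ N → ∑ (upTo (suc N)) (λ m → h m (N ℕ.∸ m)))
    ≡⟨ ∑-cong (upTo (suc K)) (λ N → ∑-upTo-suc N (λ m → h m (N ℕ.∸ m))) ⟩
  ∑ (upTo (suc K)) (λ N → h 0 N + ∑ (upTo N) (λ m → h (suc m) (N ℕ.∸ suc m)))
    ≡⟨ ∑-+ (upTo (suc K)) (h 0) _ ⟩
  ∑ (upTo (suc K)) (h 0) + ∑ (upTo (suc K)) (λ N → ∑ (upTo N) (λ m → h (suc m) (N ℕ.∸ suc m)))
    ≡⟨ addˡ (∑ (upTo (suc K)) (h 0))
         (trans (∑-upTo-suc K (λ N → ∑ (upTo N) (λ m → h (suc m) (N ℕ.∸ suc m))))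
           (zero+ _ (∑-[] _))) ⟩
  ∑ (upTo (suc K)) (h 0) + ∑ (upTo K) (λ N → ∑ (upTo (suc N)) (λ m → h (suc m) (N ℕ.∸ m)))
    ≡⟨ addˡ (∑ (upTo (suc K)) (h 0)) (∑-cauchy K (h ∘ suc) λ m l le → v (suc m) l (s≤s le)) ⟩
  ∑ (upTo (suc K)) (h 0) + ∑ (upTo K) (λ m → ∑ (upTo K) (h (suc m)))
    ≡⟨ addˡ (∑ (upTo (suc K)) (h 0))
         (∑-cong (upTo K) λ m → sym (∑-upTo-extend K (h (suc m)) (v (suc m) K (s≤s (ℕₚ.m≤n+m K m))))) ⟩
  ∑ (upTo (suc K)) (h 0) + ∑ (upTo K) (λ m → ∑ (upTo (suc K)) (h (suc m)))
    ≡⟨ sym (∑-upTo-suc K (λ m → ∑ (upTo (suc K)) (h m))) ⟩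
  ∑ (upTo (suc K)) (λ m → ∑ (upTo (suc K)) (h m)) ∎

-- Since `h` vanishes from `K` on, the range can keep its length when the index is shifted.
∑-upTo-shift : ∀ a K (h : ℕ → ℤ) → (∀ N → K ℕ.≤ N → h N ≡ 0ℤ) →
  ∑ (upTo K) h ≡ ∑ (upTo a) h + ∑ (upTo K) (λ N → h (a ℕ.+ N))
∑-upTo-shift zero K h v = sym (zero+ _ (∑-[] h))
∑-upTo-shift (suc a) K h v = begin
  ∑ (upTo K) h ≡⟨ sym (∑-upTo-extend K h (v K ℕₚ.≤-refl)) ⟩
  ∑ (upTo (suc K)) h ≡⟨ ∑-upTo-suc K h ⟩
  h 0 + ∑ (upTo K) (h ∘ suc)
    ≡⟨ addˡ (h 0) (∑-upTo-shift a K (h ∘ suc) λ N le → v (suc N) (ℕₚ.m≤n⇒m≤1+n le)) ⟩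
  h 0 + (∑ (upTo a) (h ∘ suc) + ∑ (upTo K) (λ N → h (suc (a ℕ.+ N)))) ≡⟨ sym (+-assoc (h 0) _ _) ⟩
  h 0 + ∑ (upTo a) (h ∘ suc) + ∑ (upTo K) (λ N → h (suc (a ℕ.+ N)))
    ≡⟨ cong (_+ ∑ (upTo K) (λ N → h (suc (a ℕ.+ N)))) (sym (∑-upTo-suc a h)) ⟩
  ∑ (upTo (suc a)) h + ∑ (upTo K) (λ N → h (suc (a ℕ.+ N))) ∎

FormalSum : Set → Set
FormalSum X = List (X × ℤ)

⟨_,_⟩ : FormalSum X → (X → ℤ) → ℤ
⟨ p , g ⟩ = ∑ p (λ t → proj₂ t * g (proj₁ t))

⟨⟩-cong : (p : FormalSum X) {g h : X → ℤ} → (∀ x → g x ≡ h x) → ⟨ p , g ⟩ ≡ ⟨ p , h ⟩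
⟨⟩-cong p eq = ∑-cong p λ t → cong (proj₂ t *_) (eq (proj₁ t))

⟨⟩-zero : (p : FormalSum X) {g : X → ℤ} → (∀ x → g x ≡ 0ℤ) → ⟨ p , g ⟩ ≡ 0ℤ
⟨⟩-zero p eq = ∑-zero p λ t → trans (cong (proj₂ t *_) (eq (proj₁ t))) (*-zeroʳ (proj₂ t))

⟨⟩-+ : (p : FormalSum X) (g h : X → ℤ) → ⟨ p , (λ x → g x + h x) ⟩ ≡ ⟨ p , g ⟩ + ⟨ p , h ⟩
⟨⟩-+ p g h = trans (∑-cong p λ t → ℤₚ.*-distribˡ-+ (proj₂ t) _ _) (∑-+ p _ _)

⟨⟩-*ˡ : (c : ℤ) (p : FormalSum X) (g : X → ℤ) → ⟨ p , (λ x → c * g x) ⟩ ≡ c * ⟨ p , g ⟩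
⟨⟩-*ˡ c p g = trans (∑-cong p λ t → swap* (proj₂ t) c (g (proj₁ t))) (∑-*ˡ c p _)
  where
  swap* : ∀ a b x → a * (b * x) ≡ b * (a * x)
  swap* = solve-∀

⟨⟩-neg : (p : FormalSum X) (g : X → ℤ) → ⟨ p , (λ x → - g x) ⟩ ≡ - ⟨ p , g ⟩
⟨⟩-neg p g = trans (∑-cong p λ t → sym (ℤₚ.neg-distribʳ-* (proj₂ t) _)) (∑-neg p _)

⟨⟩-minus : (p : FormalSum X) (g h : X → ℤ) → ⟨ p , (λ x → g x - h x) ⟩ ≡ ⟨ p , g ⟩ - ⟨ p , h ⟩
⟨⟩-minus p g h = trans (⟨⟩-+ p g (λ x → - h x)) (addˡ (⟨ p , g ⟩) (⟨⟩-neg p h))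

⟨⟩-∑ : (p : FormalSum X) (xs : List A) (h : A → X → ℤ) →
  ⟨ p , (λ x → ∑ xs (λ a → h a x)) ⟩ ≡ ∑ xs (λ a → ⟨ p , h a ⟩)
⟨⟩-∑ p xs h = trans (∑-cong p λ t → sym (∑-*ˡ (proj₂ t) xs _)) (∑-swap p xs _)

⟨⟩-swap : (p : FormalSum X) (r : FormalSum Y) (h : X → Y → ℤ) →
  ⟨ p , (λ x → ⟨ r , h x ⟩) ⟩ ≡ ⟨ r , (λ y → ⟨ p , (λ x → h x y) ⟩) ⟩
⟨⟩-swap p r h = trans (⟨⟩-∑ p r λ t x → proj₂ t * h x (proj₁ t))
  (∑-cong r λ t → ⟨⟩-*ˡ (proj₂ t) p (λ x → h x (proj₁ t)))

conv : (X → X → X) → FormalSum X → FormalSum X → FormalSum X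
conv _∙_ p r = concatMap (λ { (e , c) → map (λ { (e' , c') → (e ∙ e' , c * c') }) r }) p

⟨conv⟩ : (_∙_ : X → X → X) (p r : FormalSum X) (g : X → ℤ) →
  ⟨ conv _∙_ p r , g ⟩ ≡ ⟨ p , (λ x → ⟨ r , (λ y → g (x ∙ y)) ⟩) ⟩
⟨conv⟩ _∙_ p r g = trans (∑-concatMap _ p _) (∑-cong p λ { (e , c) →
  trans (∑-map _ r _) (trans (∑-cong r λ { (e' , c') → ℤₚ.*-assoc c c' _ }) (∑-*ˡ c r _)) })

⟨mulL⟩ : (p r : Laurent) (g : ℤ → ℤ) → ⟨ mulL p r , g ⟩ ≡ ⟨ p , (λ x → ⟨ r , (λ y → g (x + y)) ⟩) ⟩
⟨mulL⟩ p r g = trans (∑-concatMap _ p _) (∑-cong p λ { (e , c) →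
  trans (∑-map _ r _) (trans (∑-cong r λ { (e' , c') → ℤₚ.*-assoc c c' _ }) (∑-*ˡ c r _)) })

⟨shiftL⟩ : (k : ℤ) (p : Laurent) (g : ℤ → ℤ) → ⟨ shiftL k p , g ⟩ ≡ ⟨ p , (λ x → g (k + x)) ⟩
⟨shiftL⟩ k p g = ∑-map _ p _

evalAt1-⟨⟩ : (p : Laurent) → evalAt1 p ≡ ⟨ p , (λ _ → 1ℤ) ⟩
evalAt1-⟨⟩ p = trans (∑-sumℤ p _) (∑-cong p λ { (e , c) → sym (ℤₚ.*-identityʳ c) })

-- Equal coefficients versus equal pairings

δ : ℤ → ℤ → ℤ
δ j e = if does (e ℤ.≟ j) then 1ℤ else 0ℤ

coeffL-⟨⟩ : (p : Laurent) (j : ℤ) → coeffL p j ≡ ⟨ p , δ j ⟩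
coeffL-⟨⟩ p j = trans (∑-sumℤ p _) (∑-cong p λ { (e , c) → lem (does (e ℤ.≟ j)) c })
  where
  lem : ∀ b c → (if b then c else 0ℤ) ≡ c * (if b then 1ℤ else 0ℤ)
  lem true c = sym (ℤₚ.*-identityʳ c)
  lem false c = sym (*-zeroʳ c)

offAt : ℤ → (ℤ → ℤ) → ℤ → ℤ
offAt x g y = if does (y ℤ.≟ x) then 0ℤ else g y

off : List ℤ → (ℤ → ℤ) → ℤ → ℤ
off [] g = g
off (x ∷ J) g = offAt x (off J g)

offAt-split : ∀ x g y → g y ≡ g x * δ x y + offAt x g y
offAt-split x g y with y ℤ.≟ x
... | yes refl = lem (g x) where
  lem : ∀ a → a ≡ a * 1ℤ + 0ℤ
  lem = solve-∀
... | no _ = lem (g x) (g y) where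
  lem : ∀ a b → b ≡ a * 0ℤ + b
  lem = solve-∀

off-∈ : ∀ J g y → y List.∈ J → off J g y ≡ 0ℤ
off-∈ (x ∷ J) g y m with y ℤ.≟ x
off-∈ (x ∷ J) g y m | yes _ = refl
off-∈ (x ∷ J) g y (here eq) | no ne = ⊥-elim (ne eq)
off-∈ (x ∷ J) g y (there m) | no _ = off-∈ J g y m

⟨⟩-off : (p r : Laurent) → p ≈L r → ∀ J g → ⟨ p , off J g ⟩ ≡ ⟨ r , off J g ⟩ → ⟨ p , g ⟩ ≡ ⟨ r , g ⟩
⟨⟩-off p r eq [] g e = e
⟨⟩-off p r eq (x ∷ J) g e = ⟨⟩-off p r eq J g
  (trans (split p) (trans (cong₂ _+_ (cong (off J g x *_) δeq) e) (sym (split r))))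
  where
  δeq : ⟨ p , δ x ⟩ ≡ ⟨ r , δ x ⟩
  δeq = trans (sym (coeffL-⟨⟩ p x)) (trans (eq x) (coeffL-⟨⟩ r x))
  split : (p : Laurent) → ⟨ p , off J g ⟩ ≡ off J g x * ⟨ p , δ x ⟩ + ⟨ p , offAt x (off J g) ⟩
  split p = trans (⟨⟩-cong p (offAt-split x (off J g)))
    (trans (⟨⟩-+ p _ _) (cong (_+ ⟨ p , offAt x (off J g) ⟩) (⟨⟩-*ˡ (off J g x) p (δ x))))

-- From `g` its values at all exponents listed in `p` or `r` are removed one at a time. Each removal
-- subtracts a multiple of some `δ x`, on which `p` and `r` agree; what remains of `g` pairs to 0
-- with both.
≈L⇒⟨⟩ : (p r : Laurent) → p ≈L r → ∀ g → ⟨ p , g ⟩ ≡ ⟨ r , g ⟩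
≈L⇒⟨⟩ p r eq g = ⟨⟩-off p r eq es g (trans (vanish p ∈-++⁺ˡ) (sym (vanish r (∈-++⁺ʳ (map proj₁ p)))))
  where
  es = map proj₁ p ++ map proj₁ r
  vanish : (s : Laurent) → (∀ {x} → x List.∈ map proj₁ s → x List.∈ es) → ⟨ s , off es g ⟩ ≡ 0ℤ
  vanish s inc = trans (∑-cong-∈ s λ t m →
      trans (cong (proj₂ t *_) (off-∈ es g (proj₁ t) (inc (∈-map⁺ proj₁ m)))) (*-zeroʳ (proj₂ t)))
    (∑-zero s λ _ → refl)

⟨⟩⇒≈L : (p r : Laurent) → (∀ g → ⟨ p , g ⟩ ≡ ⟨ r , g ⟩) → p ≈L r
⟨⟩⇒≈L p r eq j = trans (coeffL-⟨⟩ p j) (trans (eq (δ j)) (sym (coeffL-⟨⟩ r j)))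

-- Series as functionals on bounded test functions

Test : Set
Test = ℕ → ℤ → ℤ

Bounded : ℕ → Test → Set
Bounded K g = ∀ N x → K ℕ.≤ N → g N x ≡ 0ℤ

-- For `g` bounded by `K` the value does not change if `K` is enlarged; the bound only makes the sum
-- finite.
⟪_⟫ : Series → ℕ → Test → ℤ
⟪ F ⟫ K g = ∑ (upTo K) (λ N → ⟨ F N , g N ⟩)

-- Transpose of multiplication by q^b T^a.
shift : ℕ → ℤ → Test → Test
shift a b g N x = g (a ℕ.+ N) (b + x)

Bounded-shift : ∀ {K g} a b → Bounded K g → Bounded K (shift a b g)
Bounded-shift a b v N x le = v (a ℕ.+ N) (b + x) (ℕₚ.≤-trans le (ℕₚ.m≤n+m N a))

⟪⟫-cong : ∀ F K {g h : Test} → (∀ N x → g N x ≡ h N x) → ⟪ F ⟫ K g ≡ ⟪ F ⟫ K h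
⟪⟫-cong F K eq = ∑-cong (upTo K) λ N → ⟨⟩-cong (F N) (eq N)

⟪⟫-zero : ∀ F K {g : Test} → (∀ N x → g N x ≡ 0ℤ) → ⟪ F ⟫ K g ≡ 0ℤ
⟪⟫-zero F K eq = ∑-zero (upTo K) λ N → ⟨⟩-zero (F N) (eq N)

⟪shift⟫-Bounded : ∀ F K {g} → Bounded K g → Bounded K (λ m x → ⟪ F ⟫ K (shift m x g))
⟪shift⟫-Bounded F K v m x le = ⟪⟫-zero F K λ N y → v _ _ (ℕₚ.≤-trans le (ℕₚ.m≤m+n m N))

⟪⟫-⟨⟩-swap : ∀ {X : Set} F K (p : FormalSum X) (h : X → Test) →
  ⟨ p , (λ t → ⟪ F ⟫ K (h t)) ⟩ ≡ ⟪ F ⟫ K (λ N x → ⟨ p , (λ t → h t N x) ⟩)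
⟪⟫-⟨⟩-swap F K p h = trans (⟨⟩-∑ p (upTo K) (λ N t → ⟨ F N , h t N ⟩))
  (∑-cong (upTo K) λ N → ⟨⟩-swap p (F N) (λ t → h t N))

⟪⟫-minus : ∀ F K (g h : Test) → ⟪ F ⟫ K (λ N x → g N x - h N x) ≡ ⟪ F ⟫ K g - ⟪ F ⟫ K h
⟪⟫-minus F K g h = trans (∑-cong (upTo K) λ N → ⟨⟩-minus (F N) (g N) (h N)) (∑-minus (upTo K) _ _)

⟪const⟫ : ∀ p K {g} → Bounded K g → ⟪ ⟦ const p ⟧ ⟫ K g ≡ ⟨ p , g 0 ⟩
⟪const⟫ p zero v = trans (∑-[] _) (sym (⟨⟩-zero p λ x → v 0 x z≤n))
⟪const⟫ p (suc K) {g} v = trans (∑-upTo-suc K λ N → ⟨ ⟦ const p ⟧ N , g N ⟩)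
  (+zero ⟨ p , g 0 ⟩ (∑-zero (upTo K) λ _ → ∑-[] _))

⟪⊕⟫ : ∀ e f K g → ⟪ ⟦ e ⊕ f ⟧ ⟫ K g ≡ ⟪ ⟦ e ⟧ ⟫ K g + ⟪ ⟦ f ⟧ ⟫ K g
⟪⊕⟫ e f K g = trans (∑-cong (upTo K) λ N → ∑-++ (⟦ e ⟧ N) (⟦ f ⟧ N) _) (∑-+ (upTo K) _ _)

⟪⊗⟫ : ∀ e f K {g} → Bounded K g →
  ⟪ ⟦ e ⊗ f ⟧ ⟫ K g ≡ ⟪ ⟦ e ⟧ ⟫ K (λ m x → ⟪ ⟦ f ⟧ ⟫ K (shift m x g))
⟪⊗⟫ e f K {g} v = begin
  ∑ (upTo K) (λ N → ⟨ ⟦ e ⊗ f ⟧ N , g N ⟩)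
    ≡⟨ ∑-cong (upTo K) (λ N → trans (∑-concatMap (λ m → mulL (⟦ e ⟧ m) (⟦ f ⟧ (N ℕ.∸ m))) (upTo (suc N)) _)
         (∑-cong-∈ (upTo (suc N)) λ m m∈ → step N m (ℕₚ.≤-pred (∈-upTo⁻ m∈)))) ⟩
  ∑ (upTo K) (λ N → ∑ (upTo (suc N)) (λ m → h m (N ℕ.∸ m)))
    ≡⟨ ∑-cauchy K h (λ m l le → ⟨⟩-zero (⟦ e ⟧ m) λ x → ⟨⟩-zero (⟦ f ⟧ l) λ y → v _ _ le) ⟩
  ∑ (upTo K) (λ m → ∑ (upTo K) (h m))
    ≡⟨ ∑-cong (upTo K) (λ m → sym (⟨⟩-∑ (⟦ e ⟧ m) (upTo K) _)) ⟩
  ⟪ ⟦ e ⟧ ⟫ K (λ m x → ⟪ ⟦ f ⟧ ⟫ K (shift m x g)) ∎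
  where
  h : ℕ → ℕ → ℤ
  h m l = ⟨ ⟦ e ⟧ m , (λ x → ⟨ ⟦ f ⟧ l , (λ y → g (m ℕ.+ l) (x + y)) ⟩) ⟩
  step : ∀ N m → m ℕ.≤ N → ⟨ mulL (⟦ e ⟧ m) (⟦ f ⟧ (N ℕ.∸ m)) , g N ⟩ ≡ h m (N ℕ.∸ m)
  step N m le = trans (⟨mulL⟩ (⟦ e ⟧ m) (⟦ f ⟧ (N ℕ.∸ m)) (g N))
    (⟨⟩-cong (⟦ e ⟧ m) λ x → ⟨⟩-cong (⟦ f ⟧ (N ℕ.∸ m)) λ y →
      cong (λ M → g M (x + y)) (sym (ℕₚ.m+[n∸m]≡n le)))

⟨genCoeff⟩-∤ : ∀ a .{{_ : ℕ.NonZero a}} b N h → ¬ (a ∣ N) → ⟨ genCoeff a b N , h ⟩ ≡ 0ℤ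
⟨genCoeff⟩-∤ a b zero h n = ∑-[] _
⟨genCoeff⟩-∤ a b (suc N) h n rewrite dec-false (a ∣? suc N) n = ∑-[] _

⟨difference⟩ : ∀ {X : Set} (x y : X) (g : X → ℤ) → ⟨ (x , 1ℤ) ∷ (y , - 1ℤ) ∷ [] , g ⟩ ≡ g x - g y
⟨difference⟩ x y g = trans (∑-∷ (x , 1ℤ) _ _)
  (cong₂ _+_ (*-identityˡ (g x)) (trans (∑-singleton (y , - 1ℤ) _) (ℤₚ.-1*i≡-i (g y))))

⟨genCoeff⟩-∣ : ∀ a .{{_ : ℕ.NonZero a}} b N (h : ℤ → ℤ) → a ∣ suc N →
  ⟨ genCoeff a b (suc N) , h ⟩ ≡ h (b * + (suc N ℕ./ a) + 1ℤ) - h (b * + (suc N ℕ./ a))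
⟨genCoeff⟩-∣ a b N h d rewrite dec-true (a ∣? suc N) d =
  ⟨difference⟩ (b * + (suc N ℕ./ a) + 1ℤ) (b * + (suc N ℕ./ a)) h

⟨genCoeff⟩ : ∀ a .{{_ : ℕ.NonZero a}} b k (h : ℤ → ℤ) →
  ⟨ genCoeff a b (suc k ℕ.* a) , h ⟩ ≡ h (b * + suc k + 1ℤ) - h (b * + suc k)
⟨genCoeff⟩ a@(suc a') b k h = trans (⟨genCoeff⟩-∣ a b (a' ℕ.+ k ℕ.* a) h (divides (suc k) refl))
  (cong (λ m → h (b * + m + 1ℤ) - h (b * + m)) (m*n/n≡m (suc k) a))

-- Raising the degree by `a` multiplies the coefficient by q^b, but only from degree 1 on: the
-- geometric sum starts at k = 1, so degree `a` does not arise from degree 0.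
genCoeff-+ : ∀ a .{{_ : ℕ.NonZero a}} b N (h : ℤ → ℤ) →
  ⟨ genCoeff a b (a ℕ.+ suc N) , h ⟩ ≡ ⟨ genCoeff a b (suc N) , (λ x → h (b + x)) ⟩
genCoeff-+ a b N h = go (a ∣? suc N)
  where
  lem₁ : ∀ b k → b * (1ℤ + k) + 1ℤ ≡ b + (b * k + 1ℤ)
  lem₁ = solve-∀
  lem₂ : ∀ b k → b * (1ℤ + k) ≡ b + b * k
  lem₂ = solve-∀
  go : Dec (a ∣ suc N) → ⟨ genCoeff a b (a ℕ.+ suc N) , h ⟩ ≡ ⟨ genCoeff a b (suc N) , (λ x → h (b + x)) ⟩
  go (no n) = trans (⟨genCoeff⟩-∤ a b (a ℕ.+ suc N) h (λ d → n (∣m+n∣m⇒∣n d ∣-refl)))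
    (sym (⟨genCoeff⟩-∤ a b (suc N) (λ x → h (b + x)) n))
  go (yes (divides (suc k) eq)) = begin
    ⟨ genCoeff a b (a ℕ.+ suc N) , h ⟩ ≡⟨ cong (λ M → ⟨ genCoeff a b (a ℕ.+ M) , h ⟩) eq ⟩
    ⟨ genCoeff a b (suc (suc k) ℕ.* a) , h ⟩ ≡⟨ ⟨genCoeff⟩ a b (suc k) h ⟩
    h (b * + suc (suc k) + 1ℤ) - h (b * + suc (suc k))
      ≡⟨ cong₂ (λ x y → h x - h y) (lem₁ b (+ suc k)) (lem₂ b (+ suc k)) ⟩
    h (b + (b * + suc k + 1ℤ)) - h (b + b * + suc k) ≡⟨ ⟨genCoeff⟩ a b k (λ x → h (b + x)) ⟨
    ⟨ genCoeff a b (suc k ℕ.* a) , (λ x → h (b + x)) ⟩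
      ≡⟨ cong (λ M → ⟨ genCoeff a b M , (λ x → h (b + x)) ⟩) eq ⟨
    ⟨ genCoeff a b (suc N) , (λ x → h (b + x)) ⟩ ∎

-- (1 − q^b T^a) · gen a b = (q − 1) q^b T^a, paired with g.
⟪gen⟫ : ∀ a .{{_ : ℕ.NonZero a}} b K {g} → Bounded K g →
  ⟪ ⟦ gen a b ⟧ ⟫ K g ≡ (g a (b + 1ℤ) - g a b) + ⟪ ⟦ gen a b ⟧ ⟫ K (shift a b g)
⟪gen⟫ a b zero {g} v = trans (∑-[] _)
  (sym (trans (+zero _ (∑-[] _)) (cong₂ _-_ (v a (b + 1ℤ) z≤n) (v a b z≤n))))
⟪gen⟫ a b (suc K) {g} v = begin
  ∑ (upTo (suc K)) G
    ≡⟨ ∑-upTo-shift a (suc K) G (λ N le → ⟨⟩-zero (genCoeff a b N) λ x → v N x le) ⟩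
  ∑ (upTo a) G + ∑ (upTo (suc K)) (λ N → G (a ℕ.+ N))
    ≡⟨ cong₂ _+_ (trans (∑-cong-∈ (upTo a) λ N N∈ → small N (∈-upTo⁻ N∈)) (∑-zero (upTo a) λ _ → refl))
                 (∑-upTo-suc K (λ N → G (a ℕ.+ N))) ⟩
  0ℤ + (G (a ℕ.+ 0) + ∑ (upTo K) (λ N → G (a ℕ.+ suc N)))
    ≡⟨ +-identityˡ _ ⟩
  G (a ℕ.+ 0) + ∑ (upTo K) (λ N → G (a ℕ.+ suc N))
    ≡⟨ cong₂ _+_ first (trans (∑-cong (upTo K) λ N → genCoeff-+ a b N (g (a ℕ.+ suc N)))
          (sym (trans (∑-upTo-suc K H) (zero+ _ (∑-[] _))))) ⟩
  (g a (b + 1ℤ) - g a b) + ∑ (upTo (suc K)) H ∎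
  where
  G H : ℕ → ℤ
  G N = ⟨ genCoeff a b N , g N ⟩
  H N = ⟨ genCoeff a b N , shift a b g N ⟩
  small : ∀ N → N ℕ.< a → G N ≡ 0ℤ
  small zero lt = ∑-[] _
  small (suc N) lt = ⟨genCoeff⟩-∤ a b (suc N) (g (suc N)) (>⇒∤ lt)
  first : G (a ℕ.+ 0) ≡ g a (b + 1ℤ) - g a b
  first = trans (cong G (trans (ℕₚ.+-identityʳ a) (sym (ℕₚ.*-identityˡ a))))
    (trans (⟨genCoeff⟩ a b 0 (g (1 ℕ.* a)))
      (cong₂ (λ m c → g m (c + 1ℤ) - g m c) (ℕₚ.*-identityˡ a) (ℤₚ.*-identityʳ b)))

-- Clearing denominators and the specialisation T = q^(−t)

BiPoly : Set
BiPoly = FormalSum (ℕ × ℤ)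

_⊞_ : ℕ × ℤ → ℕ × ℤ → ℕ × ℤ
(a , b) ⊞ (a' , b') = a ℕ.+ a' , b + b'

shiftBy : ℕ × ℤ → Test → Test
shiftBy = uncurry shift

-- The clauses follow those of `μtop` and cancel no common factors, so that the two can be compared
-- by induction on the expression.
den num : Expr → BiPoly
den (const p) = ((0 , 0ℤ) , 1ℤ) ∷ []
den (gen a b) = ((0 , 0ℤ) , 1ℤ) ∷ ((a , b) , - 1ℤ) ∷ []
den (e ⊕ f) = conv _⊞_ (den e) (den f)
den (e ⊗ f) = conv _⊞_ (den e) (den f)
num (const p) = map (λ t → (0 , proj₁ t) , proj₂ t) p
num (gen a b) = ((a , b + 1ℤ) , 1ℤ) ∷ ((a , b) , - 1ℤ) ∷ []
num (e ⊕ f) = conv _⊞_ (num e) (den f) ++ conv _⊞_ (den e) (num f)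
num (e ⊗ f) = conv _⊞_ (num e) (num f)

⟨single⟩ : ∀ {X : Set} (x : X) (g : X → ℤ) → ⟨ (x , 1ℤ) ∷ [] , g ⟩ ≡ g x
⟨single⟩ x g = trans (∑-singleton (x , 1ℤ) _) (*-identityˡ (g x))

-- den e · ⟦ e ⟧ = num e, paired with g.
cleared : ∀ e K {g} → Bounded K g →
  ⟨ den e , (λ x → ⟪ ⟦ e ⟧ ⟫ K (shiftBy x g)) ⟩ ≡ ⟨ num e , uncurry g ⟩
cleared (const p) K {g} v = begin
  ⟨ den (const p) , (λ x → ⟪ ⟦ const p ⟧ ⟫ K (shiftBy x g)) ⟩
    ≡⟨ ⟨single⟩ (0 , 0ℤ) (λ x → ⟪ ⟦ const p ⟧ ⟫ K (shiftBy x g)) ⟩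
  ⟪ ⟦ const p ⟧ ⟫ K (shift 0 0ℤ g) ≡⟨ ⟪const⟫ p K (Bounded-shift 0 0ℤ v) ⟩
  ⟨ p , shift 0 0ℤ g 0 ⟩ ≡⟨ ⟨⟩-cong p (λ x → cong (g 0) (+-identityˡ x)) ⟩
  ⟨ p , g 0 ⟩ ≡⟨ ∑-map _ p _ ⟨
  ⟨ num (const p) , uncurry g ⟩ ∎
cleared (gen a b) K {g} v = begin
  ⟨ den (gen a b) , G ⟩ ≡⟨ ⟨difference⟩ (0 , 0ℤ) (a , b) G ⟩
  G (0 , 0ℤ) - G (a , b)
    ≡⟨ cong (_- G (a , b)) (⟪⟫-cong ⟦ gen a b ⟧ K λ N x → cong (g N) (+-identityˡ x)) ⟩
  ⟪ ⟦ gen a b ⟧ ⟫ K g - G (a , b) ≡⟨ cong (_- G (a , b)) (⟪gen⟫ a b K v) ⟩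
  ((g a (b + 1ℤ) - g a b) + G (a , b)) - G (a , b) ≡⟨ cancel _ (G (a , b)) ⟩
  g a (b + 1ℤ) - g a b ≡⟨ ⟨difference⟩ (a , b + 1ℤ) (a , b) (uncurry g) ⟨
  ⟨ num (gen a b) , uncurry g ⟩ ∎
  where
  G : ℕ × ℤ → ℤ
  G x = ⟪ ⟦ gen a b ⟧ ⟫ K (shiftBy x g)
  cancel : ∀ x y → (x + y) - y ≡ x
  cancel = solve-∀
cleared (e ⊕ f) K {g} v = begin
  ⟨ conv _⊞_ (den e) (den f) , (λ x → ⟪ ⟦ e ⊕ f ⟧ ⟫ K (shiftBy x g)) ⟩
    ≡⟨ ⟨conv⟩ _⊞_ (den e) (den f) _ ⟩
  ⟨ den e , (λ x → ⟨ den f , (λ y → ⟪ ⟦ e ⊕ f ⟧ ⟫ K (shiftBy (x ⊞ y) g)) ⟩) ⟩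
    ≡⟨ ⟨⟩-cong (den e) (λ x → trans (⟨⟩-cong (den f) λ y → ⟪⊕⟫ e f K (shiftBy (x ⊞ y) g)) (⟨⟩-+ (den f) _ _)) ⟩
  ⟨ den e , (λ x → ⟨ den f , E x ⟩ + ⟨ den f , F x ⟩) ⟩ ≡⟨ ⟨⟩-+ (den e) _ _ ⟩
  ⟨ den e , (λ x → ⟨ den f , E x ⟩) ⟩ + ⟨ den e , (λ x → ⟨ den f , F x ⟩) ⟩
    ≡⟨ cong₂ _+_
        -- The pairing with `den f` is moved outside so that `den e` meets `⟦ e ⟧`.
        (trans (⟨⟩-swap (den e) (den f) E) (trans (⟨⟩-cong (den f) Eeq) (⟨⟩-swap (den f) (num e) _)))
        (⟨⟩-cong (den e) Feq) ⟩
  ⟨ num e , (λ x → ⟨ den f , (λ y → uncurry g (x ⊞ y)) ⟩) ⟩ + ⟨ den e , (λ x → ⟨ num f , (λ y → uncurry g (x ⊞ y)) ⟩) ⟩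
    ≡⟨ cong₂ _+_ (⟨conv⟩ _⊞_ (num e) (den f) _) (⟨conv⟩ _⊞_ (den e) (num f) _) ⟨
  ⟨ conv _⊞_ (num e) (den f) , uncurry g ⟩ + ⟨ conv _⊞_ (den e) (num f) , uncurry g ⟩
    ≡⟨ ∑-++ (conv _⊞_ (num e) (den f)) _ _ ⟨
  ⟨ num (e ⊕ f) , uncurry g ⟩ ∎
  where
  E F : ℕ × ℤ → ℕ × ℤ → ℤ
  E x y = ⟪ ⟦ e ⟧ ⟫ K (shiftBy (x ⊞ y) g)
  F x y = ⟪ ⟦ f ⟧ ⟫ K (shiftBy (x ⊞ y) g)
  rearrange : ∀ x y N z → shiftBy (x ⊞ y) g N z ≡ shiftBy y (shiftBy x g) N z
  rearrange (a , b) (a' , b') N z = cong₂ g (ℕₚ.+-assoc a a' N) (+-assoc b b' z)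
  rearrange' : ∀ x y N z → shiftBy (x ⊞ y) g N z ≡ shiftBy x (shiftBy y g) N z
  rearrange' x@(a , b) y@(a' , b') N z =
    trans (cong₂ (λ c d → shift c d g N z) (ℕₚ.+-comm a a') (+-comm b b')) (rearrange y x N z)
  Feq : ∀ x → ⟨ den f , F x ⟩ ≡ ⟨ num f , (λ y → uncurry g (x ⊞ y)) ⟩
  Feq x = trans (⟨⟩-cong (den f) λ y → ⟪⟫-cong ⟦ f ⟧ K (rearrange x y))
    (cleared f K (Bounded-shift (proj₁ x) (proj₂ x) v))
  Eeq : ∀ y → ⟨ den e , (λ x → E x y) ⟩ ≡ ⟨ num e , (λ x → uncurry g (x ⊞ y)) ⟩
  Eeq y = trans (⟨⟩-cong (den e) λ x → ⟪⟫-cong ⟦ e ⟧ K (rearrange' x y))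
    (trans (cleared e K (Bounded-shift (proj₁ y) (proj₂ y) v))
      (⟨⟩-cong (num e) λ x → cong₂ g (ℕₚ.+-comm (proj₁ y) (proj₁ x)) (+-comm (proj₂ y) (proj₂ x))))
cleared (e ⊗ f) K {g} v = begin
  ⟨ conv _⊞_ (den e) (den f) , (λ x → ⟪ ⟦ e ⊗ f ⟧ ⟫ K (shiftBy x g)) ⟩
    ≡⟨ ⟨conv⟩ _⊞_ (den e) (den f) _ ⟩
  ⟨ den e , (λ x → ⟨ den f , (λ y → ⟪ ⟦ e ⊗ f ⟧ ⟫ K (shiftBy (x ⊞ y) g)) ⟩) ⟩
    -- Inside the pairing with `⟦ e ⟧`, the factor `den f` clears `⟦ f ⟧`; this leaves `⟦ e ⟧`
    -- paired with a shift of the test function `k`, which `den e` then clears.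
    ≡⟨ ⟨⟩-cong (den e) (λ x → trans
         (⟨⟩-cong (den f) λ y → ⟪⊗⟫ e f K (Bounded-shift (proj₁ (x ⊞ y)) (proj₂ (x ⊞ y)) v))
         (trans (⟪⟫-⟨⟩-swap ⟦ e ⟧ K (den f) _) (⟪⟫-cong ⟦ e ⟧ K (inner x)))) ⟩
  ⟨ den e , (λ x → ⟪ ⟦ e ⟧ ⟫ K (shiftBy x k)) ⟩
    ≡⟨ cleared e K (λ N z le → ⟨⟩-zero (num f) λ y → v _ _ (ℕₚ.≤-trans le (ℕₚ.m≤m+n N _))) ⟩
  ⟨ num e , uncurry k ⟩ ≡⟨ ⟨conv⟩ _⊞_ (num e) (num f) _ ⟨
  ⟨ num (e ⊗ f) , uncurry g ⟩ ∎
  where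
  k : Test
  k N z = ⟨ num f , (λ y → uncurry g ((N , z) ⊞ y)) ⟩
  inner : ∀ x N z →
    ⟨ den f , (λ y → ⟪ ⟦ f ⟧ ⟫ K (shift N z (shiftBy (x ⊞ y) g))) ⟩ ≡ shiftBy x k N z
  inner (a , b) N z = trans
    (⟨⟩-cong (den f) λ { (a' , b') → ⟪⟫-cong ⟦ f ⟧ K λ M w →
      cong₂ g (·-interchange ℕₚ.+-commutativeSemigroup a a' N M) (interchange b b' z w) })
    (cleared f K (Bounded-shift (a ℕ.+ N) (b + z) v))

-- `cleared` asks for a bounded test function. As `num e` has finitely many terms, `g` may be cut
-- off above their T-degrees without changing the pairing.
⟨num⟩≡0 : ∀ e → ⟦ e ⟧ ≈S (λ _ → []) → (g : Test) → ⟨ num e , uncurry g ⟩ ≡ 0ℤ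
⟨num⟩≡0 e e≈0 g = begin
  ⟨ num e , uncurry g ⟩ ≡⟨ ∑-cong-∈ (num e) (λ t t∈ → cong (proj₂ t *_) (sym (g'-eq (proj₁ t) (proj₂ t) t∈))) ⟩
  ⟨ num e , uncurry g' ⟩ ≡⟨ cleared e K g'-Bounded ⟨
  ⟨ den e , (λ x → ⟪ ⟦ e ⟧ ⟫ K (shiftBy x g')) ⟩
    ≡⟨ ⟨⟩-zero (den e) (λ x → ∑-zero (upTo K) λ N → trans (≈L⇒⟨⟩ (⟦ e ⟧ N) [] (e≈0 N) _) (∑-[] _)) ⟩
  0ℤ ∎
  where
  bound : BiPoly → ℕ
  bound = foldr (λ t m → suc (proj₁ (proj₁ t)) ℕ.⊔ m) 0
  bound-∈ : ∀ p {a b c} → ((a , b) , c) List.∈ p → a ℕ.< bound p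
  bound-∈ (_ ∷ p) (here refl) = ℕₚ.m≤m⊔n _ (bound p)
  bound-∈ (t ∷ p) (there t∈) = ℕₚ.≤-trans (bound-∈ p t∈) (ℕₚ.m≤n⊔m (suc (proj₁ (proj₁ t))) (bound p))
  K = bound (num e)
  g' : Test
  g' N x = if does (N ℕ.<? K) then g N x else 0ℤ
  g'-Bounded : Bounded K g'
  g'-Bounded N x le rewrite dec-false (N ℕ.<? K) (ℕₚ.≤⇒≯ le) = refl
  g'-eq : ∀ x c → (x , c) List.∈ num e → uncurry g' x ≡ uncurry g x
  g'-eq (a , b) c t∈ rewrite dec-true (a ℕ.<? K) (bound-∈ (num e) t∈) = refl

-- Differences and powers of q - 1

Δ : (ℤ → ℤ) → ℤ → ℤ
Δ g x = g (x + 1ℤ) - g x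

-- Transpose of multiplication by (q - 1)^r, just as `Δ` is that of multiplication by q - 1.
diff : ℕ → (ℤ → ℤ) → ℤ → ℤ
diff zero g = g
diff (suc r) g = diff r (Δ g)

diff-cong : ∀ r {g h : ℤ → ℤ} → (∀ x → g x ≡ h x) → ∀ x → diff r g x ≡ diff r h x
diff-cong zero eq x = eq x
diff-cong (suc r) eq x = diff-cong r (λ y → cong₂ _-_ (eq (y + 1ℤ)) (eq y)) x

diff-translate : ∀ r g x y → diff r (λ z → g (x + z)) y ≡ diff r g (x + y)
diff-translate zero g x y = refl
diff-translate (suc r) g x y = trans
  (diff-cong r (λ z → cong (λ c → g c - g (x + z)) (sym (+-assoc x z 1ℤ))) y)
  (diff-translate r (Δ g) x y)

diff-+ : ∀ r s g → diff (r ℕ.+ s) g ≡ diff s (diff r g)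
diff-+ zero s g = refl
diff-+ (suc r) s g = diff-+ r s (Δ g)

-- Summation from 0 in both directions. That every function is a difference is the dual form of q -
-- 1 being a non-zero-divisor, and it allows cancelling (q - 1)^r.
antidiff : (ℤ → ℤ) → ℤ → ℤ
antidiff f (+ zero) = 0ℤ
antidiff f (+ suc n) = antidiff f (+ n) + f (+ n)
antidiff f -[1+ zero ] = - f -[1+ zero ]
antidiff f -[1+ suc n ] = antidiff f -[1+ n ] - f -[1+ suc n ]

Δ-antidiff : ∀ f x → Δ (antidiff f) x ≡ f x
Δ-antidiff f (+ n) = trans (cong (λ m → antidiff f (+ m) - antidiff f (+ n)) (ℕₚ.+-comm n 1)) (lem (antidiff f (+ n)) (f (+ n)))
  where
  lem : ∀ a b → (a + b) - a ≡ b
  lem = solve-∀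
Δ-antidiff f -[1+ zero ] = lem (f -[1+ zero ])
  where
  lem : ∀ b → 0ℤ - (- b) ≡ b
  lem = solve-∀
Δ-antidiff f -[1+ suc n ] = lem (antidiff f -[1+ n ]) (f -[1+ suc n ])
  where
  lem : ∀ a b → a - (a - b) ≡ b
  lem = solve-∀

antidiffs : ℕ → (ℤ → ℤ) → ℤ → ℤ
antidiffs zero f = f
antidiffs (suc r) f = antidiff (antidiffs r f)

diff-antidiffs : ∀ r f x → diff r (antidiffs r f) x ≡ f x
diff-antidiffs zero f x = refl
diff-antidiffs (suc r) f x = trans (diff-cong r (Δ-antidiff (antidiffs r f)) x) (diff-antidiffs r f x)

-- q^b T^a ↦ q^(b − a t), dually on test functions.
pull : ℤ → (ℤ → ℤ) → ℕ × ℤ → ℤ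
pull t g (a , b) = g (b - + a * t)

-- After T ↦ q^(−t) the polynomial p becomes (q − 1)^r u with u(1) = v.
record Lead (t : ℤ) (p : BiPoly) (r : ℕ) (v : ℤ) : Set where
  constructor lead
  field
    cofactor : Laurent
    factors : ∀ g → ⟨ p , pull t g ⟩ ≡ ⟨ cofactor , diff r g ⟩
    value : ⟨ cofactor , (λ _ → 1ℤ) ⟩ ≡ v

-- Testing with a function whose `r`-th difference is constantly 1 reads off the cofactor at q = 1.
Lead-zero : ∀ {t p r v} → Lead t p r v → (∀ g → ⟨ p , pull t g ⟩ ≡ 0ℤ) → v ≡ 0ℤ
Lead-zero {r = r} (lead u eq val) z = begin
  _ ≡⟨ val ⟨
  ⟨ u , (λ _ → 1ℤ) ⟩ ≡⟨ ⟨⟩-cong u (diff-antidiffs r (λ _ → 1ℤ)) ⟨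
  ⟨ u , diff r (antidiffs r (λ _ → 1ℤ)) ⟩ ≡⟨ eq (antidiffs r λ _ → 1ℤ) ⟨
  _ ≡⟨ z (antidiffs r λ _ → 1ℤ) ⟩
  0ℤ ∎

Lead-++ : ∀ {t p p' r v v'} → Lead t p r v → Lead t p' r v' → Lead t (p ++ p') r (v + v')
Lead-++ {p = p} {p'} (lead u eq val) (lead u' eq' val') = lead (u ++ u')
  (λ g → trans (∑-++ p p' _) (trans (cong₂ _+_ (eq g) (eq' g)) (sym (∑-++ u u' _))))
  (trans (∑-++ u u' _) (cong₂ _+_ val val'))

Lead-conv : ∀ {t p p' r r' v v'} → Lead t p r v → Lead t p' r' v' →
  Lead t (conv _⊞_ p p') (r' ℕ.+ r) (v * v')
Lead-conv {t} {p} {p'} {r} {r'} {v} {v'} (lead u eq val) (lead u' eq' val') = lead (mulL u u')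
  (λ g → begin
    ⟨ conv _⊞_ p p' , pull t g ⟩ ≡⟨ ⟨conv⟩ _⊞_ p p' _ ⟩
    ⟨ p , (λ x → ⟨ p' , (λ y → pull t g (x ⊞ y)) ⟩) ⟩
      ≡⟨ ⟨⟩-cong p (λ { (a , b) → trans
           (⟨⟩-cong p' λ { (a' , b') → cong g (lem b b' (+ a) (+ a')) })
           (trans (eq' (λ y → g ((b - + a * t) + y)))
             (⟨⟩-cong u' λ y → diff-translate r' g (b - + a * t) y)) }) ⟩
    ⟨ p , (λ x → ⟨ u' , (λ y → pull t (λ z → diff r' g (z + y)) x) ⟩) ⟩ ≡⟨ ⟨⟩-swap p u' _ ⟩
    ⟨ u' , (λ y → ⟨ p , pull t (λ z → diff r' g (z + y)) ⟩) ⟩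
      ≡⟨ ⟨⟩-cong u' (λ y → trans (eq _) (⟨⟩-cong u λ x → trans
           (diff-cong r (λ z → cong (diff r' g) (+-comm z y)) x)
           (trans (diff-translate r (diff r' g) y x) (cong (diff r (diff r' g)) (+-comm y x))))) ⟩
    ⟨ u' , (λ y → ⟨ u , (λ x → diff r (diff r' g) (x + y)) ⟩) ⟩ ≡⟨ ⟨⟩-swap u' u _ ⟩
    ⟨ u , (λ x → ⟨ u' , (λ y → diff r (diff r' g) (x + y)) ⟩) ⟩ ≡⟨ ⟨mulL⟩ u u' _ ⟨
    ⟨ mulL u u' , diff r (diff r' g) ⟩ ≡⟨ cong (λ h → ⟨ mulL u u' , h ⟩) (diff-+ r' r g) ⟨
    ⟨ mulL u u' , diff (r' ℕ.+ r) g ⟩ ∎)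
  (begin
    ⟨ mulL u u' , (λ _ → 1ℤ) ⟩ ≡⟨ ⟨mulL⟩ u u' (λ _ → 1ℤ) ⟩
    ⟨ u , (λ _ → ⟨ u' , (λ _ → 1ℤ) ⟩) ⟩ ≡⟨ ⟨⟩-cong u (λ _ → trans val' (sym (ℤₚ.*-identityʳ v'))) ⟩
    ⟨ u , (λ _ → v' * 1ℤ) ⟩ ≡⟨ ⟨⟩-*ˡ v' u (λ _ → 1ℤ) ⟩
    v' * ⟨ u , (λ _ → 1ℤ) ⟩ ≡⟨ cong (v' *_) val ⟩
    v' * v ≡⟨ ℤₚ.*-comm v' v ⟩
    v * v' ∎)
  where
  lem₀ : ∀ b b' a a' t → (b + b') - (a + a') * t ≡ (b - a * t) + (b' - a' * t)
  lem₀ = solve-∀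
  lem : ∀ b b' a a' → (b + b') - (a + a') * t ≡ (b - a * t) + (b' - a' * t)
  lem b b' a a' = lem₀ b b' a a' t

-- (q^m − 1)/(q − 1)
geo : ℤ → Laurent
geo (+ zero) = []
geo (+ suc n) = (+ n , 1ℤ) ∷ geo (+ n)
geo -[1+ zero ] = (-[1+ zero ] , - 1ℤ) ∷ []
geo -[1+ suc n ] = (-[1+ suc n ] , - 1ℤ) ∷ geo -[1+ n ]

⟨geo⟩ : ∀ m g → ⟨ geo m , Δ g ⟩ ≡ g m - g 0ℤ
⟨geo⟩ (+ zero) g = trans (∑-[] _) (sym (ℤₚ.+-inverseʳ (g 0ℤ)))
⟨geo⟩ (+ suc n) g = trans (∑-∷ _ (geo (+ n)) _) (trans (cong₂ (λ x y → 1ℤ * (g (+ x) - g (+ n)) + y) (ℕₚ.+-comm n 1) (⟨geo⟩ (+ n) g)) (lem (g (+ suc n)) (g (+ n)) (g 0ℤ)))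
  where
  lem : ∀ a b c → 1ℤ * (a - b) + (b - c) ≡ a - c
  lem = solve-∀
⟨geo⟩ -[1+ zero ] g = trans (∑-singleton (-[1+ 0 ] , - 1ℤ) _) (lem (g 0ℤ) (g -[1+ zero ]))
  where
  lem : ∀ a b → -[1+ 0 ] * (a - b) ≡ b - a
  lem = solve-∀
⟨geo⟩ -[1+ suc n ] g = trans (∑-∷ _ (geo -[1+ n ]) _) (trans (addˡ (- 1ℤ * (g -[1+ n ] - g -[1+ suc n ])) (⟨geo⟩ -[1+ n ] g)) (lem (g -[1+ n ]) (g -[1+ suc n ]) (g 0ℤ)))
  where
  lem : ∀ a b c → -[1+ 0 ] * (a - b) + (a - c) ≡ b - c
  lem = solve-∀

geo-at-1 : ∀ m → ⟨ geo m , (λ _ → 1ℤ) ⟩ ≡ m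
-- The identity function has difference 1, so `⟨geo⟩` at `id` gives the value at q = 1.
geo-at-1 m = trans (⟨⟩-cong (geo m) λ x → sym (lem x)) (trans (⟨geo⟩ m id) (+-identityʳ m))
  where
  lem : ∀ x → (x + 1ℤ) - x ≡ 1ℤ
  lem = solve-∀

-- Each generator contributes one factor q - 1 to the numerator and one to the denominator, so a
-- single exponent serves both and drops out of their quotient.
ord : Expr → ℕ
ord (const p) = 0
ord (gen a b) = 1
ord (e ⊕ f) = ord f ℕ.+ ord e
ord (e ⊗ f) = ord f ℕ.+ ord e

numAt denAt : Expr → ℤ → ℤ
denAt (const p) t = 1ℤ
denAt (gen a b) t = + a * t - b
denAt (e ⊕ f) t = denAt e t * denAt f t
denAt (e ⊗ f) t = denAt e t * denAt f t
numAt (const p) t = evalAt1 p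
numAt (gen a b) t = 1ℤ
numAt (e ⊕ f) t = numAt e t * denAt f t + denAt e t * numAt f t
numAt (e ⊗ f) t = numAt e t * numAt f t

Lead-den : ∀ e t → Lead t (den e) (ord e) (denAt e t)
Lead-den (const p) t = lead ((0ℤ , 1ℤ) ∷ [])
  (λ g → trans (⟨single⟩ (0 , 0ℤ) (pull t g)) (sym (⟨single⟩ 0ℤ g))) (⟨single⟩ 0ℤ (λ _ → 1ℤ))
-- With m = b - a t this is 1 - q^m = (q - 1) · q^m · (q^(-m) - 1)/(q - 1). For m = 0 both the
-- cofactor and its value are 0.
Lead-den (gen a b) t = lead (shiftL m (geo (- m)))
  (λ g → begin
    ⟨ den (gen a b) , pull t g ⟩ ≡⟨ ⟨difference⟩ (0 , 0ℤ) (a , b) (pull t g) ⟩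
    g 0ℤ - g m ≡⟨ cong₂ (λ x y → g x - g y) (ℤₚ.+-inverseʳ m) (+-identityʳ m) ⟨
    g (m - m) - g (m + 0ℤ) ≡⟨ ⟨geo⟩ (- m) (λ x → g (m + x)) ⟨
    ⟨ geo (- m) , Δ (λ x → g (m + x)) ⟩ ≡⟨ ⟨⟩-cong (geo (- m)) (diff-translate 1 g m) ⟩
    ⟨ geo (- m) , (λ x → Δ g (m + x)) ⟩ ≡⟨ ⟨shiftL⟩ m (geo (- m)) (Δ g) ⟨
    ⟨ shiftL m (geo (- m)) , Δ g ⟩ ∎)
  (trans (⟨shiftL⟩ m (geo (- m)) λ _ → 1ℤ) (trans (geo-at-1 (- m)) (lem b (+ a * t))))
  where
  m = b - + a * t
  lem : ∀ b c → - (b - c) ≡ c - b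
  lem = solve-∀
Lead-den (e ⊕ f) t = Lead-conv (Lead-den e t) (Lead-den f t)
Lead-den (e ⊗ f) t = Lead-conv (Lead-den e t) (Lead-den f t)

Lead-num : ∀ e t → Lead t (num e) (ord e) (numAt e t)
Lead-num (const p) t = lead p
  (λ g → trans (∑-map _ p _) (⟨⟩-cong p λ x → cong g (+-identityʳ x)))
  (sym (evalAt1-⟨⟩ p))
Lead-num (gen a b) t = lead ((m , 1ℤ) ∷ [])
  (λ g → begin
    ⟨ num (gen a b) , pull t g ⟩ ≡⟨ ⟨difference⟩ (a , b + 1ℤ) (a , b) (pull t g) ⟩
    g (b + 1ℤ - + a * t) - g m ≡⟨ cong (λ x → g x - g m) (lem b (+ a * t)) ⟩
    Δ g m ≡⟨ ⟨single⟩ m (Δ g) ⟨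
    ⟨ (m , 1ℤ) ∷ [] , Δ g ⟩ ∎)
  (⟨single⟩ m (λ _ → 1ℤ))
  where
  m = b - + a * t
  lem : ∀ b c → b + 1ℤ - c ≡ (b - c) + 1ℤ
  lem = solve-∀
Lead-num (e ⊕ f) t = Lead-++ (Lead-conv (Lead-num e t) (Lead-den f t)) (Lead-conv (Lead-den e t) (Lead-num f t))
Lead-num (e ⊗ f) t = Lead-conv (Lead-num e t) (Lead-num f t)

numAt≡0 : ∀ e → ⟦ e ⟧ ≈S (λ _ → []) → ∀ t → numAt e t ≡ 0ℤ
numAt≡0 e e≈0 t = Lead-zero (Lead-num e t) λ g → ⟨num⟩≡0 e e≈0 λ a b → pull t g (a , b)

-- Polynomials over ℚ

ℚ-ring : AlmostCommutativeRing 0ℓ 0ℓ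
ℚ-ring = fromCommutativeRing ℚₚ.+-*-commutativeRing λ x → dec⇒maybe (0ℚ ℚₚ.≟ x)

toℚᵘ-ℤtoℚ : ∀ z → toℚᵘ (ℤtoℚ z) ℚᵘ.≃ mkℚᵘ z 0
toℚᵘ-ℤtoℚ z = ℚₚ.toℚᵘ-fromℚᵘ (mkℚᵘ z 0)

ℤtoℚ-+ : ∀ x y → ℤtoℚ (x ℤ.+ y) ≡ ℤtoℚ x ℚ.+ ℤtoℚ y
ℤtoℚ-+ x y = ℚₚ.toℚᵘ-injective (ℚᵘₚ.≃-trans (toℚᵘ-ℤtoℚ (x ℤ.+ y)) (ℚᵘₚ.≃-sym
  (ℚᵘₚ.≃-trans (ℚₚ.toℚᵘ-homo-+ (ℤtoℚ x) (ℤtoℚ y))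
    (ℚᵘₚ.≃-trans (ℚᵘₚ.+-cong (toℚᵘ-ℤtoℚ x) (toℚᵘ-ℤtoℚ y))
      (*≡* (cong (ℤ._* 1ℤ) (cong₂ ℤ._+_ (ℤₚ.*-identityʳ x) (ℤₚ.*-identityʳ y))))))))

ℤtoℚ-* : ∀ x y → ℤtoℚ (x ℤ.* y) ≡ ℤtoℚ x ℚ.* ℤtoℚ y
ℤtoℚ-* x y = ℚₚ.toℚᵘ-injective (ℚᵘₚ.≃-trans (toℚᵘ-ℤtoℚ (x ℤ.* y)) (ℚᵘₚ.≃-sym
  (ℚᵘₚ.≃-trans (ℚₚ.toℚᵘ-homo-* (ℤtoℚ x) (ℤtoℚ y))
    (ℚᵘₚ.≃-trans (ℚᵘₚ.*-cong (toℚᵘ-ℤtoℚ x) (toℚᵘ-ℤtoℚ y)) (*≡* refl)))))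

ℤtoℚ-injective : ∀ x y → ℤtoℚ x ≡ ℤtoℚ y → x ≡ y
ℤtoℚ-injective x y eq
  with *≡* e ← ℚᵘₚ.≃-trans (ℚᵘₚ.≃-sym (toℚᵘ-ℤtoℚ x)) (ℚᵘₚ.≃-trans (ℚₚ.toℚᵘ-cong eq) (toℚᵘ-ℤtoℚ y))
  = trans (sym (ℤₚ.*-identityʳ x)) (trans e (ℤₚ.*-identityʳ y))

ℤtoℚ-neg : ∀ x → ℤtoℚ (ℤ.- x) ≡ ℚ.- ℤtoℚ x
ℤtoℚ-neg x = begin
  ℤtoℚ (ℤ.- x) ≡⟨ lem (ℤtoℚ x) (ℤtoℚ (ℤ.- x)) ⟩
  (ℤtoℚ x ℚ.+ ℤtoℚ (ℤ.- x)) ℚ.- ℤtoℚ x ≡⟨ cong (ℚ._- ℤtoℚ x) (ℤtoℚ-+ x (ℤ.- x)) ⟨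
  ℤtoℚ (x ℤ.- x) ℚ.- ℤtoℚ x ≡⟨ cong (λ y → ℤtoℚ y ℚ.- ℤtoℚ x) (ℤₚ.+-inverseʳ x) ⟩
  0ℚ ℚ.- ℤtoℚ x ≡⟨ ℚₚ.+-identityˡ _ ⟩
  ℚ.- ℤtoℚ x ∎
  where
  lem : ∀ a b → b ≡ (a ℚ.+ b) ℚ.- a
  lem = solve-∀-in ℚ-ring

x*y≡0⇒y≡0 : ∀ x y → x ≢ 0ℚ → x ℚ.* y ≡ 0ℚ → y ≡ 0ℚ
x*y≡0⇒y≡0 x y x≢0 eq = begin
  y ≡⟨ ℚₚ.*-identityˡ y ⟨
  1ℚ ℚ.* y ≡⟨ cong (ℚ._* y) (ℚₚ.*-inverseˡ x) ⟨
  (ℚ.1/ x ℚ.* x) ℚ.* y ≡⟨ ℚₚ.*-assoc (ℚ.1/ x) x y ⟩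
  ℚ.1/ x ℚ.* (x ℚ.* y) ≡⟨ cong (ℚ.1/ x ℚ.*_) eq ⟩
  ℚ.1/ x ℚ.* 0ℚ ≡⟨ ℚₚ.*-zeroʳ (ℚ.1/ x) ⟩
  0ℚ ∎
  where instance _ = ℚ.≢-nonZero x≢0

coeffP-addP : ∀ p r i → coeffP (addP p r) i ≡ coeffP p i ℚ.+ coeffP r i
coeffP-addP [] r i = sym (ℚₚ.+-identityˡ _)
coeffP-addP (x ∷ p) [] i = sym (ℚₚ.+-identityʳ _)
coeffP-addP (x ∷ p) (y ∷ r) zero = refl
coeffP-addP (x ∷ p) (y ∷ r) (suc i) = coeffP-addP p r i

coeffP-negP : ∀ p i → coeffP (negP p) i ≡ ℚ.- coeffP p i
coeffP-negP [] i = refl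
coeffP-negP (x ∷ p) zero = refl
coeffP-negP (x ∷ p) (suc i) = coeffP-negP p i

coeffP-scale : ∀ x p i → coeffP (map (x ℚ.*_) p) i ≡ x ℚ.* coeffP p i
coeffP-scale x [] i = sym (ℚₚ.*-zeroʳ x)
coeffP-scale x (y ∷ p) zero = refl
coeffP-scale x (y ∷ p) (suc i) = coeffP-scale x p i

coeffP-mulP : ∀ x p r i → coeffP (mulP (x ∷ p) r) i ≡ x ℚ.* coeffP r i ℚ.+ coeffP (0ℚ ∷ mulP p r) i
coeffP-mulP x p r i = trans (coeffP-addP (map (x ℚ.*_) r) (0ℚ ∷ mulP p r) i)
  (cong (ℚ._+ coeffP (0ℚ ∷ mulP p r) i) (coeffP-scale x r i))

eval : Poly → ℚ → ℚ
eval [] s = 0ℚ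
eval (x ∷ p) s = x ℚ.+ s ℚ.* eval p s

eval-addP : ∀ p r s → eval (addP p r) s ≡ eval p s ℚ.+ eval r s
eval-addP [] r s = sym (ℚₚ.+-identityˡ _)
eval-addP (x ∷ p) [] s = sym (ℚₚ.+-identityʳ _)
eval-addP (x ∷ p) (y ∷ r) s =
  trans (cong (λ z → (x ℚ.+ y) ℚ.+ s ℚ.* z) (eval-addP p r s)) (lem x y s (eval p s) (eval r s))
  where
  lem : ∀ x y s a b → (x ℚ.+ y) ℚ.+ s ℚ.* (a ℚ.+ b) ≡ (x ℚ.+ s ℚ.* a) ℚ.+ (y ℚ.+ s ℚ.* b)
  lem = solve-∀-in ℚ-ring

eval-scale : ∀ x p s → eval (map (x ℚ.*_) p) s ≡ x ℚ.* eval p s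
eval-scale x [] s = sym (ℚₚ.*-zeroʳ x)
eval-scale x (y ∷ p) s =
  trans (cong (λ z → x ℚ.* y ℚ.+ s ℚ.* z) (eval-scale x p s)) (lem x y s (eval p s))
  where
  lem : ∀ x y s a → x ℚ.* y ℚ.+ s ℚ.* (x ℚ.* a) ≡ x ℚ.* (y ℚ.+ s ℚ.* a)
  lem = solve-∀-in ℚ-ring

eval-negP : ∀ p s → eval (negP p) s ≡ ℚ.- eval p s
eval-negP [] s = refl
eval-negP (y ∷ p) s =
  trans (cong (λ z → ℚ.- y ℚ.+ s ℚ.* z) (eval-negP p s)) (lem y s (eval p s))
  where
  lem : ∀ y s a → ℚ.- y ℚ.+ s ℚ.* (ℚ.- a) ≡ ℚ.- (y ℚ.+ s ℚ.* a)
  lem = solve-∀-in ℚ-ring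

eval-mulP : ∀ p r s → eval (mulP p r) s ≡ eval p s ℚ.* eval r s
eval-mulP [] r s = sym (ℚₚ.*-zeroˡ (eval r s))
eval-mulP (x ∷ p) r s = trans (eval-addP (map (x ℚ.*_) r) (0ℚ ∷ mulP p r) s)
  (trans (cong₂ (λ a b → a ℚ.+ (0ℚ ℚ.+ s ℚ.* b)) (eval-scale x r s) (eval-mulP p r s))
    (lem x s (eval p s) (eval r s)))
  where
  lem : ∀ x s a b → x ℚ.* b ℚ.+ (0ℚ ℚ.+ s ℚ.* (a ℚ.* b)) ≡ (x ℚ.+ s ℚ.* a) ℚ.* b
  lem = solve-∀-in ℚ-ring

-- Orders of vanishing at s = 0

VanishesBelow : ℕ → Poly → Set
VanishesBelow k p = ∀ i → i ℕ.< k → coeffP p i ≡ 0ℚ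

mulP-VanishesBelow : ∀ p r k l → VanishesBelow k p → VanishesBelow l r →
  VanishesBelow (k ℕ.+ l) (mulP p r) × coeffP (mulP p r) (k ℕ.+ l) ≡ coeffP p k ℚ.* coeffP r l
mulP-VanishesBelow [] r k l vp vr = (λ _ _ → refl) , sym (ℚₚ.*-zeroˡ (coeffP r l))
mulP-VanishesBelow (x ∷ p) r zero l vp vr = below , leading l vr
  where
  IH : ∀ m → VanishesBelow m r → VanishesBelow m (mulP p r)
  IH m v = proj₁ (mulP-VanishesBelow p r 0 m (λ _ ()) v)
  tail : ∀ m → VanishesBelow m r → coeffP (0ℚ ∷ mulP p r) m ≡ 0ℚ
  tail zero v = refl
  tail (suc m) v = IH (suc m) v m ℕₚ.≤-refl
  leading : ∀ m → VanishesBelow m r → coeffP (mulP (x ∷ p) r) m ≡ x ℚ.* coeffP r m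
  leading m v = trans (coeffP-mulP x p r m) (trans (cong (x ℚ.* coeffP r m ℚ.+_) (tail m v)) (ℚₚ.+-identityʳ _))
  below : VanishesBelow l (mulP (x ∷ p) r)
  below i lt = trans (leading i λ j lt' → vr j (ℕₚ.<-trans lt' lt))
    (trans (cong (x ℚ.*_) (vr i lt)) (ℚₚ.*-zeroʳ x))
mulP-VanishesBelow (x ∷ p) r (suc k) l vp vr = below , trans (drop (suc (k ℕ.+ l))) (proj₂ IH)
  where
  IH = mulP-VanishesBelow p r k l (λ i lt → vp (suc i) (s≤s lt)) vr
  drop : ∀ i → coeffP (mulP (x ∷ p) r) i ≡ coeffP (0ℚ ∷ mulP p r) i
  drop i = trans (coeffP-mulP x p r i)
    (trans (cong (λ z → z ℚ.* coeffP r i ℚ.+ coeffP (0ℚ ∷ mulP p r) i) (vp 0 (s≤s z≤n)))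
      (trans (cong (ℚ._+ coeffP (0ℚ ∷ mulP p r) i) (ℚₚ.*-zeroˡ (coeffP r i))) (ℚₚ.+-identityˡ _)))
  below : VanishesBelow (suc k ℕ.+ l) (mulP (x ∷ p) r)
  below zero lt = drop 0
  below (suc i) lt = trans (drop (suc i)) (proj₁ IH i (ℕₚ.≤-pred lt))

-- Once `r` vanishes below `m`, coefficient `m` of the product is `coeffP p 0` times that of `r`.
mulP-cancel : ∀ p r m → coeffP p 0 ≢ 0ℚ → VanishesBelow m (mulP p r) → VanishesBelow m r
mulP-cancel p r (suc m) p₀ v i lt with ℕₚ.m<1+n⇒m<n∨m≡n lt
... | inj₁ lt' = mulP-cancel p r m p₀ (λ j l → v j (ℕₚ.m<n⇒m<1+n l)) i lt'
... | inj₂ refl = x*y≡0⇒y≡0 (coeffP p 0) (coeffP r m) p₀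
  (trans (sym (proj₂ (mulP-VanishesBelow p r 0 m (λ _ ())
    (mulP-cancel p r m p₀ λ j l → v j (ℕₚ.m<n⇒m<1+n l))))) (v m ℕₚ.≤-refl))

HasOrder : ℕ → Poly → Set
HasOrder k p = VanishesBelow k p × coeffP p k ≢ 0ℚ

mulP-HasOrder : ∀ {k l} p r → HasOrder k p → HasOrder l r → HasOrder (k ℕ.+ l) (mulP p r)
mulP-HasOrder {k} {l} p r (vp , pk) (vr , rl) =
  proj₁ both , λ eq → rl (x*y≡0⇒y≡0 _ _ pk (trans (sym (proj₂ both)) eq))
  where both = mulP-VanishesBelow p r k l vp vr

-- Synthetic division: the quotient of `x ∷ p` by s - a, for any constant term `x`, with Horner's
-- partial values as coefficients.
slope : Poly → ℚ → Poly
slope [] a = []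
slope (y ∷ p) a = eval (y ∷ p) a ∷ slope p a

eval-slope : ∀ p a s → s ℚ.* eval p s ≡ a ℚ.* eval p a ℚ.+ (s ℚ.- a) ℚ.* eval (slope p a) s
eval-slope [] a s = lem a s
  where
  lem : ∀ a s → s ℚ.* 0ℚ ≡ a ℚ.* 0ℚ ℚ.+ (s ℚ.- a) ℚ.* 0ℚ
  lem = solve-∀-in ℚ-ring
eval-slope (y ∷ p) a s = trans (cong (λ z → s ℚ.* (y ℚ.+ z)) (eval-slope p a s))
    (lem a s y (eval p a) (eval (slope p a) s))
  where
  lem : ∀ a s y b c → s ℚ.* (y ℚ.+ (a ℚ.* b ℚ.+ (s ℚ.- a) ℚ.* c)) ≡
    a ℚ.* (y ℚ.+ a ℚ.* b) ℚ.+ (s ℚ.- a) ℚ.* ((y ℚ.+ a ℚ.* b) ℚ.+ s ℚ.* c)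
  lem = solve-∀-in ℚ-ring

eval-zero : ∀ p s → (∀ i → coeffP p i ≡ 0ℚ) → eval p s ≡ 0ℚ
eval-zero [] s v = refl
eval-zero (x ∷ p) s v = trans (cong₂ (λ a b → a ℚ.+ s ℚ.* b) (v 0) (eval-zero p s λ i → v (suc i)))
  (trans (ℚₚ.+-identityˡ _) (ℚₚ.*-zeroʳ s))

slope-zero : ∀ p a → (∀ i → coeffP (slope p a) i ≡ 0ℚ) → ∀ i → coeffP p i ≡ 0ℚ
slope-zero [] a v i = refl
slope-zero (y ∷ p) a v (suc i) = slope-zero p a (λ j → v (suc j)) i
slope-zero (y ∷ p) a v zero = begin
  y ≡⟨ ℚₚ.+-identityʳ y ⟨
  y ℚ.+ 0ℚ ≡⟨ cong (y ℚ.+_) (trans (cong (a ℚ.*_) (eval-zero p a (slope-zero p a λ j → v (suc j)))) (ℚₚ.*-zeroʳ a)) ⟨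
  y ℚ.+ a ℚ.* eval p a ≡⟨ v 0 ⟩
  0ℚ ∎

length-slope : ∀ p a → length (slope p a) ≡ length p
length-slope [] a = refl
length-slope (x ∷ p) a = cong suc (length-slope p a)

-- The root `t₀` is divided out. The quotient is shorter and still vanishes at all later integers,
-- which is why the starting point `t₀` varies in the induction.
coeffP-zero : ∀ m p → length p ≡ m → ∀ t₀ → (∀ t → t₀ ℕ.≤ t → eval p (ℤtoℚ (+ t)) ≡ 0ℚ) →
  ∀ i → coeffP p i ≡ 0ℚ
coeffP-zero m [] len t₀ v i = refl
coeffP-zero (suc m) (x ∷ p) len t₀ v = λ { zero → x≡0 ; (suc i) → p≡0 i }
  where
  a = ℤtoℚ (+ t₀)
  slope-v : ∀ t → suc t₀ ℕ.≤ t → eval (slope p a) (ℤtoℚ (+ t)) ≡ 0ℚ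
  slope-v t lt = x*y≡0⇒y≡0 (s ℚ.- a) _ s≢a (begin
    (s ℚ.- a) ℚ.* eval (slope p a) s ≡⟨ lem₁ x (a ℚ.* eval p a) _ ⟩
    (x ℚ.+ (a ℚ.* eval p a ℚ.+ (s ℚ.- a) ℚ.* eval (slope p a) s)) ℚ.- (x ℚ.+ a ℚ.* eval p a)
      ≡⟨ cong₂ ℚ._-_ (trans (cong (x ℚ.+_) (sym (eval-slope p a s))) (v t (ℕₚ.<⇒≤ lt))) (v t₀ ℕₚ.≤-refl) ⟩
    0ℚ ∎)
    where
    s = ℤtoℚ (+ t)
    lem₁ : ∀ x b c → c ≡ (x ℚ.+ (b ℚ.+ c)) ℚ.- (x ℚ.+ b)
    lem₁ = solve-∀-in ℚ-ring
    lem₂ : ∀ s a → s ≡ (s ℚ.- a) ℚ.+ a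
    lem₂ = solve-∀-in ℚ-ring
    s≢a : s ℚ.- a ≢ 0ℚ
    s≢a eq = ℕₚ.<⇒≢ lt (sym (ℤₚ.+-injective (ℤtoℚ-injective (+ t) (+ t₀)
      (trans (lem₂ s a) (trans (cong (ℚ._+ a) eq) (ℚₚ.+-identityˡ a))))))
  p≡0 : ∀ i → coeffP p i ≡ 0ℚ
  p≡0 = slope-zero p a (coeffP-zero m (slope p a) (trans (length-slope p a) (ℕₚ.suc-injective len)) (suc t₀) slope-v)
  x≡0 : x ≡ 0ℚ
  x≡0 = trans (trans (sym (ℚₚ.+-identityʳ x)) (cong (x ℚ.+_) (sym (trans (cong (a ℚ.*_) (eval-zero p a p≡0)) (ℚₚ.*-zeroʳ a)))))
    (v t₀ ℕₚ.≤-refl)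

-- Comparing two expressions for the same series

⟪⟫-resp : ∀ (F G : Series) → F ≈S G → ∀ K g → ⟪ F ⟫ K g ≡ ⟪ G ⟫ K g
⟪⟫-resp F G eq K g = ∑-cong (upTo K) λ N → ≈L⇒⟨⟩ (F N) (G N) (eq N) (g N)

-- Test functions concentrated in T-degree `N` isolate the coefficient of T^N.
⟪⟫⇒≈S : ∀ (F G : Series) → (∀ K {g} → Bounded K g → ⟪ F ⟫ K g ≡ ⟪ G ⟫ K g) → F ≈S G
⟪⟫⇒≈S F G eq N = ⟨⟩⇒≈L (F N) (G N) λ g →
  trans (sym (extract F g)) (trans (eq (suc N) (bounded g)) (extract G g))
  where
  only : (ℤ → ℤ) → Test
  only g M x = if does (M ℕ.≟ N) then g x else 0ℤ
  bounded : ∀ g → Bounded (suc N) (only g)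
  bounded g M x lt rewrite dec-false (M ℕ.≟ N) (ℕₚ.>⇒≢ lt) = refl
  extract : ∀ F g → ⟪ F ⟫ (suc N) (only g) ≡ ⟨ F N , g ⟩
  extract F g = trans (∑-upTo-last N λ M → ⟨ F M , only g M ⟩)
    (trans (cong₂ _+_
      (trans (∑-cong-∈ (upTo N) λ M M∈ → ⟨⟩-zero (F M) λ x → off-N M x (∈-upTo⁻ M∈)) (∑-zero (upTo N) λ _ → refl))
      (⟨⟩-cong (F N) at-N)) (+-identityˡ _))
    where
    off-N : ∀ M x → M ℕ.< N → only g M x ≡ 0ℤ
    off-N M x lt rewrite dec-false (M ℕ.≟ N) (ℕₚ.<⇒≢ lt) = refl
    at-N : ∀ x → only g N x ≡ g x
    at-N x rewrite dec-true (N ℕ.≟ N) refl = refl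

eval-μtop : ∀ e t → eval (proj₁ (μtop e)) (ℤtoℚ t) ≡ ℤtoℚ (numAt e t) ×
                    eval (proj₂ (μtop e)) (ℤtoℚ t) ≡ ℤtoℚ (denAt e t)
eval-μtop (const p) t = lem _ (ℤtoℚ t) , lem _ (ℤtoℚ t)
  where
  lem : ∀ x s → x ℚ.+ s ℚ.* 0ℚ ≡ x
  lem = solve-∀-in ℚ-ring
eval-μtop (gen a b) t = lem 1ℚ (ℤtoℚ t) , (begin
  ℚ.- ℤtoℚ b ℚ.+ ℤtoℚ t ℚ.* (ℤtoℚ (+ a) ℚ.+ ℤtoℚ t ℚ.* 0ℚ) ≡⟨ lem' (ℤtoℚ b) (ℤtoℚ t) (ℤtoℚ (+ a)) ⟩
  ℤtoℚ (+ a) ℚ.* ℤtoℚ t ℚ.+ ℚ.- ℤtoℚ b ≡⟨ cong₂ ℚ._+_ (ℤtoℚ-* (+ a) t) (ℤtoℚ-neg b) ⟨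
  ℤtoℚ (+ a * t) ℚ.+ ℤtoℚ (- b) ≡⟨ ℤtoℚ-+ (+ a * t) (- b) ⟨
  ℤtoℚ (+ a * t - b) ∎)
  where
  lem : ∀ x s → x ℚ.+ s ℚ.* 0ℚ ≡ x
  lem = solve-∀-in ℚ-ring
  lem' : ∀ b s a → ℚ.- b ℚ.+ s ℚ.* (a ℚ.+ s ℚ.* 0ℚ) ≡ a ℚ.* s ℚ.+ ℚ.- b
  lem' = solve-∀-in ℚ-ring
eval-μtop (e ⊕ f) t =
  (begin
    eval (addP (mulP nₑ d_f) (mulP n_f dₑ)) s ≡⟨ eval-addP (mulP nₑ d_f) _ s ⟩
    eval (mulP nₑ d_f) s ℚ.+ eval (mulP n_f dₑ) s ≡⟨ cong₂ ℚ._+_ (eval-mulP nₑ d_f s) (eval-mulP n_f dₑ s) ⟩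
    eval nₑ s ℚ.* eval d_f s ℚ.+ eval n_f s ℚ.* eval dₑ s
      ≡⟨ cong₂ ℚ._+_ (cong₂ ℚ._*_ (proj₁ E) (proj₂ F)) (trans (cong₂ ℚ._*_ (proj₁ F) (proj₂ E)) (ℚₚ.*-comm (ℤtoℚ (numAt f t)) _)) ⟩
    ℤtoℚ (numAt e t) ℚ.* ℤtoℚ (denAt f t) ℚ.+ ℤtoℚ (denAt e t) ℚ.* ℤtoℚ (numAt f t)
      ≡⟨ cong₂ ℚ._+_ (ℤtoℚ-* (numAt e t) (denAt f t)) (ℤtoℚ-* (denAt e t) (numAt f t)) ⟨
    ℤtoℚ (numAt e t * denAt f t) ℚ.+ ℤtoℚ (denAt e t * numAt f t) ≡⟨ ℤtoℚ-+ (numAt e t * denAt f t) _ ⟨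
    ℤtoℚ (numAt e t * denAt f t + denAt e t * numAt f t) ∎) ,
  trans (eval-mulP dₑ d_f s) (trans (cong₂ ℚ._*_ (proj₂ E) (proj₂ F)) (sym (ℤtoℚ-* (denAt e t) (denAt f t))))
  where
  E = eval-μtop e t
  F = eval-μtop f t
  s = ℤtoℚ t
  nₑ = proj₁ (μtop e)
  dₑ = proj₂ (μtop e)
  n_f = proj₁ (μtop f)
  d_f = proj₂ (μtop f)
eval-μtop (e ⊗ f) t =
  trans (eval-mulP (proj₁ (μtop e)) (proj₁ (μtop f)) s) (trans (cong₂ ℚ._*_ (proj₁ E) (proj₁ F)) (sym (ℤtoℚ-* (numAt e t) (numAt f t)))) ,
  trans (eval-mulP (proj₂ (μtop e)) (proj₂ (μtop f)) s) (trans (cong₂ ℚ._*_ (proj₂ E) (proj₂ F)) (sym (ℤtoℚ-* (denAt e t) (denAt f t))))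
  where
  E = eval-μtop e t
  F = eval-μtop f t
  s = ℤtoℚ t

-- A generator with b = 0 has denominator a s, which vanishes at 0, but only to order 1 because a ≠
-- 0; orders add under products.
denominator-HasOrder : ∀ e → ∃ λ k → HasOrder k (proj₂ (μtop e))
denominator-HasOrder (const p) = 0 , (λ _ ()) , λ ()
denominator-HasOrder (gen a b) with ℚ.- ℤtoℚ b ℚₚ.≟ 0ℚ
... | no ne = 0 , (λ _ ()) , ne
... | yes eq = 1 , (λ { zero _ → eq ; (suc _) (s≤s ()) }) ,
  λ a≡0 → ℕ.≢-nonZero⁻¹ a (ℤₚ.+-injective (ℤtoℚ-injective (+ a) 0ℤ a≡0))
denominator-HasOrder (e ⊕ f) with denominator-HasOrder e | denominator-HasOrder f
... | k , o | l , o' = k ℕ.+ l , mulP-HasOrder (proj₂ (μtop e)) (proj₂ (μtop f)) o o'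
denominator-HasOrder (e ⊗ f) with denominator-HasOrder e | denominator-HasOrder f
... | k , o | l , o' = k ℕ.+ l , mulP-HasOrder (proj₂ (μtop e)) (proj₂ (μtop f)) o o'

-1L : Laurent
-1L = (0ℤ , - 1ℤ) ∷ []

-- The expression e - f represents 0, and its numerator is the difference of the two cross products.
cross-multiply : ∀ e f → ⟦ e ⟧ ≈S ⟦ f ⟧ → ∀ t →
  numAt e t * denAt f t ≡ numAt f t * denAt e t
cross-multiply e f e≈f t = ℤₚ.i-j≡0⇒i≡j _ _
  (trans (lem (numAt e t) (denAt e t) (numAt f t) (denAt f t)) (numAt≡0 (e ⊕ (const -1L ⊗ f)) difference t))
  where
  lem : ∀ a b c d → a * d - c * b ≡ a * (1ℤ * d) + b * (-[1+ 0 ] * c)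
  lem = solve-∀
  difference : ⟦ e ⊕ (const -1L ⊗ f) ⟧ ≈S (λ _ → [])
  difference = ⟪⟫⇒≈S ⟦ e ⊕ (const -1L ⊗ f) ⟧ (λ _ → []) λ K {g} v → begin
    ⟪ ⟦ e ⊕ (const -1L ⊗ f) ⟧ ⟫ K g ≡⟨ ⟪⊕⟫ e (const -1L ⊗ f) K g ⟩
    ⟪ ⟦ e ⟧ ⟫ K g + ⟪ ⟦ const -1L ⊗ f ⟧ ⟫ K g
      ≡⟨ cong₂ _+_ (⟪⟫-resp ⟦ e ⟧ ⟦ f ⟧ e≈f K g) (trans (⟪⊗⟫ (const -1L) f K v)
           (trans (⟪const⟫ -1L K (⟪shift⟫-Bounded ⟦ f ⟧ K v))
             (trans (trans (∑-singleton (0ℤ , - 1ℤ) _) (ℤₚ.-1*i≡-i _)) (cong -_ (⟪⟫-cong ⟦ f ⟧ K λ N x → cong (g N) (+-identityˡ x)))))) ⟩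
    ⟪ ⟦ f ⟧ ⟫ K g - ⟪ ⟦ f ⟧ ⟫ K g ≡⟨ ℤₚ.+-inverseʳ (⟪ ⟦ f ⟧ ⟫ K g) ⟩
    0ℤ ≡⟨ ∑-zero (upTo K) (λ _ → ∑-[] _) ⟨
    ⟪ (λ _ → []) ⟫ K g ∎

-- N = D (v + d s) + O(s²) with D(0) ≠ 0
Jet : Frac → ℚ → ℚ → Set
Jet (N , D) v d = coeffP D 0 ≢ 0ℚ × coeffP N 0 ≡ v ℚ.* coeffP D 0 ×
  coeffP N 1 ≡ v ℚ.* coeffP D 1 ℚ.+ d ℚ.* coeffP D 0

coeffP-mulP-0 : ∀ p r → coeffP (mulP p r) 0 ≡ coeffP p 0 ℚ.* coeffP r 0
coeffP-mulP-0 [] r = sym (ℚₚ.*-zeroˡ (coeffP r 0))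
coeffP-mulP-0 (x ∷ p) r = trans (coeffP-mulP x p r 0) (ℚₚ.+-identityʳ _)

coeffP-mulP-1 : ∀ p r → coeffP (mulP p r) 1 ≡ coeffP p 0 ℚ.* coeffP r 1 ℚ.+ coeffP p 1 ℚ.* coeffP r 0
coeffP-mulP-1 [] r = lem (coeffP r 1) (coeffP r 0)
  where
  lem : ∀ x y → 0ℚ ≡ 0ℚ ℚ.* x ℚ.+ 0ℚ ℚ.* y
  lem = solve-∀-in ℚ-ring
coeffP-mulP-1 (x ∷ p) r = trans (coeffP-mulP x p r 1) (cong (x ℚ.* coeffP r 1 ℚ.+_) (coeffP-mulP-0 p r))

residual : Frac → Poly → Poly
residual (N , D) ℓ = addP N (negP (mulP D ℓ))

Jet-residual : ∀ f {v d} → Jet f v d → VanishesBelow 2 (residual f (v ∷ d ∷ []))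
Jet-residual (N , D) {v} {d} (D₀ , N₀ , N₁) zero lt = begin
  coeffP (residual (N , D) ℓ) 0 ≡⟨ trans (coeffP-addP N _ 0) (cong (coeffP N 0 ℚ.+_) (coeffP-negP (mulP D ℓ) 0)) ⟩
  coeffP N 0 ℚ.- coeffP (mulP D ℓ) 0 ≡⟨ cong₂ ℚ._-_ N₀ (coeffP-mulP-0 D ℓ) ⟩
  v ℚ.* coeffP D 0 ℚ.- coeffP D 0 ℚ.* v ≡⟨ lem v (coeffP D 0) ⟩
  0ℚ ∎
  where
  ℓ = v ∷ d ∷ []
  lem : ∀ v x → v ℚ.* x ℚ.- x ℚ.* v ≡ 0ℚ
  lem = solve-∀-in ℚ-ring
Jet-residual (N , D) {v} {d} (D₀ , N₀ , N₁) (suc zero) lt = begin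
  coeffP (residual (N , D) ℓ) 1 ≡⟨ trans (coeffP-addP N _ 1) (cong (coeffP N 1 ℚ.+_) (coeffP-negP (mulP D ℓ) 1)) ⟩
  coeffP N 1 ℚ.- coeffP (mulP D ℓ) 1 ≡⟨ cong₂ ℚ._-_ N₁ (coeffP-mulP-1 D ℓ) ⟩
  (v ℚ.* coeffP D 1 ℚ.+ d ℚ.* coeffP D 0) ℚ.- (coeffP D 0 ℚ.* d ℚ.+ coeffP D 1 ℚ.* v) ≡⟨ lem v (coeffP D 1) d (coeffP D 0) ⟩
  0ℚ ∎
  where
  ℓ = v ∷ d ∷ []
  lem : ∀ v y d x → (v ℚ.* y ℚ.+ d ℚ.* x) ℚ.- (x ℚ.* d ℚ.+ y ℚ.* v) ≡ 0ℚ
  lem = solve-∀-in ℚ-ring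
Jet-residual f _ (suc (suc i)) (s≤s (s≤s ()))

eval-residual : ∀ N D ℓ s → eval (residual (N , D) ℓ) s ≡ eval N s ℚ.- eval D s ℚ.* eval ℓ s
eval-residual N D ℓ s = trans (eval-addP N _ s)
  (cong (eval N s ℚ.+_) (trans (eval-negP (mulP D ℓ) s) (cong ℚ.-_ (eval-mulP D ℓ s))))

-- Multiplying out, D_f · residual e = D_e · residual f as polynomials.
ValDerivAt0-transfer : ∀ e f {v d} → ⟦ e ⟧ ≈S ⟦ f ⟧ → Jet (μtop f) v d → ValDerivAt0 (μtop e) v d
ValDerivAt0-transfer e f {v} {d} e≈f jet with denominator-HasOrder e
-- The order of `Dₑ` serves as `k`. The product `Dₑ · R_f` vanishes to order `k + 2`, hence so does
-- `D_f · Rₑ`, and `D_f` is nonzero at 0 and can be cancelled.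
... | k , below , nonzero = k , below , nonzero , mulP-cancel D_f Rₑ (k ℕ.+ 2) (proj₁ jet) λ i lt →
    trans (same i) (proj₁ (mulP-VanishesBelow Dₑ R_f k 2 below (Jet-residual (μtop f) jet)) i lt)
  where
  ℓ = v ∷ d ∷ []
  Nₑ = proj₁ (μtop e)
  Dₑ = proj₂ (μtop e)
  N_f = proj₁ (μtop f)
  D_f = proj₂ (μtop f)
  Rₑ = residual (μtop e) ℓ
  R_f = residual (μtop f) ℓ
  gap = addP (mulP D_f Rₑ) (negP (mulP Dₑ R_f))
  gap-eval : ∀ t → 0 ℕ.≤ t → eval gap (ℤtoℚ (+ t)) ≡ 0ℚ
  gap-eval t _ = begin
    eval gap s ≡⟨ trans (eval-addP (mulP D_f Rₑ) _ s) (cong (eval (mulP D_f Rₑ) s ℚ.+_) (eval-negP (mulP Dₑ R_f) s)) ⟩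
    eval (mulP D_f Rₑ) s ℚ.- eval (mulP Dₑ R_f) s
      ≡⟨ cong₂ ℚ._-_ (trans (eval-mulP D_f Rₑ s) (cong (eval D_f s ℚ.*_) (eval-residual Nₑ Dₑ ℓ s)))
                     (trans (eval-mulP Dₑ R_f s) (cong (eval Dₑ s ℚ.*_) (eval-residual N_f D_f ℓ s))) ⟩
    eval D_f s ℚ.* (eval Nₑ s ℚ.- eval Dₑ s ℚ.* eval ℓ s) ℚ.- eval Dₑ s ℚ.* (eval N_f s ℚ.- eval D_f s ℚ.* eval ℓ s)
      ≡⟨ lem (eval Nₑ s) (eval Dₑ s) (eval N_f s) (eval D_f s) (eval ℓ s) ⟩
    eval Nₑ s ℚ.* eval D_f s ℚ.- eval N_f s ℚ.* eval Dₑ s ≡⟨ cong (ℚ._- eval N_f s ℚ.* eval Dₑ s) cross ⟩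
    eval N_f s ℚ.* eval Dₑ s ℚ.- eval N_f s ℚ.* eval Dₑ s ≡⟨ ℚₚ.+-inverseʳ (eval N_f s ℚ.* eval Dₑ s) ⟩
    0ℚ ∎
    where
    s = ℤtoℚ (+ t)
    lem : ∀ a b c d l → d ℚ.* (a ℚ.- b ℚ.* l) ℚ.- b ℚ.* (c ℚ.- d ℚ.* l) ≡ a ℚ.* d ℚ.- c ℚ.* b
    lem = solve-∀-in ℚ-ring
    cross : eval Nₑ s ℚ.* eval D_f s ≡ eval N_f s ℚ.* eval Dₑ s
    cross = begin
      eval Nₑ s ℚ.* eval D_f s ≡⟨ cong₂ ℚ._*_ (proj₁ (eval-μtop e (+ t))) (proj₂ (eval-μtop f (+ t))) ⟩
      ℤtoℚ (numAt e (+ t)) ℚ.* ℤtoℚ (denAt f (+ t)) ≡⟨ ℤtoℚ-* (numAt e (+ t)) (denAt f (+ t)) ⟨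
      ℤtoℚ (numAt e (+ t) * denAt f (+ t)) ≡⟨ cong ℤtoℚ (cross-multiply e f e≈f (+ t)) ⟩
      ℤtoℚ (numAt f (+ t) * denAt e (+ t)) ≡⟨ ℤtoℚ-* (numAt f (+ t)) (denAt e (+ t)) ⟩
      ℤtoℚ (numAt f (+ t)) ℚ.* ℤtoℚ (denAt e (+ t)) ≡⟨ cong₂ ℚ._*_ (proj₁ (eval-μtop f (+ t))) (proj₂ (eval-μtop e (+ t))) ⟨
      eval N_f s ℚ.* eval Dₑ s ∎
  same : ∀ i → coeffP (mulP D_f Rₑ) i ≡ coeffP (mulP Dₑ R_f) i
  same i = begin
    x ≡⟨ lem x y ⟩
    (x ℚ.- y) ℚ.+ y ≡⟨ cong (ℚ._+ y) (trans (sym (trans (coeffP-addP (mulP D_f Rₑ) _ i) (cong (x ℚ.+_) (coeffP-negP (mulP Dₑ R_f) i))))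
         (coeffP-zero (length gap) gap refl 0 gap-eval i)) ⟩
    0ℚ ℚ.+ y ≡⟨ ℚₚ.+-identityˡ y ⟩
    y ∎
    where
    x = coeffP (mulP D_f Rₑ) i
    y = coeffP (mulP Dₑ R_f) i
    lem : ∀ x y → x ≡ (x ℚ.- y) ℚ.+ y
    lem = solve-∀-in ℚ-ring

-- Matroids

∈-allSubsets : (S : Subset n) → S List.∈ allSubsets n
∈-allSubsets [] = here refl
∈-allSubsets (inside ∷ S) = ∈-concatMap⁺ _ (Any.map (λ { refl → here refl }) (∈-allSubsets S))
∈-allSubsets (outside ∷ S) = ∈-concatMap⁺ _ (Any.map (λ { refl → there (here refl) }) (∈-allSubsets S))

∈⇒≤maxList : ∀ {x xs} → x List.∈ xs → x ℕ.≤ maxList xs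
∈⇒≤maxList {xs = x ∷ xs} (here refl) = ℕₚ.m≤m⊔n x (maxList xs)
∈⇒≤maxList {xs = x ∷ xs} (there x∈) = ℕₚ.≤-trans (∈⇒≤maxList x∈) (ℕₚ.m≤n⊔m x (maxList xs))

maxList-∈ : ∀ {x xs} → x List.∈ xs → maxList xs List.∈ xs
maxList-∈ {xs = x ∷ xs} _ with ℕₚ.⊔-sel x (maxList xs)
... | inj₁ eq = here eq
maxList-∈ {xs = x ∷ []} _ | inj₂ eq = here (ℕₚ.⊔-identityʳ x)
maxList-∈ {xs = x ∷ xs@(_ ∷ _)} _ | inj₂ eq = there (subst (List._∈ xs) (sym eq) (maxList-∈ {xs = xs} (here refl)))

rankOf-ub : ∀ (bs : Subset n → Bool) A B → T (bs B) → ∣ A ∩ B ∣ ℕ.≤ rankOf bs A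
rankOf-ub bs A B b = ∈⇒≤maxList (∈-map⁺ (λ B → ∣ A ∩ B ∣) (∈-filter⁺ _ (∈-allSubsets B) b))

rankOf-attained : ∀ (bs : Subset n → Bool) A → ∃ (T ∘ bs) → ∃ λ B → T (bs B) × ∣ A ∩ B ∣ ≡ rankOf bs A
rankOf-attained bs A (B , b)
  with C , C∈ , eq ← ∈-map⁻ (λ B → ∣ A ∩ B ∣)
         (maxList-∈ (∈-map⁺ (λ B → ∣ A ∩ B ∣) (∈-filter⁺ _ (∈-allSubsets B) b)))
  = C , proj₂ (∈-filter⁻ _ {xs = allSubsets _} C∈) , sym eq

module _ (M : Matroid n) (w : Vec ℕ n) where

  private
    weight : Subset n → ℕ
    weight B = if isBasis M B then wsum w B else 0

    weight-basis : ∀ B → T (isBasis M B) → weight B ≡ wsum w B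
    weight-basis B b with true ← isBasis M B = refl

  wt-ub : ∀ B → T (isBasis M B) → wsum w B ℕ.≤ wt M w
  wt-ub B b = subst (ℕ._≤ wt M w) (weight-basis B b) (∈⇒≤maxList (∈-map⁺ weight (∈-allSubsets B)))

  wt-attained : ∃ λ B → T (isBasis M B) × wsum w B ≡ wt M w
  wt-attained
    with C , _ , eq ← ∈-map⁻ weight (maxList-∈ (∈-map⁺ weight (∈-allSubsets (proj₁ (nonempty M)))))
    with isBasis M C in isB
  ... | true = C , subst T (sym isB) tt , sym eq
  -- The maximum also runs over non-bases, which count as 0. If it is found at one of them it equals
  -- 0, and then any basis attains it.
  ... | false = B₀ , b₀ , trans (ℕₚ.n≤0⇒n≡0 (subst (wsum w B₀ ℕ.≤_) eq (wt-ub B₀ b₀))) (sym eq)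
    where
    B₀ = proj₁ (nonempty M)
    b₀ = proj₂ (nonempty M)

  basesW⁺ : ∀ B → T (isBasis M B) → wsum w B ≡ wt M w → T (basesW M w B)
  basesW⁺ B b eq = Equivalence.from T-∧ (b , ℕₚ.≡⇒≡ᵇ (wsum w B) (wt M w) eq)

  basesW⁻ : ∀ B → T (basesW M w B) → T (isBasis M B) × wsum w B ≡ wt M w
  basesW⁻ B b with b₁ , b₂ ← Equivalence.to (T-∧ {isBasis M B}) b = b₁ , ℕₚ.≡ᵇ⇒≡ (wsum w B) (wt M w) b₂

  basesW-nonempty : ∃ (T ∘ basesW M w)
  basesW-nonempty with B , b , eq ← wt-attained = B , basesW⁺ B b eq

-- The inequality is |B ∖ Y| ≤ |C ∖ Y| written without subtraction. It holds when B ∖ Y ⊆ C, and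
-- otherwise some `x` witnesses the failure.
excess-or-≤ : ∀ (B C Y : Subset n) →
  (∃ λ x → x ∈ B × x ∉ C × x ∉ Y) ⊎ ∣ B ∣ ℕ.+ ∣ Y ∩ C ∣ ℕ.≤ ∣ C ∣ ℕ.+ ∣ Y ∩ B ∣
excess-or-≤ [] [] [] = inj₂ z≤n
excess-or-≤ (b ∷ B) (c ∷ C) (y ∷ Y) with excess-or-≤ B C Y
... | inj₁ (x , x∈B , x∉C , x∉Y) = inj₁ (suc x , there x∈B , (λ { (there p) → x∉C p }) , λ { (there p) → x∉Y p })
excess-or-≤ (inside ∷ B) (outside ∷ C) (outside ∷ Y) | inj₂ le = inj₁ (zero , here , (λ ()) , λ ())
excess-or-≤ (outside ∷ B) (outside ∷ C) (outside ∷ Y) | inj₂ le = inj₂ le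
excess-or-≤ (outside ∷ B) (outside ∷ C) (inside ∷ Y) | inj₂ le = inj₂ le
excess-or-≤ (outside ∷ B) (inside ∷ C) (outside ∷ Y) | inj₂ le = inj₂ (ℕₚ.m≤n⇒m≤1+n le)
excess-or-≤ (outside ∷ B) (inside ∷ C) (inside ∷ Y) | inj₂ le =
  inj₂ (ℕₚ.≤-trans (ℕₚ.≤-reflexive (ℕₚ.+-suc ∣ B ∣ ∣ Y ∩ C ∣)) (s≤s le))
excess-or-≤ (inside ∷ B) (outside ∷ C) (inside ∷ Y) | inj₂ le =
  inj₂ (ℕₚ.≤-trans (s≤s le) (ℕₚ.≤-reflexive (sym (ℕₚ.+-suc ∣ C ∣ ∣ Y ∩ B ∣))))
excess-or-≤ (inside ∷ B) (inside ∷ C) (outside ∷ Y) | inj₂ le = inj₂ (s≤s le)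
excess-or-≤ (inside ∷ B) (inside ∷ C) (inside ∷ Y) | inj₂ le =
  inj₂ (s≤s (subst₂ ℕ._≤_ (sym (ℕₚ.+-suc ∣ B ∣ ∣ Y ∩ C ∣)) (sym (ℕₚ.+-suc ∣ C ∣ ∣ Y ∩ B ∣)) (s≤s le)))

remove-size : ∀ (B : Subset n) x → ∣ B ∣ ℕ.≤ suc ∣ B [ x ]≔ outside ∣
remove-size (inside ∷ B) zero = ℕₚ.≤-refl
remove-size (outside ∷ B) zero = ℕₚ.n≤1+n _
remove-size (inside ∷ B) (suc x) = s≤s (remove-size B x)
remove-size (outside ∷ B) (suc x) = remove-size B x

insert-size : ∀ (B : Subset n) y → y ∉ B → suc ∣ B ∣ ℕ.≤ ∣ B [ y ]≔ inside ∣
insert-size (inside ∷ B) zero y∉ = ⊥-elim (y∉ here)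
insert-size (outside ∷ B) zero y∉ = ℕₚ.≤-refl
insert-size (inside ∷ B) (suc y) y∉ = s≤s (insert-size B y (y∉ ∘ there))
insert-size (outside ∷ B) (suc y) y∉ = insert-size B y (y∉ ∘ there)

remove-⊆ : ∀ (B : Subset n) x {y} → y ∈ B [ x ]≔ outside → y ∈ B
remove-⊆ (b ∷ B) zero (there p) = there p
remove-⊆ (b ∷ B) (suc x) here = here
remove-⊆ (b ∷ B) (suc x) (there p) = there (remove-⊆ B x p)

insert-─ : ∀ (B C : Subset n) y → y ∈ C → ∣ (B [ y ]≔ inside) ─ C ∣ ℕ.≤ ∣ B ─ C ∣
insert-─ (b ∷ B) (c ∷ C) zero here = ℕₚ.≤-refl
insert-─ (b ∷ B) (inside ∷ C) (suc y) (there y∈) = insert-─ B C y y∈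
insert-─ (inside ∷ B) (outside ∷ C) (suc y) (there y∈) = s≤s (insert-─ B C y y∈)
insert-─ (outside ∷ B) (outside ∷ C) (suc y) (there y∈) = insert-─ B C y y∈

remove-─ : ∀ (B C : Subset n) x → x ∈ B → x ∉ C → ∣ (B [ x ]≔ outside) ─ C ∣ ℕ.< ∣ B ─ C ∣
remove-─ (b ∷ B) (inside ∷ C) zero here x∉ = ⊥-elim (x∉ here)
remove-─ (b ∷ B) (outside ∷ C) zero here x∉ = ℕₚ.≤-refl
remove-─ (b ∷ B) (inside ∷ C) (suc x) (there x∈) x∉ = remove-─ B C x x∈ (x∉ ∘ there)
remove-─ (inside ∷ B) (outside ∷ C) (suc x) (there x∈) x∉ = s≤s (remove-─ B C x x∈ (x∉ ∘ there))
remove-─ (outside ∷ B) (outside ∷ C) (suc x) (there x∈) x∉ = remove-─ B C x x∈ (x∉ ∘ there)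

module _ (M : Matroid n) where

  private
    closer : ∀ (B C : Subset n) x y k → x ∈ B → x ∉ C → y ∈ C → ∣ B ─ C ∣ ℕ.≤ suc k →
      ∣ ((B [ x ]≔ outside) [ y ]≔ inside) ─ C ∣ ℕ.≤ k
    closer B C x y k x∈B x∉C y∈C le = ℕₚ.≤-trans (insert-─ (B [ x ]≔ outside) C y y∈C)
      (ℕₚ.≤-pred (ℕₚ.≤-trans (remove-─ B C x x∈B x∉C) le))

    far : ∀ (B C : Subset n) x → x ∈ B → x ∉ C → ¬ (∣ B ─ C ∣ ℕ.≤ 0)
    far B C x x∈B x∉C le with () ← ℕₚ.≤-trans (remove-─ B C x x∈B x∉C) le

  -- Exchanging some x ∈ B ∖ C for an element of `C` brings `B` closer to `C` without making it
  -- smaller. When no such `x` is left, B ⊆ C. The number `k` bounds the exchanges still to be made.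
  bases-≤ : ∀ k B C → T (isBasis M B) → T (isBasis M C) → ∣ B ─ C ∣ ℕ.≤ k → ∣ B ∣ ℕ.≤ ∣ C ∣
  bases-≤ k B C b c le with excess-or-≤ B C ⊥
  ... | inj₂ le' = ℕₚ.≤-trans (ℕₚ.m≤m+n ∣ B ∣ _) (ℕₚ.≤-trans le'
        (ℕₚ.≤-reflexive (trans (cong (∣ C ∣ ℕ.+_) (trans (cong ∣_∣ (Subₚ.∩-zeroˡ B)) (Subₚ.∣⊥∣≡0 n))) (ℕₚ.+-identityʳ _))))
  bases-≤ zero B C b c le | inj₁ (x , x∈B , x∉C , _) = ⊥-elim (far B C x x∈B x∉C le)
  bases-≤ (suc k) B C b c le | inj₁ (x , x∈B , x∉C , _)
    with y , y∈C , y∉B , b' ← exchange M B C b c x x∈B x∉C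
    = ℕₚ.≤-trans (ℕₚ.≤-trans (remove-size B x) (insert-size (B [ x ]≔ outside) y (y∉B ∘ remove-⊆ B x)))
        (bases-≤ k _ C b' c (closer B C x y k x∈B x∉C y∈C le))

  bases-equicardinal : ∀ B C → T (isBasis M B) → T (isBasis M C) → ∣ B ∣ ≡ ∣ C ∣
  bases-equicardinal B C b c = ℕₚ.≤-antisym (bases-≤ _ B C b c ℕₚ.≤-refl) (bases-≤ _ C B c b ℕₚ.≤-refl)

  -- Only elements outside `Y` are exchanged away, so `Y ∩ B` is kept. When B ∖ Y ⊆ C,
  -- equicardinality of `B` and `C` turns |B ∖ Y| ≤ |C ∖ Y| into the bound on the intersections with
  -- `Y`.
  augment-towards : ∀ k B C Y → T (isBasis M B) → T (isBasis M C) → ∣ B ─ C ∣ ℕ.≤ k →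
    ∃ λ B' → T (isBasis M B') × (∀ {i} → i ∈ Y → i ∈ B → i ∈ B') × ∣ Y ∩ C ∣ ℕ.≤ ∣ Y ∩ B' ∣
  augment-towards k B C Y b c le with excess-or-≤ B C Y
  ... | inj₂ le' = B , b , (λ _ i∈ → i∈) ,
        ℕₚ.+-cancelˡ-≤ ∣ B ∣ _ _ (subst (λ m → ∣ B ∣ ℕ.+ ∣ Y ∩ C ∣ ℕ.≤ m ℕ.+ ∣ Y ∩ B ∣) (bases-equicardinal C B c b) le')
  augment-towards zero B C Y b c le | inj₁ (x , x∈B , x∉C , _) = ⊥-elim (far B C x x∈B x∉C le)
  augment-towards (suc k) B C Y b c le | inj₁ (x , x∈B , x∉C , x∉Y)
    with y , y∈C , y∉B , b' ← exchange M B C b c x x∈B x∉C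
    with B' , isB' , keeps , le' ← augment-towards k _ C Y b' c (closer B C x y k x∈B x∉C y∈C le)
    = B' , isB' , (λ {i} i∈Y i∈B → keeps i∈Y (updateAt-minimal i y (B [ x ]≔ outside)
        (λ { refl → y∉B i∈B }) (updateAt-minimal i x B (λ { refl → x∉Y i∈Y }) i∈B))) , le'

  -- Here `C` is a basis meeting `Y` in as many elements as possible.
  augment : ∀ B Y → T (isBasis M B) →
    ∃ λ B' → T (isBasis M B') × (∀ {i} → i ∈ Y → i ∈ B → i ∈ B') × rk M Y ℕ.≤ ∣ Y ∩ B' ∣
  augment B Y b
    with C , c , eq ← rankOf-attained (isBasis M) Y (nonempty M)
    with B' , b' , keeps , le ← augment-towards _ B C Y b c ℕₚ.≤-refl
    = B' , b' , keeps , subst (ℕ._≤ ∣ Y ∩ B' ∣) eq le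

-- Raising a weight by the indicator of a set

increment : Subset n → Vec ℕ n → Vec ℕ n
increment = zipWith λ s k → if s then suc k else k

-- Entries inside `S` may be 0: the support is contained in `S`, and it becomes exactly `S` after
-- `increment S`.
data SupportedOn : Vec ℕ n → Subset n → Set where
  []      : SupportedOn [] []
  outside : ∀ {w : Vec ℕ n} {S} → SupportedOn w S → SupportedOn (0 ∷ w) (outside ∷ S)
  inside  : ∀ {w : Vec ℕ n} {S} k → SupportedOn w S → SupportedOn (k ∷ w) (inside ∷ S)

wsum-mono : ∀ {w : Vec ℕ n} {S B C} → SupportedOn w S → (∀ {i} → i ∈ S → i ∈ B → i ∈ C) → wsum w B ℕ.≤ wsum w C
wsum-mono {B = []} {[]} [] inc = z≤n
wsum-mono {w = _ ∷ w} {B = b ∷ B} {c ∷ C} (outside s) inc =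
  subst₂ ℕ._≤_ (sym (zero-head b B)) (sym (zero-head c C)) (wsum-mono s λ i∈S i∈B → drop (inc (there i∈S) (there i∈B)))
  where
  drop : ∀ {i} → suc i ∈ c ∷ C → i ∈ C
  drop (there p) = p
  zero-head : ∀ b B → wsum (0 ∷ w) (b ∷ B) ≡ wsum w B
  zero-head inside B = refl
  zero-head outside B = refl
wsum-mono {B = b ∷ B} {c ∷ C} (inside k s) inc =
  ℕₚ.+-mono-≤ (head b c (λ { refl → inc here here })) (wsum-mono s λ i∈S i∈B → drop (inc (there i∈S) (there i∈B)))
  where
  drop : ∀ {i} → suc i ∈ c ∷ C → i ∈ C
  drop (there p) = p
  head : ∀ b c → (b ≡ inside → zero ∈ c ∷ C) → (if b then k else 0) ℕ.≤ (if c then k else 0)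
  head inside inside p = ℕₚ.≤-refl
  head inside outside p with () ← p refl
  head outside c p = z≤n

wsum-increment : ∀ S (w : Vec ℕ n) B → wsum (increment S w) B ≡ wsum w B ℕ.+ ∣ S ∩ B ∣
wsum-increment [] [] [] = refl
wsum-increment (inside ∷ S) (k ∷ w) (inside ∷ B) =
  trans (cong (suc k ℕ.+_) (wsum-increment S w B)) (lem k (wsum w B) ∣ S ∩ B ∣)
  where
  lem : ∀ k a b → suc k ℕ.+ (a ℕ.+ b) ≡ k ℕ.+ a ℕ.+ suc b
  lem = solveℕ-∀
wsum-increment (inside ∷ S) (k ∷ w) (outside ∷ B) = wsum-increment S w B
wsum-increment (outside ∷ S) (k ∷ w) (inside ∷ B) =
  trans (cong (k ℕ.+_) (wsum-increment S w B)) (sym (ℕₚ.+-assoc k (wsum w B) _))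
wsum-increment (outside ∷ S) (k ∷ w) (outside ∷ B) = wsum-increment S w B

∣∪∣+∣∩∣ : ∀ (A S B : Subset n) → ∣ A ∩ B ∣ ℕ.+ ∣ S ∩ B ∣ ≡ ∣ (A ∪ S) ∩ B ∣ ℕ.+ ∣ (A ∩ S) ∩ B ∣
∣∪∣+∣∩∣ [] [] [] = refl
∣∪∣+∣∩∣ (inside ∷ A) (inside ∷ S) (inside ∷ B) =
  cong suc (trans (ℕₚ.+-suc ∣ A ∩ B ∣ _) (trans (cong suc (∣∪∣+∣∩∣ A S B)) (sym (ℕₚ.+-suc _ ∣ (A ∩ S) ∩ B ∣))))
∣∪∣+∣∩∣ (inside ∷ A) (outside ∷ S) (inside ∷ B) = cong suc (∣∪∣+∣∩∣ A S B)
∣∪∣+∣∩∣ (outside ∷ A) (inside ∷ S) (inside ∷ B) =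
  trans (ℕₚ.+-suc ∣ A ∩ B ∣ _) (cong suc (∣∪∣+∣∩∣ A S B))
∣∪∣+∣∩∣ (outside ∷ A) (outside ∷ S) (inside ∷ B) = ∣∪∣+∣∩∣ A S B
∣∪∣+∣∩∣ (inside ∷ A) (inside ∷ S) (outside ∷ B) = ∣∪∣+∣∩∣ A S B
∣∪∣+∣∩∣ (inside ∷ A) (outside ∷ S) (outside ∷ B) = ∣∪∣+∣∩∣ A S B
∣∪∣+∣∩∣ (outside ∷ A) (inside ∷ S) (outside ∷ B) = ∣∪∣+∣∩∣ A S B
∣∪∣+∣∩∣ (outside ∷ A) (outside ∷ S) (outside ∷ B) = ∣∪∣+∣∩∣ A S B

equal-summands : ∀ {a b c d} → a ℕ.≤ c → b ℕ.≤ d → c ℕ.+ d ℕ.≤ a ℕ.+ b → a ≡ c × b ≡ d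
equal-summands {a} {b} {c} {d} a≤c b≤d le =
  ℕₚ.≤-antisym a≤c (ℕₚ.+-cancelʳ-≤ d c a (ℕₚ.≤-trans le (ℕₚ.+-monoʳ-≤ a b≤d))) ,
  ℕₚ.≤-antisym b≤d (ℕₚ.+-cancelˡ-≤ c d b (ℕₚ.≤-trans le (ℕₚ.+-monoˡ-≤ b a≤c)))

-- The exponent of q attached to `w` and `A` in `Z` is -ρ: M_w has the same rank as M, so the two
-- full ranks cancel.
ρ : Matroid n → Vec ℕ n → Subset n → ℕ
ρ M w A = wt M w ℕ.+ rankOf (basesW M w) A

-- The basis B₂ below is optimal for w, for S and for A ∪ S at once.
ρ-increment : ∀ (M : Matroid n) {w S} → SupportedOn w S → ∀ A →
  ρ M (increment S w) A ≡ rk M (A ∪ S) ℕ.+ ρ M w (A ∩ S)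
ρ-increment {n} M {w} {S} supp A
  -- `B₀` is optimal for `w` and, among such bases, for `A ∩ S`. Augmenting along `S` and then along
  -- `A ∪ S` loses nothing of `B₀` inside `S`, where the weight `w` and the set `A ∩ S` live.
  with B₀ , b₀w , r₀-eq ← rankOf-attained (basesW M w) (A ∩ S) (basesW-nonempty M w)
  with b₀ , w₀ ← basesW⁻ M w B₀ b₀w
  with B₁ , b₁ , keep₁ , le₁ ← augment M B₀ S b₀
  with B₂ , b₂ , keep₂ , le₂ ← augment M B₁ (A ∪ S) b₁
  with Bmax , bmax , wmax ← wt-attained M (increment S w)
  with D , dw , D-eq ← rankOf-attained (basesW M (increment S w)) A (basesW-nonempty M (increment S w))
  = trans (cong (ℕ._+ R) wt-eq) (trans (lem₁ (wt M w) rS R) (trans (cong (wt M w ℕ.+_) rank-eq) (lem₂ (wt M w) rAS r₀)))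
  where
  w⁺ = increment S w
  rS = rk M S
  rAS = rk M (A ∪ S)
  r₀ = rankOf (basesW M w) (A ∩ S)
  R = rankOf (basesW M w⁺) A
  lem₁ : ∀ a b c → (a ℕ.+ b) ℕ.+ c ≡ a ℕ.+ (c ℕ.+ b)
  lem₁ = solveℕ-∀
  lem₂ : ∀ a b c → a ℕ.+ (b ℕ.+ c) ≡ b ℕ.+ (a ℕ.+ c)
  lem₂ = solveℕ-∀
  S⊆A∪S : ∀ {i} → i ∈ S → i ∈ A ∪ S
  S⊆A∪S = Subₚ.q⊆p∪q A S
  keeps : ∀ {i} → i ∈ S → i ∈ B₀ → i ∈ B₂
  keeps i∈S i∈B = keep₂ (S⊆A∪S i∈S) (keep₁ i∈S i∈B)
  ∩-mono : ∀ {X B C : Subset n} → (∀ {i} → i ∈ X → i ∈ B → i ∈ C) → ∣ X ∩ B ∣ ℕ.≤ ∣ X ∩ C ∣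
  ∩-mono {X} {B} {C} f = Subₚ.p⊆q⇒∣p∣≤∣q∣ {p = X ∩ B} {q = X ∩ C} λ i∈ →
    let i∈X , i∈B = Subₚ.x∈p∩q⁻ X B i∈ in Subₚ.x∈p∩q⁺ (i∈X , f i∈X i∈B)
  w≤ : wt M w ℕ.≤ wsum w B₂
  w≤ = subst (ℕ._≤ wsum w B₂) w₀ (wsum-mono supp keeps)
  rS≤ : rS ℕ.≤ ∣ S ∩ B₂ ∣
  rS≤ = ℕₚ.≤-trans le₁ (∩-mono λ i∈S i∈B → keep₂ (S⊆A∪S i∈S) i∈B)
  r₀≤ : r₀ ℕ.≤ ∣ (A ∩ S) ∩ B₂ ∣
  r₀≤ = subst (ℕ._≤ _) r₀-eq (∩-mono λ i∈ i∈B → keeps (proj₂ (Subₚ.x∈p∩q⁻ A S i∈)) i∈B)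
  wt≤ : wt M w⁺ ℕ.≤ wt M w ℕ.+ rS
  wt≤ = subst (ℕ._≤ wt M w ℕ.+ rS) (trans (sym (wsum-increment S w Bmax)) wmax)
    (ℕₚ.+-mono-≤ (wt-ub M w Bmax bmax) (rankOf-ub (isBasis M) S Bmax bmax))
  B₂≥ : wt M w ℕ.+ rS ℕ.≤ wsum w⁺ B₂
  B₂≥ = subst (wt M w ℕ.+ rS ℕ.≤_) (sym (wsum-increment S w B₂)) (ℕₚ.+-mono-≤ w≤ rS≤)
  wt-eq : wt M w⁺ ≡ wt M w ℕ.+ rS
  wt-eq = ℕₚ.≤-antisym wt≤ (ℕₚ.≤-trans B₂≥ (wt-ub M w⁺ B₂ b₂))
  B₂-max : T (basesW M w⁺ B₂)
  B₂-max = basesW⁺ M w⁺ B₂ b₂ (ℕₚ.≤-antisym (wt-ub M w⁺ B₂ b₂) (ℕₚ.≤-trans wt≤ B₂≥))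
  d = proj₁ (basesW⁻ M w⁺ D dw)
  -- Both summands of the raised weight of `D` are at most their maxima, and the total attains the
  -- sum of the maxima, so each is attained.
  D-split : wsum w D ≡ wt M w × ∣ S ∩ D ∣ ≡ rS
  D-split = equal-summands (wt-ub M w D d) (rankOf-ub (isBasis M) S D d)
    (ℕₚ.≤-reflexive (trans (sym wt-eq) (trans (sym (proj₂ (basesW⁻ M w⁺ D dw))) (wsum-increment S w D))))
  -- The sizes of the intersections with a fixed basis are modular in the other set. The basis `D`
  -- gives one inequality, the basis `B₂` the other.
  rank-eq : R ℕ.+ rS ≡ rAS ℕ.+ r₀
  rank-eq = ℕₚ.≤-antisym
    (subst₂ (λ a b → a ℕ.+ b ℕ.≤ rAS ℕ.+ r₀) D-eq (proj₂ D-split) (subst (ℕ._≤ rAS ℕ.+ r₀) (sym (∣∪∣+∣∩∣ A S D))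
      (ℕₚ.+-mono-≤ (rankOf-ub (isBasis M) (A ∪ S) D d)
        (rankOf-ub (basesW M w) (A ∩ S) D (basesW⁺ M w D d (proj₁ D-split))))))
    (ℕₚ.≤-trans (ℕₚ.+-mono-≤ le₂ r₀≤) (subst (ℕ._≤ R ℕ.+ rS) (∣∪∣+∣∩∣ A S B₂)
      (ℕₚ.+-mono-≤ (rankOf-ub (basesW M w⁺) A B₂ B₂-max) (rankOf-ub (isBasis M) S B₂ b₂))))

rankOf-basesW-⊤ : ∀ (M : Matroid n) w → rankOf (basesW M w) ⊤ ≡ rkM M
rankOf-basesW-⊤ M w
  with B , bw , B-eq ← rankOf-attained (basesW M w) ⊤ (basesW-nonempty M w)
  with C , c , C-eq ← rankOf-attained (isBasis M) ⊤ (nonempty M)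
  = trans (sym B-eq) (trans (trans (cong ∣_∣ (Subₚ.∩-identityˡ B)) (trans
      (bases-equicardinal M B C (proj₁ (basesW⁻ M w B bw)) c) (sym (cong ∣_∣ (Subₚ.∩-identityˡ C))))) C-eq)

inhabitant : ∀ (F : Subset n) {m} → ∣ F ∣ ≡ suc m → ∃ λ e → e ∈ F
inhabitant (inside ∷ F) _ = zero , here
inhabitant (outside ∷ F) size with e , e∈ ← inhabitant F size = suc e , there e∈

-- A single non-loop in `F` already has rank 1. This keeps |F| s + r F from vanishing at s = 0.
rank-nonzero : ∀ (M : Matroid n) → Loopless M → ∀ F {m} → ∣ F ∣ ≡ suc m → rk M F ≢ 0
rank-nonzero M loopless F size eq
  with e , e∈F ← inhabitant F size
  with B , b , B-eq ← rankOf-attained (isBasis M) ⁅ e ⁆ (nonempty M)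
  with () ← subst₂ ℕ._≤_ (trans B-eq (loopless e)) eq (ℕₚ.≤-trans
        (Subₚ.p⊆q⇒∣p∣≤∣q∣ {p = ⁅ e ⁆ ∩ B} {q = F ∩ B} λ i∈ →
           let i∈e , i∈B = Subₚ.x∈p∩q⁻ ⁅ e ⁆ B i∈ in
           Subₚ.x∈p∩q⁺ (subst (_∈ F) (sym (Subₚ.x∈⁅y⁆⇒x≡y e i∈e)) e∈F , i∈B))
        (rankOf-ub (isBasis M) F B b))

rk-⊥ : ∀ (M : Matroid n) → rk M ⊥ ≡ 0
rk-⊥ {n} M with B , b , eq ← rankOf-attained (isBasis M) ⊥ (nonempty M) =
  trans (sym eq) (trans (cong ∣_∣ (Subₚ.∩-zeroˡ B)) (Subₚ.∣⊥∣≡0 n))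

ρ-zero : ∀ (M : Matroid n) → ρ M (replicate n 0) ⊥ ≡ 0
ρ-zero {n} M
  with B , _ , eq ← wt-attained M (replicate n 0)
  with C , _ , eq' ← rankOf-attained (basesW M (replicate n 0)) ⊥ (basesW-nonempty M (replicate n 0))
  = cong₂ ℕ._+_ (trans (sym eq) (wsum-zero B)) (trans (sym eq') (trans (cong ∣_∣ (Subₚ.∩-zeroˡ C)) (Subₚ.∣⊥∣≡0 n)))
  where
  wsum-zero : ∀ {n} (B : Subset n) → wsum (replicate n 0) B ≡ 0
  wsum-zero [] = refl
  wsum-zero (inside ∷ B) = wsum-zero B
  wsum-zero (outside ∷ B) = wsum-zero B

-- Sums over subsets and weights, and the recursion for zeta functions

∑-cong-All : {P : A → Set} {xs : List A} → All P xs → {h k : A → ℤ} →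
  (∀ {x} → P x → h x ≡ k x) → ∑ xs h ≡ ∑ xs k
∑-cong-All {xs = xs} ps eq = ∑-cong-∈ xs λ x x∈ → eq (All.lookup ps x∈)

-- `F` comes first, so that the term S = F of the recursion splits off as the head of the list.
subsets proper : Subset n → List (Subset n)
subsets F = F ∷ proper F
proper [] = []
proper (outside ∷ F) = map (outside ∷_) (proper F)
proper (inside ∷ F) = map (outside ∷_) (subsets F) ++ map (inside ∷_) (proper F)

∑-subsets-outside : ∀ (F : Subset n) h → ∑ (subsets (outside ∷ F)) h ≡ ∑ (subsets F) (h ∘ (outside ∷_))
∑-subsets-outside F h = ∑-map (outside ∷_) (subsets F) h

∑-subsets-inside : ∀ (F : Subset n) h →
  ∑ (subsets (inside ∷ F)) h ≡ ∑ (subsets F) (h ∘ (outside ∷_)) + ∑ (subsets F) (h ∘ (inside ∷_))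
∑-subsets-inside F h = trans (trans (∑-∷ (inside ∷ F) _ h)
  (addˡ (h (inside ∷ F)) (trans (∑-++ (map (outside ∷_) (subsets F)) _ h)
    (cong₂ _+_ (∑-map (outside ∷_) (subsets F) h) (∑-map (inside ∷_) (proper F) h)))))
  (trans (lem (h (inside ∷ F)) (∑ (subsets F) (h ∘ (outside ∷_))) (∑ (proper F) (h ∘ (inside ∷_))))
    (addˡ (∑ (subsets F) (h ∘ (outside ∷_))) (sym (∑-∷ F (proper F) (h ∘ (inside ∷_))))))
  where
  lem : ∀ a b c → a + (b + c) ≡ b + (a + c)
  lem = solve-∀

∑-allSubsets : ∀ n (h : Subset n → ℤ) → ∑ (allSubsets n) h ≡ ∑ (subsets ⊤) h
∑-allSubsets zero h = refl
∑-allSubsets (suc n) h = begin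
  ∑ (allSubsets (suc n)) h ≡⟨ ∑-concatMap (λ S → (inside ∷ S) ∷ (outside ∷ S) ∷ []) (allSubsets n) h ⟩
  ∑ (allSubsets n) (λ S → ∑ ((inside ∷ S) ∷ (outside ∷ S) ∷ []) h)
    ≡⟨ ∑-cong (allSubsets n) (λ S → trans (∑-∷ (inside ∷ S) _ h) (trans
         (addˡ (h (inside ∷ S)) (∑-singleton (outside ∷ S) h)) (+-comm (h (inside ∷ S)) _))) ⟩
  ∑ (allSubsets n) (λ S → h (outside ∷ S) + h (inside ∷ S)) ≡⟨ ∑-allSubsets n _ ⟩
  ∑ (subsets ⊤) (λ S → h (outside ∷ S) + h (inside ∷ S)) ≡⟨ ∑-+ (subsets ⊤) _ _ ⟩
  ∑ (subsets ⊤) (h ∘ (outside ∷_)) + ∑ (subsets ⊤) (h ∘ (inside ∷_)) ≡⟨ ∑-subsets-inside ⊤ h ⟨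
  ∑ (subsets (inside ∷ ⊤)) h ∎

data _⊑_ : Subset n → Subset n → Set where
  []   : [] ⊑ []
  skip : ∀ {S F : Subset n} b → S ⊑ F → (outside ∷ S) ⊑ (b ∷ F)
  keep : ∀ {S F : Subset n} → S ⊑ F → (inside ∷ S) ⊑ (inside ∷ F)

⊑-refl : (F : Subset n) → F ⊑ F
⊑-refl [] = []
⊑-refl (outside ∷ F) = skip outside (⊑-refl F)
⊑-refl (inside ∷ F) = keep (⊑-refl F)

⊑⇒size : {S F : Subset n} → S ⊑ F → ∣ S ∣ ℕ.≤ ∣ F ∣
⊑⇒size [] = z≤n
⊑⇒size (skip outside s) = ⊑⇒size s
⊑⇒size (skip inside s) = ℕₚ.m≤n⇒m≤1+n (⊑⇒size s)
⊑⇒size (keep s) = s≤s (⊑⇒size s)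

subsets-⊑ : (F : Subset n) → All (_⊑ F) (subsets F)
proper-⊏ : (F : Subset n) → All (λ S → S ⊑ F × ∣ S ∣ ℕ.< ∣ F ∣) (proper F)
subsets-⊑ F = ⊑-refl F ∷ All.map proj₁ (proper-⊏ F)
proper-⊏ [] = []
proper-⊏ (outside ∷ F) = Allₚ.map⁺ (All.map (λ (s , lt) → skip outside s , lt) (proper-⊏ F))
proper-⊏ (inside ∷ F) = Allₚ.++⁺
  (Allₚ.map⁺ (All.map (λ s → skip inside s , s≤s (⊑⇒size s)) (subsets-⊑ F)))
  (Allₚ.map⁺ (All.map (λ (s , lt) → keep s , s≤s lt) (proper-⊏ F)))

-- Signed sums over subsets

neg-* : ∀ a b → (- a) * b ≡ - (a * b)
neg-* = solve-∀

-- Each A ⊆ F is the disjoint union of C = A ∖ S and A ∩ S. The sign is multiplicative in this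
-- decomposition, and A ∪ S = C ∪ S.
∑-sign-split : {S F : Subset n} → S ⊑ F → (h : Subset n → Subset n → ℤ) →
  ∑ (subsets F) (λ A → sign ∣ A ∣ * h (A ∪ S) (A ∩ S)) ≡
  ∑ (subsets (F ─ S)) (λ C → sign ∣ C ∣ * ∑ (subsets S) (λ A → sign ∣ A ∣ * h (C ∪ S) A))
∑-sign-split [] h = trans (∑-singleton [] _) (sym (trans (∑-singleton [] _) (trans (*-identityˡ _) (∑-singleton [] _))))
∑-sign-split {S = outside ∷ S} {outside ∷ F} (skip outside s) h = begin
  ∑ (subsets (outside ∷ F)) (λ A → sign ∣ A ∣ * h (A ∪ (outside ∷ S)) (A ∩ (outside ∷ S)))
    ≡⟨ ∑-subsets-outside F _ ⟩
  _ ≡⟨ ∑-sign-split s (λ X Y → h (outside ∷ X) (outside ∷ Y)) ⟩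
  ∑ (subsets (F ─ S)) (λ C → sign ∣ C ∣ * ∑ (subsets S) (λ A → sign ∣ A ∣ * h (outside ∷ (C ∪ S)) (outside ∷ A)))
    ≡⟨ ∑-cong (subsets (F ─ S)) (λ C → cong (sign ∣ C ∣ *_) (sym (∑-subsets-outside S _))) ⟩
  _ ≡⟨ ∑-subsets-outside (F ─ S) _ ⟨
  _ ∎
∑-sign-split {S = outside ∷ S} {inside ∷ F} (skip inside s) h = begin
  ∑ (subsets (inside ∷ F)) (λ A → sign ∣ A ∣ * h (A ∪ (outside ∷ S)) (A ∩ (outside ∷ S)))
    ≡⟨ ∑-subsets-inside F _ ⟩
  ∑ (subsets F) (λ A → sign ∣ A ∣ * h (outside ∷ (A ∪ S)) (outside ∷ (A ∩ S))) +
  ∑ (subsets F) (λ A → - sign ∣ A ∣ * h (inside ∷ (A ∪ S)) (outside ∷ (A ∩ S)))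
    ≡⟨ cong₂ _+_ (∑-sign-split s (λ X Y → h (outside ∷ X) (outside ∷ Y)))
         (trans (∑-cong (subsets F) λ A → neg-* (sign ∣ A ∣) _) (trans (∑-neg (subsets F) _)
           (trans (cong -_ (∑-sign-split s (λ X Y → h (inside ∷ X) (outside ∷ Y))))
             (trans (sym (∑-neg (subsets (F ─ S)) _)) (∑-cong (subsets (F ─ S)) λ C → sym (neg-* (sign ∣ C ∣) _)))))) ⟩
  ∑ (subsets (F ─ S)) (λ C → sign ∣ C ∣ * ∑ (subsets S) (λ A → sign ∣ A ∣ * h (outside ∷ (C ∪ S)) (outside ∷ A))) +
  ∑ (subsets (F ─ S)) (λ C → - sign ∣ C ∣ * ∑ (subsets S) (λ A → sign ∣ A ∣ * h (inside ∷ (C ∪ S)) (outside ∷ A)))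
    ≡⟨ cong₂ _+_
         (∑-cong (subsets (F ─ S)) λ C → cong (sign ∣ C ∣ *_) (sym (∑-subsets-outside S _)))
         (∑-cong (subsets (F ─ S)) λ C → cong (- sign ∣ C ∣ *_) (sym (∑-subsets-outside S _))) ⟩
  _ ≡⟨ ∑-subsets-inside (F ─ S) _ ⟨
  _ ∎
∑-sign-split {S = inside ∷ S} {inside ∷ F} (keep s) h = begin
  ∑ (subsets (inside ∷ F)) (λ A → sign ∣ A ∣ * h (A ∪ (inside ∷ S)) (A ∩ (inside ∷ S)))
    ≡⟨ ∑-subsets-inside F _ ⟩
  ∑ (subsets F) (λ A → sign ∣ A ∣ * h (inside ∷ (A ∪ S)) (outside ∷ (A ∩ S))) +
  ∑ (subsets F) (λ A → - sign ∣ A ∣ * h (inside ∷ (A ∪ S)) (inside ∷ (A ∩ S)))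
    ≡⟨ cong₂ _+_ (∑-sign-split s (λ X Y → h (inside ∷ X) (outside ∷ Y)))
         (trans (∑-cong (subsets F) λ A → neg-*ʳ (sign ∣ A ∣) _) (∑-sign-split s (λ X Y → - h (inside ∷ X) (inside ∷ Y)))) ⟩
  ∑ (subsets (F ─ S)) (λ C → sign ∣ C ∣ * ∑ (subsets S) (λ A → sign ∣ A ∣ * h (inside ∷ (C ∪ S)) (outside ∷ A))) +
  ∑ (subsets (F ─ S)) (λ C → sign ∣ C ∣ * ∑ (subsets S) (λ A → sign ∣ A ∣ * - h (inside ∷ (C ∪ S)) (inside ∷ A)))
    ≡⟨ ∑-+ (subsets (F ─ S)) _ _ ⟨
  ∑ (subsets (F ─ S)) (λ C →
    sign ∣ C ∣ * ∑ (subsets S) (λ A → sign ∣ A ∣ * h (inside ∷ (C ∪ S)) (outside ∷ A)) +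
    sign ∣ C ∣ * ∑ (subsets S) (λ A → sign ∣ A ∣ * - h (inside ∷ (C ∪ S)) (inside ∷ A)))
    ≡⟨ ∑-cong (subsets (F ─ S)) (λ C → trans (sym (ℤₚ.*-distribˡ-+ (sign ∣ C ∣) _ _))
         (cong (sign ∣ C ∣ *_) (trans
           (addˡ (∑ (subsets S) _) (∑-cong (subsets S) λ A → sym (neg-*ʳ (sign ∣ A ∣) _)))
           (sym (∑-subsets-inside S _))))) ⟩
  ∑ (subsets (F ─ S)) (λ C → sign ∣ C ∣ * ∑ (subsets (inside ∷ S)) (λ A → sign ∣ A ∣ * h (inside ∷ (C ∪ S)) A))
    ≡⟨ ∑-subsets-outside (F ─ S) _ ⟨
  _ ∎
  where
  neg-*ʳ : ∀ a b → (- a) * b ≡ a * - b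
  neg-*ʳ = solve-∀

-- Subsets with and without a fixed element of F ∖ S cancel. This is the vanishing of c(F, S) at q =
-- 1.
∑-sign-proper : {S F : Subset n} → S ⊑ F → ∣ S ∣ ℕ.< ∣ F ∣ → ∑ (subsets (F ─ S)) (λ C → sign ∣ C ∣) ≡ 0ℤ
∑-sign-proper {S = outside ∷ S} {outside ∷ F} (skip outside s) lt =
  trans (∑-subsets-outside (F ─ S) (λ C → sign ∣ C ∣)) (∑-sign-proper s lt)
∑-sign-proper {S = outside ∷ S} {inside ∷ F} (skip inside s) lt =
  trans (∑-subsets-inside (F ─ S) (λ C → sign ∣ C ∣))
    (trans (addˡ (∑ (subsets (F ─ S)) λ C → sign ∣ C ∣) (∑-neg (subsets (F ─ S)) λ C → sign ∣ C ∣)) (ℤₚ.+-inverseʳ (∑ (subsets (F ─ S)) λ C → sign ∣ C ∣)))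
∑-sign-proper {S = inside ∷ S} {inside ∷ F} (keep s) (s≤s lt) =
  trans (∑-subsets-outside (F ─ S) (λ C → sign ∣ C ∣)) (∑-sign-proper s lt)

-- The Möbius inverse of `f` from above in the Boolean lattice below `F`: with X = C ∪ S it is the
-- sum of (-1)^|X ∖ S| f(X) over S ⊆ X ⊆ F.
upper : (F : Subset n) (f : Subset n → ℤ) → Subset n → ℤ
upper F f S = ∑ (subsets (F ─ S)) (λ C → sign ∣ C ∣ * f (C ∪ S))

upper-outside : ∀ (F : Subset n) f S → upper (outside ∷ F) f (outside ∷ S) ≡ upper F (f ∘ (outside ∷_)) S
upper-outside F f S = ∑-subsets-outside (F ─ S) _

upper-inside : ∀ (F : Subset n) f S → upper (inside ∷ F) f (inside ∷ S) ≡ upper F (f ∘ (inside ∷_)) S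
upper-inside F f S = ∑-subsets-outside (F ─ S) _

upper-between : ∀ (F : Subset n) f S → upper (inside ∷ F) f (outside ∷ S) ≡
  upper F (f ∘ (outside ∷_)) S - upper F (f ∘ (inside ∷_)) S
upper-between F f S = trans (∑-subsets-inside (F ─ S) _)
  (addˡ (upper F (f ∘ (outside ∷_)) S)
    (trans (∑-cong (subsets (F ─ S)) λ C → neg-* (sign ∣ C ∣) (f (inside ∷ (C ∪ S)))) (∑-neg (subsets (F ─ S)) _)))

-- Möbius inversion at the empty set; for each element of `F`, the terms containing it telescope
-- away.
∑-upper : ∀ (F : Subset n) f → ∑ (subsets F) (upper F f) ≡ f ⊥
∑-upper [] f = trans (∑-singleton [] _) (trans (∑-singleton [] _) (*-identityˡ _))
∑-upper (outside ∷ F) f = trans (∑-subsets-outside F _)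
  (trans (∑-cong (subsets F) (upper-outside F f)) (∑-upper F (f ∘ (outside ∷_))))
∑-upper (inside ∷ F) f = begin
  ∑ (subsets (inside ∷ F)) (upper (inside ∷ F) f) ≡⟨ ∑-subsets-inside F _ ⟩
  _ ≡⟨ cong₂ _+_ (trans (∑-cong (subsets F) (upper-between F f)) (∑-minus (subsets F) _ _))
         (∑-cong (subsets F) (upper-inside F f)) ⟩
  (∑ (subsets F) u₀ - ∑ (subsets F) u₁) + ∑ (subsets F) u₁ ≡⟨ lem (∑ (subsets F) u₀) (∑ (subsets F) u₁) ⟩
  ∑ (subsets F) u₀ ≡⟨ ∑-upper F (f ∘ (outside ∷_)) ⟩
  f ⊥ ∎
  where
  u₀ = upper F (f ∘ (outside ∷_))
  u₁ = upper F (f ∘ (inside ∷_))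
  lem : ∀ a b → (a - b) + b ≡ a
  lem = solve-∀

-- Writing |S| as a sum over its elements, the sets S containing a given e ∈ F contribute f({e}) = 1
-- by Möbius inversion at {e}.
∑-size-upper : ∀ (F : Subset n) f → (∀ e → f ⁅ e ⁆ ≡ 1ℤ) →
  ∑ (subsets F) (λ S → + ∣ S ∣ * upper F f S) ≡ + ∣ F ∣
∑-size-upper [] f one = trans (∑-singleton [] _) (*-zeroˡ (upper [] f []))
∑-size-upper (outside ∷ F) f one = trans (∑-subsets-outside F _)
  (trans (∑-cong (subsets F) λ S → cong (+ ∣ S ∣ *_) (upper-outside F f S))
    (∑-size-upper F (f ∘ (outside ∷_)) (one ∘ suc)))
∑-size-upper (inside ∷ F) f one = begin
  ∑ (subsets (inside ∷ F)) (λ S → + ∣ S ∣ * upper (inside ∷ F) f S) ≡⟨ ∑-subsets-inside F _ ⟩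
  _ ≡⟨ ∑-+ (subsets F) _ _ ⟨
  ∑ (subsets F) (λ S → + ∣ S ∣ * upper (inside ∷ F) f (outside ∷ S) + + suc ∣ S ∣ * upper (inside ∷ F) f (inside ∷ S))
    ≡⟨ ∑-cong (subsets F) (λ S → trans (cong₂ (λ x y → + ∣ S ∣ * x + + suc ∣ S ∣ * y) (upper-between F f S) (upper-inside F f S))
         (lem (+ ∣ S ∣) (u₀ S) (u₁ S))) ⟩
  ∑ (subsets F) (λ S → u₁ S + + ∣ S ∣ * u₀ S) ≡⟨ ∑-+ (subsets F) u₁ _ ⟩
  ∑ (subsets F) u₁ + ∑ (subsets F) (λ S → + ∣ S ∣ * u₀ S)
    ≡⟨ cong₂ _+_ (trans (∑-upper F (f ∘ (inside ∷_))) (one zero)) (∑-size-upper F (f ∘ (outside ∷_)) (one ∘ suc)) ⟩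
  1ℤ + + ∣ F ∣ ∎
  where
  u₀ = upper F (f ∘ (outside ∷_))
  u₁ = upper F (f ∘ (inside ∷_))
  lem : ∀ k a b → k * (a - b) + (1ℤ + k) * b ≡ b + k * a
  lem = solve-∀

-- A box with all entries below `K`, so that sums factor over coordinates. The weights of total size
-- at least `K` in it pair to 0 with test functions bounded by `K`.
weights : ℕ → Subset n → List (Vec ℕ n)
weights K [] = [] ∷ []
weights K (outside ∷ F) = map (0 ∷_) (weights K F)
weights K (inside ∷ F) = concatMap (λ k → map (k ∷_) (weights K F)) (upTo K)

∑-weights-outside : ∀ K (F : Subset n) h → ∑ (weights K (outside ∷ F)) h ≡ ∑ (weights K F) (h ∘ (0 ∷_))
∑-weights-outside K F h = ∑-map (0 ∷_) (weights K F) h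

∑-weights-inside : ∀ K (F : Subset n) h →
  ∑ (weights K (inside ∷ F)) h ≡ ∑ (upTo K) (λ k → ∑ (weights K F) (h ∘ (k ∷_)))
∑-weights-inside K F h = trans (∑-concatMap (λ k → map (k ∷_) (weights K F)) (upTo K) h)
  (∑-cong (upTo K) λ k → ∑-map (k ∷_) (weights K F) h)

weights-supported : ∀ K (F : Subset n) → All (λ w → SupportedOn w F) (weights K F)
weights-supported K [] = [] ∷ []
weights-supported K (outside ∷ F) = Allₚ.map⁺ (All.map outside (weights-supported K F))
weights-supported K (inside ∷ F) = Allₚ.concat⁺ (Allₚ.map⁺ (All.universal
  (λ k → Allₚ.map⁺ (All.map (inside k) (weights-supported K F))) (upTo K)))

sum-increment : ∀ S (w : Vec ℕ n) → sum (increment S w) ≡ ∣ S ∣ ℕ.+ sum w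
sum-increment [] [] = refl
sum-increment (inside ∷ S) (k ∷ w) = cong suc (trans (cong (k ℕ.+_) (sum-increment S w))
  (·-x∙yz≈y∙xz ℕₚ.+-commutativeSemigroup k ∣ S ∣ (sum w)))
sum-increment (outside ∷ S) (k ∷ w) = trans (cong (k ℕ.+_) (sum-increment S w))
  (·-x∙yz≈y∙xz ℕₚ.+-commutativeSemigroup k ∣ S ∣ (sum w))

-- Every `w` is w′ + 1_S for S its support and a unique w′ supported in S.
∑-weights-split : ∀ K (F : Subset n) (h : Vec ℕ n → ℤ) → (∀ w → K ℕ.≤ sum w → h w ≡ 0ℤ) →
  ∑ (weights K F) h ≡ ∑ (subsets F) (λ S → ∑ (weights K S) (h ∘ increment S))
∑-weights-split K [] h v = sym (trans (∑-singleton [] _) (∑-cong (weights K []) λ { [] → refl }))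
∑-weights-split K (outside ∷ F) h v = begin
  ∑ (weights K (outside ∷ F)) h ≡⟨ ∑-weights-outside K F h ⟩
  ∑ (weights K F) (h ∘ (0 ∷_)) ≡⟨ ∑-weights-split K F (h ∘ (0 ∷_)) (λ w → v (0 ∷ w)) ⟩
  ∑ (subsets F) (λ S → ∑ (weights K S) (λ w → h (0 ∷ increment S w)))
    ≡⟨ ∑-cong (subsets F) (λ S → sym (∑-weights-outside K S _)) ⟩
  ∑ (subsets F) (λ S → ∑ (weights K (outside ∷ S)) (h ∘ increment (outside ∷ S))) ≡⟨ ∑-subsets-outside F _ ⟨
  _ ∎
∑-weights-split K (inside ∷ F) h v = begin
  ∑ (weights K (inside ∷ F)) h ≡⟨ ∑-weights-inside K F h ⟩
  ∑ (upTo K) (λ k → ∑ (weights K F) (h ∘ (k ∷_)))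
    ≡⟨ ∑-cong (upTo K) (λ k → ∑-weights-split K F (h ∘ (k ∷_)) (λ w le → v (k ∷ w) (ℕₚ.≤-trans le (ℕₚ.m≤n+m _ k)))) ⟩
  ∑ (upTo K) H
    -- The head entry is also allowed to be `K`, where `h` vanishes. After splitting off the entry
    -- 0, the remaining entries are `suc k` with `k` again in the full range.
    ≡⟨ ∑-upTo-extend K H (∑-zero (subsets F) λ S → ∑-zero (weights K S) λ w → v _ (ℕₚ.m≤m+n K _)) ⟨
  ∑ (upTo (suc K)) H ≡⟨ ∑-upTo-suc K H ⟩
  H 0 + ∑ (upTo K) (H ∘ suc)
    ≡⟨ cong₂ _+_ (∑-cong (subsets F) λ S → sym (∑-weights-outside K S _))
         (trans (∑-swap (upTo K) (subsets F) _) (∑-cong (subsets F) λ S → sym (∑-weights-inside K S _))) ⟩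
  _ ≡⟨ ∑-subsets-inside F (λ S → ∑ (weights K S) (h ∘ increment S)) ⟨
  _ ∎
  where
  H : ℕ → ℤ
  H k = ∑ (subsets F) (λ S → ∑ (weights K S) (λ w → h (k ∷ increment S w)))

∑-weightsOfSize : ∀ n K (h : ℕ → Vec ℕ n → ℤ) → (∀ N w → K ℕ.≤ N → h N w ≡ 0ℤ) →
  ∑ (upTo K) (λ N → ∑ (weightsOfSize n N) (h N)) ≡ ∑ (weights K ⊤) (λ w → h (sum w) w)
∑-weightsOfSize zero zero h v = trans (∑-[] _) (sym (trans (∑-singleton [] _) (v 0 [] z≤n)))
∑-weightsOfSize zero (suc K) h v = trans (∑-upTo-suc K (λ N → ∑ (weightsOfSize 0 N) (h N)))
  (trans (+zero _ (∑-zero (upTo K) λ _ → ∑-[] _)) (trans (∑-singleton [] _) (sym (∑-singleton [] _))))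
∑-weightsOfSize (suc n) K h v = begin
  ∑ (upTo K) (λ N → ∑ (weightsOfSize (suc n) N) (h N))
    ≡⟨ ∑-cong (upTo K) (λ N → trans (∑-concatMap (λ k → map (k ∷_) (weightsOfSize n (N ℕ.∸ k))) (upTo (suc N)) (h N))
         (∑-cong-∈ (upTo (suc N)) λ k k∈ → trans (∑-map (k ∷_) (weightsOfSize n (N ℕ.∸ k)) (h N))
           (cong (λ L → ∑ (weightsOfSize n (N ℕ.∸ k)) (λ w → h L (k ∷ w)))
             (sym (ℕₚ.m+[n∸m]≡n (ℕₚ.≤-pred (∈-upTo⁻ k∈))))))) ⟩
  ∑ (upTo K) (λ N → ∑ (upTo (suc N)) (λ k → G k (N ℕ.∸ k)))
    ≡⟨ ∑-cauchy K G (λ k l le → ∑-zero (weightsOfSize n l) λ w → v (k ℕ.+ l) (k ∷ w) le) ⟩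
  ∑ (upTo K) (λ k → ∑ (upTo K) (G k))
    ≡⟨ ∑-cong (upTo K) (λ k → ∑-weightsOfSize n K (λ l w → h (k ℕ.+ l) (k ∷ w))
         λ l w le → v _ _ (ℕₚ.≤-trans le (ℕₚ.m≤n+m l k))) ⟩
  ∑ (upTo K) (λ k → ∑ (weights K ⊤) (λ w → h (k ℕ.+ sum w) (k ∷ w))) ≡⟨ ∑-weights-inside K ⊤ _ ⟨
  ∑ (weights K (inside ∷ ⊤)) (λ w → h (sum w) w) ∎
  where
  G : ℕ → ℕ → ℤ
  G k l = ∑ (weightsOfSize n l) (λ w → h (k ℕ.+ l) (k ∷ w))

-- Zeta functions of restrictions

module _ (M : Matroid n) where

  -- The series Σ_w T^|w| Σ_{A ⊆ F} (−1)^|A| q^(−ρ(w, A)) over w supported on F, paired with g: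
  -- this is Z of the restriction of M to F.
  zeta : ℕ → Subset n → Test → ℤ
  zeta K F g = ∑ (weights K F) λ w → ∑ (subsets F) λ A → sign ∣ A ∣ * g (sum w) (- (+ ρ M w A))

  zeta-cong : ∀ K F {g h : Test} → (∀ N x → g N x ≡ h N x) → zeta K F g ≡ zeta K F h
  zeta-cong K F eq = ∑-cong (weights K F) λ w → ∑-cong (subsets F) λ A → cong (sign ∣ A ∣ *_) (eq _ _)

  zeta-zero : ∀ K F {g : Test} → (∀ N x → g N x ≡ 0ℤ) → zeta K F g ≡ 0ℤ
  zeta-zero K F eq = ∑-zero (weights K F) λ w → ∑-zero (subsets F) λ A →
    trans (cong (sign ∣ A ∣ *_) (eq _ _)) (*-zeroʳ (sign ∣ A ∣))

  zeta-minus : ∀ K F (g h : Test) → zeta K F (λ N x → g N x - h N x) ≡ zeta K F g - zeta K F h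
  zeta-minus K F g h = trans (∑-cong (weights K F) λ w →
      trans (∑-cong (subsets F) λ A → lem (sign ∣ A ∣) _ _) (∑-minus (subsets F) _ _))
    (∑-minus (weights K F) _ _)
    where
    lem : ∀ a b c → a * (b - c) ≡ a * b - a * c
    lem = solve-∀

  -- The coefficient c(F, S), with A written as C ∪ S.
  lowerTerms : Subset n → Subset n → Laurent
  lowerTerms F S = map (λ C → (- (+ rk M (C ∪ S)) , sign ∣ C ∣)) (subsets (F ─ S))

  -- Weights are split by their support `S` and sets `A` into A ∖ S and A ∩ S. By `ρ-increment` the
  -- exponent separates into a part depending on C ∪ S, giving c(F, S), and a part that reassembles
  -- into the zeta function of `S`.
  zeta-rec : ∀ K F {g} → Bounded K g →
    zeta K F g ≡ ∑ (subsets F) λ S → ⟨ lowerTerms F S , (λ x → zeta K S (shift ∣ S ∣ x g)) ⟩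
  zeta-rec K F {g} v = begin
    zeta K F g ≡⟨ ∑-weights-split K F _ (λ w le → ∑-zero (subsets F) λ A →
                    trans (cong (sign ∣ A ∣ *_) (v _ _ le)) (*-zeroʳ (sign ∣ A ∣))) ⟩
    ∑ (subsets F) (λ S → ∑ (weights K S) λ w → ∑ (subsets F) λ A →
        sign ∣ A ∣ * g (sum (increment S w)) (- (+ ρ M (increment S w) A)))
      ≡⟨ ∑-cong-All (subsets-⊑ F) (λ {S} S⊑F → trans
           (∑-cong-All (weights-supported K S) λ {w} supp → trans
             (∑-cong (subsets F) λ A → cong (sign ∣ A ∣ *_)
               (cong₂ g (sum-increment S w) (trans (cong (λ m → - (+ m)) (ρ-increment M supp A))
                 (trans (cong -_ (ℤₚ.pos-+ (rk M (A ∪ S)) (ρ M w (A ∩ S)))) (ℤₚ.neg-distrib-+ (+ rk M (A ∪ S)) (+ ρ M w (A ∩ S)))))))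
             (∑-sign-split S⊑F (λ X Y → shift ∣ S ∣ (- (+ rk M X)) g (sum w) (- (+ ρ M w Y)))))
           (trans (∑-swap (weights K S) (subsets (F ─ S)) _)
             (trans (∑-cong (subsets (F ─ S)) λ C → ∑-*ˡ (sign ∣ C ∣) (weights K S) _)
               (sym (∑-map _ (subsets (F ─ S)) _))))) ⟩
    ∑ (subsets F) (λ S → ⟨ lowerTerms F S , (λ x → zeta K S (shift ∣ S ∣ x g)) ⟩) ∎

  ⟪Z⟫ : ∀ K {g} → Bounded K g → ⟪ Z M ⟫ K g ≡ zeta K ⊤ g
  ⟪Z⟫ K {g} v = begin
    ⟪ Z M ⟫ K g ≡⟨ ∑-cong (upTo K) (λ N → trans
        (∑-concatMap (λ w → shiftL (- (+ (rkM M ℕ.+ wt M w))) (χ (basesW M w))) (weightsOfSize n N) _)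
        (∑-cong (weightsOfSize n N) λ w → trans (⟨shiftL⟩ (- (+ (rkM M ℕ.+ wt M w))) (χ (basesW M w)) (g N))
          (trans (∑-map _ (allSubsets n) _) (trans (∑-allSubsets n _)
            (∑-cong (subsets ⊤) λ A → cong (λ x → sign ∣ A ∣ * g N x) (exponent w A)))))) ⟩
    ∑ (upTo K) (λ N → ∑ (weightsOfSize n N) (h N))
      ≡⟨ ∑-weightsOfSize n K h (λ N w le → ∑-zero (subsets ⊤) λ A →
           trans (cong (sign ∣ A ∣ *_) (v _ _ le)) (*-zeroʳ (sign ∣ A ∣))) ⟩
    zeta K ⊤ g ∎
    where
    h : ℕ → Vec ℕ n → ℤ
    h N w = ∑ (subsets ⊤) λ A → sign ∣ A ∣ * g N (- (+ ρ M w A))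
    lem : ∀ a b c → - (a + b) + (a - c) ≡ - (b + c)
    lem = solve-∀
    exponent : ∀ w A → - (+ (rkM M ℕ.+ wt M w)) + (+ rankOf (basesW M w) ⊤ - + rankOf (basesW M w) A) ≡ - (+ ρ M w A)
    exponent w A = trans
      (cong₂ (λ x y → - x + (+ y - + rankOf (basesW M w) A)) (ℤₚ.pos-+ (rkM M) (wt M w)) (rankOf-basesW-⊤ M w))
      (trans (lem (+ rkM M) (+ wt M w) (+ rankOf (basesW M w) A))
        (cong -_ (sym (ℤₚ.pos-+ (wt M w) (rankOf (basesW M w) A)))))

-- A rational expression for Z and its expansion at s = 0

⨁ : List A → (A → Expr) → Expr
⨁ xs f = foldr (λ x e → f x ⊕ e) (const []) xs

⟪⨁⟫ : ∀ (xs : List A) f K {g} → Bounded K g → ⟪ ⟦ ⨁ xs f ⟧ ⟫ K g ≡ ∑ xs (λ x → ⟪ ⟦ f x ⟧ ⟫ K g)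
⟪⨁⟫ [] f K v = trans (⟪const⟫ [] K v) (trans (∑-[] _) (sym (∑-[] _)))
⟪⨁⟫ (x ∷ xs) f K {g} v = trans (⟪⊕⟫ (f x) (⨁ xs f) K g)
  (trans (addˡ (⟪ ⟦ f x ⟧ ⟫ K g) (⟪⨁⟫ xs f K v)) (sym (∑-∷ x xs _)))

⟪const⊗⟫ : ∀ p e K {g} → Bounded K g →
  ⟪ ⟦ const p ⊗ e ⟧ ⟫ K g ≡ ⟨ p , (λ x → ⟪ ⟦ e ⟧ ⟫ K (shift 0 x g)) ⟩
⟪const⊗⟫ p e K v = trans (⟪⊗⟫ (const p) e K v) (⟪const⟫ p K (⟪shift⟫-Bounded ⟦ e ⟧ K v))

scale : ℤ → Laurent → Laurent
scale c = map λ (e , k) → e , c * k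

⟨scale⟩ : ∀ c p g → ⟨ scale c p , g ⟩ ≡ c * ⟨ p , g ⟩
⟨scale⟩ c p g = trans (∑-map _ p _) (trans (∑-cong p λ (e , k) → ℤₚ.*-assoc c k (g e)) (∑-*ˡ c p _))

⟨concatMap⟩ : ∀ (f : A → Laurent) xs g → ⟨ concatMap f xs , g ⟩ ≡ ∑ xs (λ x → ⟨ f x , g ⟩)
⟨concatMap⟩ f xs g = ∑-concatMap f xs _

F─F≡⊥ : (F : Subset n) → F ─ F ≡ ⊥
F─F≡⊥ [] = refl
F─F≡⊥ (inside ∷ F) = cong (outside ∷_) (F─F≡⊥ F)
F─F≡⊥ (outside ∷ F) = cong (outside ∷_) (F─F≡⊥ F)

∣F∣≡0⇒F≡⊥ : (F : Subset n) → ∣ F ∣ ≡ 0 → F ≡ ⊥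
∣F∣≡0⇒F≡⊥ [] eq = refl
∣F∣≡0⇒F≡⊥ (outside ∷ F) eq = cong (outside ∷_) (∣F∣≡0⇒F≡⊥ F eq)

proper-⊥ : ∀ n → proper (⊥ {n}) ≡ []
proper-⊥ zero = refl
proper-⊥ (suc n) = cong (map (outside ∷_)) (proper-⊥ n)

weights-⊥ : ∀ K n → weights K (⊥ {n}) ≡ replicate n 0 ∷ []
weights-⊥ K zero = refl
weights-⊥ K (suc n) = cong (map (0 ∷_)) (weights-⊥ K n)

∑-subsets-⊥ : ∀ (h : Subset n → ℤ) → ∑ (subsets ⊥) h ≡ h ⊥
∑-subsets-⊥ {n} h = trans (cong (λ l → ∑ (⊥ ∷ l) h) (proper-⊥ n)) (∑-singleton ⊥ h)

upper-self : ∀ (F : Subset n) f → upper F f F ≡ f F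
upper-self {n} F f = begin
  ∑ (subsets (F ─ F)) (λ C → sign ∣ C ∣ * f (C ∪ F))
    ≡⟨ cong (λ G → ∑ (subsets G) (λ C → sign ∣ C ∣ * f (C ∪ F))) (F─F≡⊥ F) ⟩
  ∑ (subsets ⊥) (λ C → sign ∣ C ∣ * f (C ∪ F)) ≡⟨ ∑-subsets-⊥ _ ⟩
  sign (∣ ⊥ {n} ∣) * f (⊥ ∪ F) ≡⟨ cong₂ (λ m G → sign m * f G) (Subₚ.∣⊥∣≡0 n) (Subₚ.∪-identityˡ F) ⟩
  1ℤ * f F ≡⟨ *-identityˡ (f F) ⟩
  f F ∎

-- First-order expansions at s = 0, with integral value and slope

record JetAt0 (e : Expr) (v d : ℤ) : Set where
  constructor at0
  field
    jet-μtop : Jet (μtop e) (ℤtoℚ v) (ℤtoℚ d)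

JetAt0-const : ∀ p {v} → evalAt1 p ≡ v → JetAt0 (const p) v 0ℤ
JetAt0-const p {v} refl = at0 ((λ ()) , sym (ℚₚ.*-identityʳ _) , lem (ℤtoℚ v))
  where
  lem : ∀ x → 0ℚ ≡ x ℚ.* 0ℚ ℚ.+ 0ℚ ℚ.* 1ℚ
  lem = solve-∀-in ℚ-ring

mulP₀≢0 : ∀ p r → coeffP p 0 ≢ 0ℚ → coeffP r 0 ≢ 0ℚ → coeffP (mulP p r) 0 ≢ 0ℚ
mulP₀≢0 p r p₀ r₀ eq = r₀ (x*y≡0⇒y≡0 _ _ p₀ (trans (sym (coeffP-mulP-0 p r)) eq))

JetAt0-⊕ : ∀ e f {v d v' d'} → JetAt0 e v d → JetAt0 f v' d' → JetAt0 (e ⊕ f) (v + v') (d + d')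
JetAt0-⊕ e f {v} {d} {v'} {d'} (at0 (x≢0 , a₀ , a₁)) (at0 (y≢0 , b₀ , b₁)) = at0 (mulP₀≢0 D D' x≢0 y≢0 ,
  (begin
    coeffP (addP (mulP N D') (mulP N' D)) 0
      ≡⟨ trans (coeffP-addP (mulP N D') _ 0) (cong₂ ℚ._+_ (coeffP-mulP-0 N D') (coeffP-mulP-0 N' D)) ⟩
    coeffP N 0 ℚ.* y₀ ℚ.+ coeffP N' 0 ℚ.* x₀ ≡⟨ cong₂ (λ p r → p ℚ.* y₀ ℚ.+ r ℚ.* x₀) a₀ b₀ ⟩
    (V ℚ.* x₀) ℚ.* y₀ ℚ.+ (V' ℚ.* y₀) ℚ.* x₀ ≡⟨ lem₀ V V' x₀ y₀ ⟩
    (V ℚ.+ V') ℚ.* (x₀ ℚ.* y₀) ≡⟨ cong₂ ℚ._*_ (ℤtoℚ-+ v v') (coeffP-mulP-0 D D') ⟨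
    ℤtoℚ (v + v') ℚ.* coeffP (mulP D D') 0 ∎) ,
  (begin
    coeffP (addP (mulP N D') (mulP N' D)) 1
      ≡⟨ trans (coeffP-addP (mulP N D') _ 1) (cong₂ ℚ._+_ (coeffP-mulP-1 N D') (coeffP-mulP-1 N' D)) ⟩
    (coeffP N 0 ℚ.* y₁ ℚ.+ coeffP N 1 ℚ.* y₀) ℚ.+ (coeffP N' 0 ℚ.* x₁ ℚ.+ coeffP N' 1 ℚ.* x₀)
      ≡⟨ cong₂ ℚ._+_ (cong₂ (λ p r → p ℚ.* y₁ ℚ.+ r ℚ.* y₀) a₀ a₁) (cong₂ (λ p r → p ℚ.* x₁ ℚ.+ r ℚ.* x₀) b₀ b₁) ⟩
    _ ≡⟨ lem₁ V V' W W' x₀ x₁ y₀ y₁ ⟩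
    (V ℚ.+ V') ℚ.* (x₀ ℚ.* y₁ ℚ.+ x₁ ℚ.* y₀) ℚ.+ (W ℚ.+ W') ℚ.* (x₀ ℚ.* y₀)
      ≡⟨ cong₂ ℚ._+_ (cong₂ ℚ._*_ (ℤtoℚ-+ v v') (coeffP-mulP-1 D D')) (cong₂ ℚ._*_ (ℤtoℚ-+ d d') (coeffP-mulP-0 D D')) ⟨
    ℤtoℚ (v + v') ℚ.* coeffP (mulP D D') 1 ℚ.+ ℤtoℚ (d + d') ℚ.* coeffP (mulP D D') 0 ∎))
  where
  N = proj₁ (μtop e)
  D = proj₂ (μtop e)
  N' = proj₁ (μtop f)
  D' = proj₂ (μtop f)
  x₀ = coeffP D 0
  x₁ = coeffP D 1
  y₀ = coeffP D' 0
  y₁ = coeffP D' 1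
  V = ℤtoℚ v
  V' = ℤtoℚ v'
  W = ℤtoℚ d
  W' = ℤtoℚ d'
  lem₀ : ∀ V V' x y → (V ℚ.* x) ℚ.* y ℚ.+ (V' ℚ.* y) ℚ.* x ≡ (V ℚ.+ V') ℚ.* (x ℚ.* y)
  lem₀ = solve-∀-in ℚ-ring
  lem₁ : ∀ V V' W W' x₀ x₁ y₀ y₁ →
    ((V ℚ.* x₀) ℚ.* y₁ ℚ.+ (V ℚ.* x₁ ℚ.+ W ℚ.* x₀) ℚ.* y₀) ℚ.+
    ((V' ℚ.* y₀) ℚ.* x₁ ℚ.+ (V' ℚ.* y₁ ℚ.+ W' ℚ.* y₀) ℚ.* x₀) ≡
    (V ℚ.+ V') ℚ.* (x₀ ℚ.* y₁ ℚ.+ x₁ ℚ.* y₀) ℚ.+ (W ℚ.+ W') ℚ.* (x₀ ℚ.* y₀)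
  lem₁ = solve-∀-in ℚ-ring

JetAt0-const⊗ : ∀ p e {c v d} → evalAt1 p ≡ c → JetAt0 e v d → JetAt0 (const p ⊗ e) (c * v) (c * d)
JetAt0-const⊗ p e {c} {v} {d} refl (at0 (x≢0 , a₀ , a₁)) = at0 (mulP₀≢0 (1ℚ ∷ []) D (λ ()) x≢0 ,
  (begin
    coeffP (mulP (C ∷ []) N) 0 ≡⟨ coeffP-mulP-0 (C ∷ []) N ⟩
    C ℚ.* coeffP N 0 ≡⟨ cong (C ℚ.*_) a₀ ⟩
    C ℚ.* (ℤtoℚ v ℚ.* coeffP D 0) ≡⟨ lem₀ C (ℤtoℚ v) (coeffP D 0) ⟩
    (C ℚ.* ℤtoℚ v) ℚ.* (1ℚ ℚ.* coeffP D 0) ≡⟨ cong₂ ℚ._*_ (ℤtoℚ-* c v) (coeffP-mulP-0 (1ℚ ∷ []) D) ⟨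
    ℤtoℚ (c * v) ℚ.* coeffP (mulP (1ℚ ∷ []) D) 0 ∎) ,
  (begin
    coeffP (mulP (C ∷ []) N) 1 ≡⟨ coeffP-mulP-1 (C ∷ []) N ⟩
    C ℚ.* coeffP N 1 ℚ.+ 0ℚ ℚ.* coeffP N 0 ≡⟨ cong (λ z → C ℚ.* z ℚ.+ 0ℚ ℚ.* coeffP N 0) a₁ ⟩
    C ℚ.* (ℤtoℚ v ℚ.* coeffP D 1 ℚ.+ ℤtoℚ d ℚ.* coeffP D 0) ℚ.+ 0ℚ ℚ.* coeffP N 0
      ≡⟨ lem₁ C (ℤtoℚ v) (ℤtoℚ d) (coeffP D 0) (coeffP D 1) (coeffP N 0) ⟩
    (C ℚ.* ℤtoℚ v) ℚ.* (1ℚ ℚ.* coeffP D 1 ℚ.+ 0ℚ ℚ.* coeffP D 0) ℚ.+ (C ℚ.* ℤtoℚ d) ℚ.* (1ℚ ℚ.* coeffP D 0)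
      ≡⟨ cong₂ ℚ._+_ (cong₂ ℚ._*_ (ℤtoℚ-* c v) (coeffP-mulP-1 (1ℚ ∷ []) D)) (cong₂ ℚ._*_ (ℤtoℚ-* c d) (coeffP-mulP-0 (1ℚ ∷ []) D)) ⟨
    _ ∎))
  where
  N = proj₁ (μtop e)
  D = proj₂ (μtop e)
  C = ℤtoℚ c
  lem₀ : ∀ c v x → c ℚ.* (v ℚ.* x) ≡ (c ℚ.* v) ℚ.* (1ℚ ℚ.* x)
  lem₀ = solve-∀-in ℚ-ring
  lem₁ : ∀ c v d x y z → c ℚ.* (v ℚ.* y ℚ.+ d ℚ.* x) ℚ.+ 0ℚ ℚ.* z ≡
    (c ℚ.* v) ℚ.* (1ℚ ℚ.* y ℚ.+ 0ℚ ℚ.* x) ℚ.+ (c ℚ.* d) ℚ.* (1ℚ ℚ.* x)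
  lem₁ = solve-∀-in ℚ-ring

JetAt0-⨁ : ∀ {P : A → Set} {xs : List A} {f : A → Expr} (v d : A → ℤ) → All P xs →
  (∀ {x} → P x → JetAt0 (f x) (v x) (d x)) → JetAt0 (⨁ xs f) (∑ xs v) (∑ xs d)
JetAt0-⨁ v d [] jet = subst₂ (JetAt0 (const [])) (sym (∑-[] v)) (sym (∑-[] d)) (JetAt0-const [] refl)
JetAt0-⨁ {xs = x ∷ xs} {f} v d (p ∷ ps) jet = subst₂ (JetAt0 (f x ⊕ ⨁ xs f)) (sym (∑-∷ x xs v)) (sym (∑-∷ x xs d))
  (JetAt0-⊕ (f x) (⨁ xs f) (jet p) (JetAt0-⨁ v d ps jet))

-- (a s + r)(1 − a s) = r − a (r − 1) s + O(s²)
JetAt0-gen⊗ : ∀ a .{{_ : ℕ.NonZero a}} r e → r ≢ 0 → JetAt0 e (+ r) (+ a - + a * + r) →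
  JetAt0 (gen a (- (+ r)) ⊗ e) 1ℤ (- (+ a))
JetAt0-gen⊗ a r e r≢0 (at0 (x≢0 , a₀ , a₁)) = at0 (mulP₀≢0 G D G₀≢0 x≢0 ,
  (begin
    coeffP (mulP (1ℚ ∷ []) N) 0 ≡⟨ trans (coeffP-mulP-0 (1ℚ ∷ []) N) (cong (1ℚ ℚ.*_) a₀) ⟩
    1ℚ ℚ.* (R ℚ.* x₀) ≡⟨ cong (1ℚ ℚ.*_) (trans (coeffP-mulP-0 G D) (cong (ℚ._* x₀) G₀≡R)) ⟨
    ℤtoℚ 1ℤ ℚ.* coeffP (mulP G D) 0 ∎) ,
  (begin
    coeffP (mulP (1ℚ ∷ []) N) 1 ≡⟨ trans (coeffP-mulP-1 (1ℚ ∷ []) N) (cong (λ z → 1ℚ ℚ.* z ℚ.+ 0ℚ ℚ.* coeffP N 0) a₁) ⟩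
    1ℚ ℚ.* (R ℚ.* x₁ ℚ.+ ℤtoℚ (+ a - + a * + r) ℚ.* x₀) ℚ.+ 0ℚ ℚ.* coeffP N 0
      ≡⟨ cong (λ z → 1ℚ ℚ.* (R ℚ.* x₁ ℚ.+ z ℚ.* x₀) ℚ.+ 0ℚ ℚ.* coeffP N 0)
           (trans (ℤtoℚ-+ (+ a) (- (+ a * + r))) (cong (A' ℚ.+_) (trans (ℤtoℚ-neg (+ a * + r)) (cong ℚ.-_ (ℤtoℚ-* (+ a) (+ r)))))) ⟩
    1ℚ ℚ.* (R ℚ.* x₁ ℚ.+ (A' ℚ.- A' ℚ.* R) ℚ.* x₀) ℚ.+ 0ℚ ℚ.* coeffP N 0 ≡⟨ lem₁ R A' x₀ x₁ (coeffP N 0) ⟩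
    1ℚ ℚ.* (R ℚ.* x₁ ℚ.+ A' ℚ.* x₀) ℚ.+ ℚ.- A' ℚ.* (R ℚ.* x₀)
      ≡⟨ cong₂ ℚ._+_ (cong (1ℚ ℚ.*_) (trans (coeffP-mulP-1 G D) (cong (λ z → z ℚ.* x₁ ℚ.+ A' ℚ.* x₀) G₀≡R)))
           (cong₂ ℚ._*_ (ℤtoℚ-neg (+ a)) (trans (coeffP-mulP-0 G D) (cong (ℚ._* x₀) G₀≡R))) ⟨
    ℤtoℚ 1ℤ ℚ.* coeffP (mulP G D) 1 ℚ.+ ℤtoℚ (- (+ a)) ℚ.* coeffP (mulP G D) 0 ∎))
  where
  N = proj₁ (μtop e)
  D = proj₂ (μtop e)
  x₀ = coeffP D 0
  x₁ = coeffP D 1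
  R = ℤtoℚ (+ r)
  A' = ℤtoℚ (+ a)
  G = ℚ.- ℤtoℚ (- (+ r)) ∷ A' ∷ []
  G₀≡R : coeffP G 0 ≡ R
  G₀≡R = trans (sym (ℤtoℚ-neg (- (+ r)))) (cong ℤtoℚ (ℤₚ.neg-involutive (+ r)))
  G₀≢0 : coeffP G 0 ≢ 0ℚ
  G₀≢0 eq = r≢0 (ℤₚ.+-injective (ℤtoℚ-injective (+ r) 0ℤ (trans (sym G₀≡R) eq)))
  lem₁ : ∀ R a x₀ x₁ z → 1ℚ ℚ.* (R ℚ.* x₁ ℚ.+ (a ℚ.- a ℚ.* R) ℚ.* x₀) ℚ.+ 0ℚ ℚ.* z ≡
    1ℚ ℚ.* (R ℚ.* x₁ ℚ.+ a ℚ.* x₀) ℚ.+ ℚ.- a ℚ.* (R ℚ.* x₀)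
  lem₁ = solve-∀-in ℚ-ring

-- The recursive expression for Z, its correctness and its expansion

module _ (M : Matroid n) where

  private
    r : Subset n → ℕ
    r = rk M

  ⟨lowerTerms⟩ : ∀ F S g → ⟨ lowerTerms M F S , g ⟩ ≡ upper F (λ X → g (- (+ r X))) S
  ⟨lowerTerms⟩ F S g = ∑-map _ (subsets (F ─ S)) _

  ⟨lowerTerms⟩-self : ∀ F g → ⟨ lowerTerms M F F , g ⟩ ≡ g (- (+ r F))
  ⟨lowerTerms⟩-self F g = trans (⟨lowerTerms⟩ F F g) (upper-self F λ X → g (- (+ r X)))

  -- lowerTerms divided by q − 1
  quotientTerms : Subset n → Subset n → Laurent
  quotientTerms F S = concatMap (λ C → scale (sign ∣ C ∣) (geo (- (+ r (C ∪ S))))) (subsets (F ─ S))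

  -- Each power q^(-r) is replaced by (q^(-r) - 1)/(q - 1); the subtracted ones cancel because their
  -- signs sum to 0.
  ⟨quotientTerms⟩ : ∀ {F S} → S ⊑ F → ∣ S ∣ ℕ.< ∣ F ∣ → ∀ g →
    ⟨ quotientTerms F S , Δ g ⟩ ≡ ⟨ lowerTerms M F S , g ⟩
  ⟨quotientTerms⟩ {F} {S} S⊑F lt g = begin
    ⟨ quotientTerms F S , Δ g ⟩ ≡⟨ ⟨concatMap⟩ _ (subsets (F ─ S)) (Δ g) ⟩
    ∑ (subsets (F ─ S)) (λ C → ⟨ scale (sign ∣ C ∣) (geo (- (+ r (C ∪ S)))) , Δ g ⟩)
      ≡⟨ ∑-cong (subsets (F ─ S)) (λ C → trans (⟨scale⟩ (sign ∣ C ∣) (geo (- (+ r (C ∪ S)))) (Δ g))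
           (trans (cong (sign ∣ C ∣ *_) (⟨geo⟩ (- (+ r (C ∪ S))) g)) (lem (sign ∣ C ∣) _ (g 0ℤ)))) ⟩
    ∑ (subsets (F ─ S)) (λ C → sign ∣ C ∣ * g (- (+ r (C ∪ S))) - g 0ℤ * sign ∣ C ∣)
      ≡⟨ ∑-minus (subsets (F ─ S)) _ _ ⟩
    ∑ (subsets (F ─ S)) (λ C → sign ∣ C ∣ * g (- (+ r (C ∪ S)))) - ∑ (subsets (F ─ S)) (λ C → g 0ℤ * sign ∣ C ∣)
      ≡⟨ +zero _ (cong -_ (trans (∑-*ˡ (g 0ℤ) (subsets (F ─ S)) _)
           (trans (cong (g 0ℤ *_) (∑-sign-proper S⊑F lt)) (*-zeroʳ (g 0ℤ))))) ⟩
    ∑ (subsets (F ─ S)) (λ C → sign ∣ C ∣ * g (- (+ r (C ∪ S)))) ≡⟨ ⟨lowerTerms⟩ F S g ⟨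
    ⟨ lowerTerms M F S , g ⟩ ∎
    where
    lem : ∀ s a b → s * (a - b) ≡ s * a - b * s
    lem = solve-∀

  -- c′(F, S): besides the division by q - 1 there is a factor q^(r S), because the recursion is
  -- written in Y_S, which carries q^(-r S).
  coefficient : Subset n → Subset n → Laurent
  coefficient F S = shiftL (+ r S) (quotientTerms F S)

  below : (Subset n → Expr) → Subset n → Expr
  below y F = ⨁ (proper F) λ S → const (coefficient F S) ⊗ y S

  -- The first argument is `∣ F ∣`, passed separately so that matching on `suc m` shows the
  -- T-exponent of the generator to be nonzero.
  step : ℕ → (Subset n → Expr) → Subset n → Expr
  step zero y F = const ((0ℤ , 1ℤ) ∷ [])
  step (suc m) y F = gen (suc m) (- (+ r F)) ⊗ below y F

  -- The part of the zeta function of the restriction to F coming from w with support exactly F;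
  -- k bounds ∣ F ∣.
  flagExpr : ℕ → Subset n → Expr
  flagExpr zero F = const ((0ℤ , 1ℤ) ∷ [])
  flagExpr (suc k) F = step ∣ F ∣ (flagExpr k) F

  -- `y F` is an expression for Y_F = q^(-r F) T^|F| Z_F.
  Represents : (Subset n → Expr) → Subset n → Set
  Represents y F = ∀ K {g} → Bounded K g → ⟪ ⟦ y F ⟧ ⟫ K g ≡ zeta M K F (shift ∣ F ∣ (- (+ r F)) g)

  -- In terms of series, (q - 1) · `below y F` = Z_F - Y_F: these are the terms S ≠ F of `zeta-rec`.
  ⟪below⟫ : ∀ y F → (∀ {S} → ∣ S ∣ ℕ.< ∣ F ∣ → Represents y S) → ∀ K {h} → Bounded K h →
    ⟪ ⟦ below y F ⟧ ⟫ K (λ N → Δ (h N)) ≡ zeta M K F h - zeta M K F (shift ∣ F ∣ (- (+ r F)) h)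
  ⟪below⟫ y F rep K {h} v = begin
    ⟪ ⟦ below y F ⟧ ⟫ K Δh ≡⟨ ⟪⨁⟫ (proper F) (λ S → const (coefficient F S) ⊗ y S) K Δv ⟩
    ∑ (proper F) (λ S → ⟪ ⟦ const (coefficient F S) ⊗ y S ⟧ ⟫ K Δh) ≡⟨ ∑-cong-All (proper-⊏ F) term ⟩
    ∑ (proper F) t ≡⟨ lem (t F) (∑ (proper F) t) ⟩
    (t F + ∑ (proper F) t) - t F ≡⟨ cong₂ _-_ (trans (sym (∑-∷ F (proper F) t)) (sym (zeta-rec M K F v))) tF ⟩
    zeta M K F h - zeta M K F (shift ∣ F ∣ (- (+ r F)) h) ∎
    where
    Δh : Test
    Δh N = Δ (h N)
    Δv : Bounded K Δh
    Δv N x le = cong₂ _-_ (v N (x + 1ℤ) le) (v N x le)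
    t : Subset n → ℤ
    t S = ⟨ lowerTerms M F S , (λ x → zeta M K S (shift ∣ S ∣ x h)) ⟩
    lem : ∀ a b → b ≡ (a + b) - a
    lem = solve-∀
    tF : t F ≡ zeta M K F (shift ∣ F ∣ (- (+ r F)) h)
    tF = ⟨lowerTerms⟩-self F _
    term : ∀ {S} → S ⊑ F × ∣ S ∣ ℕ.< ∣ F ∣ → ⟪ ⟦ const (coefficient F S) ⊗ y S ⟧ ⟫ K Δh ≡ t S
    term {S} (S⊑F , lt) = begin
      ⟪ ⟦ const (coefficient F S) ⊗ y S ⟧ ⟫ K Δh ≡⟨ ⟪const⊗⟫ (coefficient F S) (y S) K Δv ⟩
      ⟨ coefficient F S , (λ x → ⟪ ⟦ y S ⟧ ⟫ K (shift 0 x Δh)) ⟩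
        ≡⟨ trans (⟨shiftL⟩ (+ r S) (quotientTerms F S) _)
             (⟨⟩-cong (quotientTerms F S) λ x → rep lt K (Bounded-shift 0 (+ r S + x) Δv)) ⟩
      ⟨ quotientTerms F S , (λ x → zeta M K S (shift ∣ S ∣ (- (+ r S)) (shift 0 (+ r S + x) Δh))) ⟩
        -- The shift by r S in `coefficient` cancels the one in Y_S, leaving a difference in x,
        -- which restores the factor q - 1.
        ≡⟨ ⟨⟩-cong (quotientTerms F S) (λ x → trans
             (zeta-cong M K S λ N z → cong₂ (λ a b → h (∣ S ∣ ℕ.+ N) a - h (∣ S ∣ ℕ.+ N) b)
               (assoc₁ (+ r S) x z) (assoc₀ (+ r S) x z))
             (zeta-minus M K S (shift ∣ S ∣ (x + 1ℤ) h) (shift ∣ S ∣ x h))) ⟩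
      ⟨ quotientTerms F S , Δ (λ x → zeta M K S (shift ∣ S ∣ x h)) ⟩ ≡⟨ ⟨quotientTerms⟩ S⊑F lt _ ⟩
      t S ∎
      where
      assoc₁ : ∀ a x z → (a + x) + (- a + z) + 1ℤ ≡ (x + 1ℤ) + z
      assoc₁ = solve-∀
      assoc₀ : ∀ a x z → (a + x) + (- a + z) ≡ x + z
      assoc₀ = solve-∀

  -- The difference of the two sides is unchanged under g ↦ shift (suc m) (- (+ r F)) g, and iterating
  -- that shift eventually annihilates g.
  step-represents : ∀ m y F → ∣ F ∣ ≡ suc m → (∀ {S} → ∣ S ∣ ℕ.< ∣ F ∣ → Represents y S) →
    ∀ K j {g} → Bounded j g → Bounded K g →
    ⟪ ⟦ step (suc m) y F ⟧ ⟫ K g ≡ zeta M K F (shift (suc m) (- (+ r F)) g)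
  step-represents m y F size rep K zero v w = trans
    (⟪⟫-zero ⟦ step (suc m) y F ⟧ K (λ N x → v N x z≤n)) (sym (zeta-zero M K F λ N x → v (suc m ℕ.+ N) (- (+ r F) + x) z≤n))
  step-represents m y F size rep K (suc j) {g} v w = begin
    ⟪ ⟦ gen a b ⊗ below y F ⟧ ⟫ K g ≡⟨ ⟪⊗⟫ (gen a b) (below y F) K w ⟩
    ⟪ ⟦ gen a b ⟧ ⟫ K (G g) ≡⟨ ⟪gen⟫ a b K (⟪shift⟫-Bounded ⟦ below y F ⟧ K w) ⟩
    (G g a (b + 1ℤ) - G g a b) + ⟪ ⟦ gen a b ⟧ ⟫ K (shift a b (G g))
      ≡⟨ cong₂ _+_ jump (trans (⟪⟫-cong ⟦ gen a b ⟧ K λ N x → ⟪⟫-cong ⟦ below y F ⟧ K λ L z →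
             cong₂ g (ℕₚ.+-assoc a N L) (+-assoc b x z))
           (trans (sym (⟪⊗⟫ (gen a b) (below y F) K w'))
             (step-represents m y F size rep K j v' w'))) ⟩
    (zeta M K F g' - zeta M K F (shift a b g')) + zeta M K F (shift a b g') ≡⟨ lem (zeta M K F g') (zeta M K F (shift a b g')) ⟩
    zeta M K F g' ∎
    where
    a = suc m
    b = - (+ r F)
    g' = shift a b g
    G : Test → Test
    G h N x = ⟪ ⟦ below y F ⟧ ⟫ K (shift N x h)
    w' : Bounded K g'
    w' = Bounded-shift a b w
    v' : Bounded j g'
    -- A shift by `a ≥ 1` in T-degree lowers the bound `j`, which drives the induction, while the
    -- truncation `K` stays fixed.
    v' N x le = v (a ℕ.+ N) (b + x) (s≤s (ℕₚ.≤-trans le (ℕₚ.m≤n+m N m)))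
    lem : ∀ p q → (p - q) + q ≡ p
    lem = solve-∀
    -- The numerator (q - 1) q^b T^a of the generator, applied to `below y F`: its factor q - 1 is
    -- what `⟪below⟫` asks for.
    jump : G g a (b + 1ℤ) - G g a b ≡ zeta M K F g' - zeta M K F (shift a b g')
    jump = begin
      G g a (b + 1ℤ) - G g a b ≡⟨ ⟪⟫-minus ⟦ below y F ⟧ K (shift a (b + 1ℤ) g) (shift a b g) ⟨
      ⟪ ⟦ below y F ⟧ ⟫ K (λ N x → shift a (b + 1ℤ) g N x - shift a b g N x)
        ≡⟨ ⟪⟫-cong ⟦ below y F ⟧ K (λ N x → cong (λ z → g (a ℕ.+ N) z - g (a ℕ.+ N) (b + x)) (assoc b x)) ⟩
      ⟪ ⟦ below y F ⟧ ⟫ K (λ N → Δ (g' N)) ≡⟨ ⟪below⟫ y F rep K w' ⟩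
      zeta M K F g' - zeta M K F (shift ∣ F ∣ b g') ≡⟨ cong (λ c → zeta M K F g' - zeta M K F (shift c b g')) size ⟩
      zeta M K F g' - zeta M K F (shift a b g') ∎
      where
      assoc : ∀ b x → (b + 1ℤ) + x ≡ b + (x + 1ℤ)
      assoc = solve-∀

  empty-represents : ∀ F → ∣ F ∣ ≡ 0 → ∀ K {g} → Bounded K g →
    ⟪ ⟦ const ((0ℤ , 1ℤ) ∷ []) ⟧ ⟫ K g ≡ zeta M K F (shift ∣ F ∣ (- (+ r F)) g)
  empty-represents F size K {g} v with refl ← ∣F∣≡0⇒F≡⊥ F size = begin
    ⟪ ⟦ const ((0ℤ , 1ℤ) ∷ []) ⟧ ⟫ K g ≡⟨ trans (⟪const⟫ ((0ℤ , 1ℤ) ∷ []) K v) (⟨single⟩ 0ℤ (g 0)) ⟩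
    g 0 0ℤ ≡⟨ cong₂ g (cong₂ ℕ._+_ (Subₚ.∣⊥∣≡0 n) (sum-replicate-zero n))
               (cong₂ (λ p q → - (+ p) + - (+ q)) (rk-⊥ M) (ρ-zero M)) ⟨
    h (sum (replicate n 0)) (- (+ ρ M (replicate n 0) ⊥)) ≡⟨ *-identityˡ _ ⟨
    1ℤ * h (sum (replicate n 0)) (- (+ ρ M (replicate n 0) ⊥)) ≡⟨ cong (λ m → sign m * h (sum (replicate n 0)) (- (+ ρ M (replicate n 0) ⊥))) (Subₚ.∣⊥∣≡0 n) ⟨
    sign ∣ ⊥ {n} ∣ * h (sum (replicate n 0)) (- (+ ρ M (replicate n 0) ⊥)) ≡⟨ ∑-subsets-⊥ (λ A → sign ∣ A ∣ * h (sum (replicate n 0)) (- (+ ρ M (replicate n 0) A))) ⟨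
    ∑ (subsets ⊥) (λ A → sign ∣ A ∣ * h (sum (replicate n 0)) (- (+ ρ M (replicate n 0) A))) ≡⟨ ∑-singleton (replicate n 0) _ ⟨
    _ ≡⟨ cong (λ l → ∑ l (λ w → ∑ (subsets ⊥) (λ A → sign ∣ A ∣ * h (sum w) (- (+ ρ M w A))))) (weights-⊥ K n) ⟨
    zeta M K ⊥ h ∎
    where
    h = shift ∣ ⊥ {n} ∣ (- (+ r ⊥)) g
    sum-replicate-zero : ∀ n → sum (replicate n 0) ≡ 0
    sum-replicate-zero zero = refl
    sum-replicate-zero (suc n) = sum-replicate-zero n

  flagExpr-represents : ∀ k F → ∣ F ∣ ℕ.≤ k → Represents (flagExpr k) F
  flagExpr-represents zero F le = empty-represents F (ℕₚ.n≤0⇒n≡0 le)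
  flagExpr-represents (suc k) F le = go ∣ F ∣ refl
    where
    go : ∀ m → ∣ F ∣ ≡ m → ∀ K {g} → Bounded K g →
      ⟪ ⟦ step m (flagExpr k) F ⟧ ⟫ K g ≡ zeta M K F (shift ∣ F ∣ (- (+ r F)) g)
    go zero size = empty-represents F size
    go (suc m) size K {g} v = trans
      (step-represents m (flagExpr k) F size
        (λ {S} lt → flagExpr-represents k S (ℕₚ.≤-pred (ℕₚ.≤-trans lt le))) K K v v)
      (cong (λ c → zeta M K F (shift c (- (+ r F)) g)) (sym size))

  -- The coefficient is c(⊤, S) q^(r S), not divided by q - 1. For proper `S` it vanishes at q = 1,
  -- so the term contributes nothing to the expansion at 0.
  rest : Subset n → Expr
  rest S = const (shiftL (+ r S) (lowerTerms M ⊤ S)) ⊗ flagExpr n S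

  zetaExpr : Expr
  zetaExpr = flagExpr n ⊤ ⊕ ⨁ (proper ⊤) rest

  zetaExpr-represents : ⟦ zetaExpr ⟧ ≈S Z M
  zetaExpr-represents = ⟪⟫⇒≈S ⟦ zetaExpr ⟧ (Z M) λ K {g} v → begin
    ⟪ ⟦ zetaExpr ⟧ ⟫ K g ≡⟨ ⟪⊕⟫ (flagExpr n ⊤) (⨁ (proper ⊤) rest) K g ⟩
    _ ≡⟨ cong₂ _+_ (trans (flagExpr-represents n ⊤ (Subₚ.∣p∣≤n ⊤) K v) (sym (top K g)))
          (trans (⟪⨁⟫ (proper ⊤) rest K v) (∑-cong (proper ⊤) λ S → term S K v)) ⟩
    t K g ⊤ + ∑ (proper ⊤) (t K g) ≡⟨ ∑-∷ ⊤ (proper ⊤) (t K g) ⟨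
    ∑ (subsets ⊤) (t K g) ≡⟨ zeta-rec M K ⊤ v ⟨
    zeta M K ⊤ g ≡⟨ ⟪Z⟫ M K v ⟨
    ⟪ Z M ⟫ K g ∎
    where
    t : ℕ → Test → Subset n → ℤ
    t K g S = ⟨ lowerTerms M ⊤ S , (λ x → zeta M K S (shift ∣ S ∣ x g)) ⟩
    top : ∀ K g → t K g ⊤ ≡ zeta M K ⊤ (shift ∣ ⊤ {n} ∣ (- (+ r ⊤)) g)
    top K g = ⟨lowerTerms⟩-self ⊤ _
    term : ∀ S K {g} → Bounded K g → ⟪ ⟦ rest S ⟧ ⟫ K g ≡ t K g S
    term S K {g} v = trans (⟪const⊗⟫ (shiftL (+ r S) (lowerTerms M ⊤ S)) (flagExpr n S) K v)
      (trans (⟨shiftL⟩ (+ r S) (lowerTerms M ⊤ S) _) (⟨⟩-cong (lowerTerms M ⊤ S) λ x →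
        trans (flagExpr-represents n S (Subₚ.∣p∣≤n S) K (Bounded-shift 0 (+ r S + x) v))
          (zeta-cong M K S λ N z → cong (g (∣ S ∣ ℕ.+ N)) (assoc₀ (+ r S) x z))))
      where
      assoc₀ : ∀ a x z → (a + x) + (- a + z) ≡ x + z
      assoc₀ = solve-∀

  -- `geo m` takes the value m at q = 1, so the powers q^(-r) turn into -r.
  evalAt1-coefficient : ∀ F S → evalAt1 (coefficient F S) ≡ - upper F (λ X → + r X) S
  evalAt1-coefficient F S = begin
    evalAt1 (coefficient F S) ≡⟨ trans (evalAt1-⟨⟩ (coefficient F S)) (⟨shiftL⟩ (+ r S) (quotientTerms F S) (λ _ → 1ℤ)) ⟩
    ⟨ quotientTerms F S , (λ _ → 1ℤ) ⟩ ≡⟨ ⟨concatMap⟩ _ (subsets (F ─ S)) (λ _ → 1ℤ) ⟩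
    ∑ (subsets (F ─ S)) (λ C → ⟨ scale (sign ∣ C ∣) (geo (- (+ r (C ∪ S)))) , (λ _ → 1ℤ) ⟩)
      ≡⟨ ∑-cong (subsets (F ─ S)) (λ C → trans (⟨scale⟩ (sign ∣ C ∣) (geo (- (+ r (C ∪ S)))) (λ _ → 1ℤ))
           (trans (cong (sign ∣ C ∣ *_) (geo-at-1 (- (+ r (C ∪ S))))) (sym (ℤₚ.neg-distribʳ-* (sign ∣ C ∣) _)))) ⟩
    ∑ (subsets (F ─ S)) (λ C → - (sign ∣ C ∣ * + r (C ∪ S))) ≡⟨ ∑-neg (subsets (F ─ S)) _ ⟩
    - upper F (λ X → + r X) S ∎

  -- Over all subsets of `F`, the Möbius inverse `u` of the rank sums to r(∅) = 0, and weighted by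
  -- |S| to |F|. Removing the term S = F, where u = r F, and changing the sign of `u` gives the
  -- value; in the slope that sign meets the one in -|S|.
  below-jet : ∀ y F → Loopless M → (∀ {S} → ∣ S ∣ ℕ.< ∣ F ∣ → JetAt0 (y S) 1ℤ (- (+ ∣ S ∣))) →
    JetAt0 (below y F) (+ r F) (+ ∣ F ∣ - + ∣ F ∣ * + r F)
  below-jet y F loopless jets = subst₂ (JetAt0 (below y F)) values slopes
    (JetAt0-⨁ (λ S → - u S * 1ℤ) (λ S → - u S * - (+ ∣ S ∣)) (proper-⊏ F)
      λ {S} (_ , lt) → JetAt0-const⊗ (coefficient F S) (y S) (evalAt1-coefficient F S) (jets lt))
    where
    u : Subset n → ℤ
    r' : Subset n → ℤ
    r' X = + r X
    u = upper F r'
    proper-sum : ∀ f {x} → ∑ (subsets F) f ≡ x → ∑ (proper F) f ≡ x - f F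
    proper-sum f refl = trans (lem (f F) (∑ (proper F) f)) (cong (_- f F) (sym (∑-∷ F (proper F) f)))
      where
      lem : ∀ a b → b ≡ (a + b) - a
      lem = solve-∀
    values : ∑ (proper F) (λ S → - u S * 1ℤ) ≡ + r F
    values = begin
      ∑ (proper F) (λ S → - u S * 1ℤ) ≡⟨ trans (∑-cong (proper F) λ S → ℤₚ.*-identityʳ (- u S)) (∑-neg (proper F) u) ⟩
      - ∑ (proper F) u ≡⟨ cong -_ (proper-sum u (trans (∑-upper F r') (cong +_ (rk-⊥ M)))) ⟩
      - (0ℤ - u F) ≡⟨ cong (λ x → - (0ℤ - x)) (upper-self F r') ⟩
      - (0ℤ - + r F) ≡⟨ lem (+ r F) ⟩
      + r F ∎
      where
      lem : ∀ x → - (0ℤ - x) ≡ x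
      lem = solve-∀
    slopes : ∑ (proper F) (λ S → - u S * - (+ ∣ S ∣)) ≡ + ∣ F ∣ - + ∣ F ∣ * + r F
    slopes = begin
      ∑ (proper F) (λ S → - u S * - (+ ∣ S ∣)) ≡⟨ ∑-cong (proper F) (λ S → lem (u S) (+ ∣ S ∣)) ⟩
      ∑ (proper F) (λ S → + ∣ S ∣ * u S)
        ≡⟨ proper-sum (λ S → + ∣ S ∣ * u S) (∑-size-upper F r' λ e → cong +_ (loopless e)) ⟩
      + ∣ F ∣ - + ∣ F ∣ * u F ≡⟨ cong (λ x → + ∣ F ∣ - + ∣ F ∣ * x) (upper-self F r') ⟩
      + ∣ F ∣ - + ∣ F ∣ * + r F ∎
      where
      lem : ∀ a b → - a * - b ≡ b * a
      lem = solve-∀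

  flagExpr-jet : Loopless M → ∀ k F → ∣ F ∣ ℕ.≤ k → JetAt0 (flagExpr k F) 1ℤ (- (+ ∣ F ∣))
  flagExpr-jet loopless = jet
    where
    empty-jet : ∀ F → ∣ F ∣ ≡ 0 → JetAt0 (const ((0ℤ , 1ℤ) ∷ [])) 1ℤ (- (+ ∣ F ∣))
    empty-jet F size = subst (λ m → JetAt0 (const ((0ℤ , 1ℤ) ∷ [])) 1ℤ (- (+ m))) (sym size)
      (JetAt0-const ((0ℤ , 1ℤ) ∷ []) refl)
    jet : ∀ k F → ∣ F ∣ ℕ.≤ k → JetAt0 (flagExpr k F) 1ℤ (- (+ ∣ F ∣))
    jet zero F le = empty-jet F (ℕₚ.n≤0⇒n≡0 le)
    jet (suc k) F le = go ∣ F ∣ refl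
      where
      go : ∀ m → ∣ F ∣ ≡ m → JetAt0 (step m (flagExpr k) F) 1ℤ (- (+ ∣ F ∣))
      go zero size = empty-jet F size
      go (suc m) size = subst (λ c → JetAt0 (step (suc m) (flagExpr k) F) 1ℤ (- (+ c))) (sym size)
        (JetAt0-gen⊗ (suc m) (r F) (below (flagExpr k) F) (rank-nonzero M loopless F size)
          (subst (λ c → JetAt0 (below (flagExpr k) F) (+ r F) (+ c - + c * + r F)) size
            (below-jet (flagExpr k) F loopless λ {S} lt → jet k S (ℕₚ.≤-pred (ℕₚ.≤-trans lt le)))))

  zetaExpr-jet : Loopless M → JetAt0 zetaExpr 1ℤ (- (+ n))
  zetaExpr-jet loopless = subst₂ (JetAt0 zetaExpr) (+zero 1ℤ (∑-zero (proper ⊤) λ _ → refl))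
    (trans (+zero _ (∑-zero (proper ⊤) λ S → *-zeroˡ (- (+ ∣ S ∣)))) (cong (λ m → - (+ m)) (Subₚ.∣⊤∣≡n n)))
    (JetAt0-⊕ (flagExpr n ⊤) (⨁ (proper ⊤) rest) (flagExpr-jet loopless n ⊤ (Subₚ.∣p∣≤n ⊤))
      (JetAt0-⨁ (λ S → 0ℤ * 1ℤ) (λ S → 0ℤ * - (+ ∣ S ∣)) (proper-⊏ ⊤) λ {S} (S⊑⊤ , lt) →
        JetAt0-const⊗ (shiftL (+ r S) (lowerTerms M ⊤ S)) (flagExpr n S) (vanishes S S⊑⊤ lt)
          (flagExpr-jet loopless n S (Subₚ.∣p∣≤n S))))
    where
    vanishes : ∀ S → S ⊑ ⊤ → ∣ S ∣ ℕ.< ∣ ⊤ {n} ∣ → evalAt1 (shiftL (+ r S) (lowerTerms M ⊤ S)) ≡ 0ℤ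
    vanishes S S⊑⊤ lt = begin
      evalAt1 (shiftL (+ r S) (lowerTerms M ⊤ S))
        ≡⟨ trans (evalAt1-⟨⟩ (shiftL (+ r S) (lowerTerms M ⊤ S))) (⟨shiftL⟩ (+ r S) (lowerTerms M ⊤ S) (λ _ → 1ℤ)) ⟩
      ⟨ lowerTerms M ⊤ S , (λ _ → 1ℤ) ⟩ ≡⟨ ⟨lowerTerms⟩ ⊤ S (λ _ → 1ℤ) ⟩
      ∑ (subsets (⊤ ─ S)) (λ C → sign ∣ C ∣ * 1ℤ) ≡⟨ ∑-cong (subsets (⊤ ─ S)) (λ C → ℤₚ.*-identityʳ (sign ∣ C ∣)) ⟩
      ∑ (subsets (⊤ ─ S)) (λ C → sign ∣ C ∣) ≡⟨ ∑-sign-proper S⊑⊤ lt ⟩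
      0ℤ ∎

theorem1p5 : ∀ {n : ℕ} (M : Matroid n) → Loopless M →
    (Σ[ e ∈ Expr ] (⟦ e ⟧ ≈S Z M)) ×
    (∀ (e : Expr) → ⟦ e ⟧ ≈S Z M → ValDerivAt0 (μtop e) 1ℚ (ℚneg (ℤtoℚ (+ n))))
theorem1p5 {n} M loopless = (zetaExpr M , zetaExpr-represents M) , λ e e≈Z →
  -- The expansion is known for one expression; any `e` with the same series inherits it.
  ValDerivAt0-transfer e (zetaExpr M)
    (λ N j → trans (e≈Z N j) (sym (zetaExpr-represents M N j)))
    (subst (Jet (μtop (zetaExpr M)) 1ℚ) (ℤtoℚ-neg (+ n)) (JetAt0.jet-μtop (zetaExpr-jet M loopless)))
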